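{- Let $\Phi=\phi_1\wedge\cdots\wedge\phi_m$ be an extremal instance over variables $\mathbf X=(X_1,\dots,X_n)$ with product distribution $\mathcal D$, and suppose $\Phi$ is satisfiable, i.e. $\Pr_{\mathcal D}(\Phi(\mathbf X))>0$. Then $\mathrm{PRS}(\Phi,\mathcal D)$ terminates with probability $1$, whatever rule is used to choose the false clause in each iteration. On termination, $\mathbf X$ is distributed according to $\mathcal D_\Phi$, the distribution $\mathcal D$ conditioned on $\Phi(\mathbf X)$ being true.
   Context: Setting: For $i\in[n]$, $X_i$ takes values in a countable set $D_i$ equipped with a probability distribution $\mathcal D_i$; $\mathcal D=\mathcal D_1\times\cdots\times\mathcal D_n$ is the product distribution. A formula $\Phi=\phi_1\wedge\cdots\wedge\phi_m$ is a conjunction of clauses. Each clause $\phi_k$ is a Boolean function of the variables $X_i$ with $i\in\mathrm{Scp}(\phi_k)$, where $\mathrm{Scp}(\phi_k)\subseteq[n]$ is a nonempty set called the scope of $\phi_k$. The instance $\Phi$ is extremal if for all $1\le k<\ell\le m$ with $\mathrm{Scp}(\phi_k)\cap\mathrm{Scp}(\phi_\ell)\neq\emptyset$, the formula $\phi_k\vee\phi_\ell$ is true under every assignment, i.e. two clauses sharing a variable are never simultaneously false. Algorithm $\mathrm{PRS}(\Phi,\mathcal D)$ (Partial Rejection Sampling): sample $\mathbf X$ from $\mathcal D$. While $\Phi(\mathbf X)$ is false, choose any clause $\phi_k$ that is false under the current $\mathbf X$ and resample all variables $X_i$, $i\in\mathrm{Scp}(\phi_k)$, independently from their distributions $\mathcal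 D_i$. The choice of the false clause may be made by an arbitrary rule; it may depend on the current values, the past history, or independent external randomness. Each execution of the loop body is one iteration. -}

module Defs where

open import Data.Bool.Base using (Bool; true; false; if_then_else_; _∧_; _∨_)
open import Data.Fin.Base as Fin using (Fin; zero; suc)
open import Data.Fin.Subset using (Subset; _∈_; _∩_; Nonempty)
open import Data.Fin.Subset.Properties using (_∈?_)
open import Data.List.Base as List using (List)
open import Data.List.Relation.Binary.Subset.Propositional using (_⊆_)
open import Data.List.Relation.Unary.Unique.Propositional using (Unique)
open import Data.Nat.Base as ℕ using (ℕ; zero; suc)
import Data.Nat.Properties as ℕ
open import Data.Product using (∃; _×_; _,_)
open import Data.Product.Properties using (≡-dec)
open import Data.Rational.Base as ℚ using (ℚ; 0ℚ; 1ℚ; ½; ∣_∣; NonZero)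
import Data.Rational.Properties as ℚ
import Data.Rational.Solver as ℚ
open import Data.Unit.Base using (⊤; tt)
open import Data.Vec.Functional using (Vector; foldr)
open import Function.Base using (_∘_; case_of_)
open import Function.Bundles using (_↣_)
open import Relation.Binary.Definitions using (DecidableEquality)
open import Relation.Binary.PropositionalEquality using (_≡_; refl; sym; trans; cong; cong₂)
open import Relation.Nullary.Decidable using (yes; ⌊_⌋; via-injection)

private abstract
  pos* : ∀ {p q} → 0ℚ ℚ.< p → 0ℚ ℚ.< q → 0ℚ ℚ.< p ℚ.* q
  pos* {p} {q} 0<p 0<q =
    ℚ.positive⁻¹ _ {{ℚ.pos*pos⇒pos p {{ℚ.positive 0<p}} q {{ℚ.positive 0<q}}}}

  pos⁻¹ : ∀ {p} (0<p : 0ℚ ℚ.< p) → ∃ λ r → 0ℚ ℚ.< r × p ℚ.* r ≡ 1ℚ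
  pos⁻¹ {p} 0<p =
    r , ℚ.positive⁻¹ r {{ℚ.1/pos⇒pos p {{ℚ.positive 0<p}}}} , ℚ.*-inverseʳ p {{nz}}
    where
    nz : NonZero p
    nz = ℚ.pos⇒nonZero p {{ℚ.positive 0<p}}
    r : ℚ
    r = ℚ.1/_ p {{nz}}

  halve : ∀ {ε} → 0ℚ ℚ.< ε → ∃ λ δ → 0ℚ ℚ.< δ × δ ℚ.+ δ ≡ ε
  halve {ε} 0<ε = ε ℚ.* ½ , pos* {ε} {½} 0<ε (ℚ.positive⁻¹ ½) ,
    trans (sym (ℚ.*-distribˡ-+ ε ½ ½)) (ℚ.*-identityʳ ε)

  *-mono-≤-nonNeg : ∀ {p q r s} → 0ℚ ℚ.≤ r → 0ℚ ℚ.≤ q →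
                    p ℚ.≤ q → r ℚ.≤ s → p ℚ.* r ℚ.≤ q ℚ.* s
  *-mono-≤-nonNeg {p} {q} {r} {s} 0≤r 0≤q p≤q r≤s = ℚ.≤-trans
    (ℚ.*-monoʳ-≤-nonNeg r {{ℚ.nonNegative 0≤r}} p≤q)
    (ℚ.*-monoˡ-≤-nonNeg q {{ℚ.nonNegative 0≤q}} r≤s)

Cauchy : (ℕ → ℚ) → Set
Cauchy s = ∀ ε → 0ℚ ℚ.< ε → ∃ λ N → ∀ i j → N ℕ.≤ i → N ℕ.≤ j → ∣ s i ℚ.- s j ∣ ℚ.≤ ε

record ℝ : Set where
  constructor mkℝ
  field
    seq    : ℕ → ℚ
    cauchy : Cauchy seq

open ℝ public

infix 4 _≤_ _<_ _≃_

_≤_ : ℝ → ℝ → Set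
x ≤ y = ∀ ε → 0ℚ ℚ.< ε → ∃ λ N → ∀ i → N ℕ.≤ i → seq x i ℚ.≤ seq y i ℚ.+ ε

_<_ : ℝ → ℝ → Set
x < y = ∃ λ ε → 0ℚ ℚ.< ε × ∃ λ N → ∀ i → N ℕ.≤ i → seq x i ℚ.+ ε ℚ.≤ seq y i

_≃_ : ℝ → ℝ → Set
x ≃ y = x ≤ y × y ≤ x

-- The modulus proofs are abstract because normalising them is very slow; the
-- relations on ℝ depend on the sequences only.
private abstract
  const-cauchy : ∀ q → Cauchy (λ _ → q)
  const-cauchy q ε 0<ε = 0 , λ i j _ _ →
    ℚ.≤-trans (ℚ.≤-reflexive (cong ∣_∣ (ℚ.+-inverseʳ q))) (ℚ.<⇒≤ 0<ε)

fromℚ : ℚ → ℝ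
fromℚ q = mkℝ (λ _ → q) (const-cauchy q)

0ℝ 1ℝ : ℝ
0ℝ = fromℚ 0ℚ
1ℝ = fromℚ 1ℚ

private abstract
  +-estimate : ∀ a b c d η θ → ∣ a ℚ.- c ∣ ℚ.≤ η → ∣ b ℚ.- d ∣ ℚ.≤ θ →
               ∣ (a ℚ.+ b) ℚ.- (c ℚ.+ d) ∣ ℚ.≤ η ℚ.+ θ
  +-estimate a b c d η θ a-c≤η b-d≤θ = begin
    ∣ (a ℚ.+ b) ℚ.- (c ℚ.+ d) ∣      ≡⟨ cong ∣_∣ (rearrange a b c d) ⟩
    ∣ (a ℚ.- c) ℚ.+ (b ℚ.- d) ∣      ≤⟨ ℚ.∣p+q∣≤∣p∣+∣q∣ (a ℚ.- c) (b ℚ.- d) ⟩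
    ∣ a ℚ.- c ∣ ℚ.+ ∣ b ℚ.- d ∣      ≤⟨ ℚ.+-mono-≤ a-c≤η b-d≤θ ⟩
    η ℚ.+ θ                          ∎
    where
    open ℚ.≤-Reasoning
    rearrange : ∀ a b c d → (a ℚ.+ b) ℚ.- (c ℚ.+ d) ≡ (a ℚ.- c) ℚ.+ (b ℚ.- d)
    rearrange = ℚ.+-*-Solver.solve 4
      (λ a b c d → (a :+ b) :- (c :+ d) := (a :- c) :+ (b :- d)) refl
      where open ℚ.+-*-Solver

  +-cauchy : ∀ {s t} → Cauchy s → Cauchy t → Cauchy (λ i → s i ℚ.+ t i)
  +-cauchy {s} {t} cs ct ε 0<ε = case halve {ε} 0<ε of λ where
    (δ , 0<δ , δ+δ≡ε) → case cs δ 0<δ of λ where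
      (M , f) → case ct δ 0<δ of λ where
        (N , g) → M ℕ.⊔ N , λ i j p q → ℚ.≤-trans
          (+-estimate (s i) (t i) (s j) (t j) δ δ
            (f i j (ℕ.m⊔n≤o⇒m≤o M N p) (ℕ.m⊔n≤o⇒m≤o M N q))
            (g i j (ℕ.m⊔n≤o⇒n≤o M N p) (ℕ.m⊔n≤o⇒n≤o M N q)))
          (ℚ.≤-reflexive δ+δ≡ε)

  bounded : ∀ {s} → Cauchy s →
            ∃ λ B → 0ℚ ℚ.< B × ∃ λ N → ∀ i → N ℕ.≤ i → ∣ s i ∣ ℚ.≤ B
  bounded {s} cs = case cs 1ℚ (ℚ.positive⁻¹ 1ℚ) of λ where
      (N , f) → 1ℚ ℚ.+ ∣ s N ∣ , ℚ.+-mono-<-≤ (ℚ.positive⁻¹ 1ℚ) (ℚ.0≤∣p∣ (s N)) , N ,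
                λ i p → shift (s i) (s N) (f i N p ℕ.≤-refl)
    where
    open ℚ.≤-Reasoning
    rearrange : ∀ a b → a ≡ (a ℚ.- b) ℚ.+ b
    rearrange = ℚ.+-*-Solver.solve 2 (λ a b → a := (a :- b) :+ b) refl
      where open ℚ.+-*-Solver
    shift : ∀ a b → ∣ a ℚ.- b ∣ ℚ.≤ 1ℚ → ∣ a ∣ ℚ.≤ 1ℚ ℚ.+ ∣ b ∣
    shift a b a-b≤1 = begin
      ∣ a ∣                      ≡⟨ cong ∣_∣ (rearrange a b) ⟩
      ∣ (a ℚ.- b) ℚ.+ b ∣        ≤⟨ ℚ.∣p+q∣≤∣p∣+∣q∣ (a ℚ.- b) b ⟩
      ∣ a ℚ.- b ∣ ℚ.+ ∣ b ∣      ≤⟨ ℚ.+-monoˡ-≤ ∣ b ∣ a-b≤1 ⟩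
      1ℚ ℚ.+ ∣ b ∣               ∎

  *-estimate : ∀ a b c d A B η θ → 0ℚ ℚ.< A → 0ℚ ℚ.< B →
               ∣ a ∣ ℚ.≤ A → ∣ d ∣ ℚ.≤ B → ∣ b ℚ.- d ∣ ℚ.≤ η → ∣ a ℚ.- c ∣ ℚ.≤ θ →
               ∣ a ℚ.* b ℚ.- c ℚ.* d ∣ ℚ.≤ A ℚ.* η ℚ.+ B ℚ.* θ
  *-estimate a b c d A B η θ 0<A 0<B a≤A d≤B b-d≤η a-c≤θ = begin
    ∣ a ℚ.* b ℚ.- c ℚ.* d ∣
      ≡⟨ cong ∣_∣ (rearrange a b c d) ⟩
    ∣ a ℚ.* (b ℚ.- d) ℚ.+ d ℚ.* (a ℚ.- c) ∣
      ≤⟨ ℚ.∣p+q∣≤∣p∣+∣q∣ (a ℚ.* (b ℚ.- d)) (d ℚ.* (a ℚ.- c)) ⟩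
    ∣ a ℚ.* (b ℚ.- d) ∣ ℚ.+ ∣ d ℚ.* (a ℚ.- c) ∣
      ≡⟨ cong₂ ℚ._+_ (ℚ.∣p*q∣≡∣p∣*∣q∣ a (b ℚ.- d)) (ℚ.∣p*q∣≡∣p∣*∣q∣ d (a ℚ.- c)) ⟩
    ∣ a ∣ ℚ.* ∣ b ℚ.- d ∣ ℚ.+ ∣ d ∣ ℚ.* ∣ a ℚ.- c ∣
      ≤⟨ ℚ.+-mono-≤
           (*-mono-≤-nonNeg {∣ a ∣} {A} {∣ b ℚ.- d ∣} {η} (ℚ.0≤∣p∣ (b ℚ.- d)) (ℚ.<⇒≤ 0<A) a≤A b-d≤η)
           (*-mono-≤-nonNeg {∣ d ∣} {B} {∣ a ℚ.- c ∣} {θ} (ℚ.0≤∣p∣ (a ℚ.- c)) (ℚ.<⇒≤ 0<B) d≤B a-c≤θ) ⟩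
    A ℚ.* η ℚ.+ B ℚ.* θ ∎
    where
    open ℚ.≤-Reasoning
    rearrange : ∀ a b c d → a ℚ.* b ℚ.- c ℚ.* d ≡ a ℚ.* (b ℚ.- d) ℚ.+ d ℚ.* (a ℚ.- c)
    rearrange = ℚ.+-*-Solver.solve 4
      (λ a b c d → a :* b :- c :* d := a :* (b :- d) :+ d :* (a :- c)) refl
      where open ℚ.+-*-Solver

  divide : ∀ {c ε} → 0ℚ ℚ.< c → 0ℚ ℚ.< ε → ∃ λ η → 0ℚ ℚ.< η × c ℚ.* η ≡ ε
  divide {c} {ε} 0<c 0<ε = case pos⁻¹ {c} 0<c of λ where
    (r , 0<r , cr≡1) → r ℚ.* ε , pos* {r} {ε} 0<r 0<ε ,
      trans (sym (ℚ.*-assoc c r ε)) (trans (cong (ℚ._* ε) cr≡1) (ℚ.*-identityˡ ε))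

  control : ∀ {s t} → Cauchy s → Cauchy t → ∀ ε → 0ℚ ℚ.< ε →
            ∃ λ A → 0ℚ ℚ.< A × ∃ λ η → A ℚ.* η ≡ ε × ∃ λ N →
            (∀ i → N ℕ.≤ i → ∣ s i ∣ ℚ.≤ A) ×
            (∀ i j → N ℕ.≤ i → N ℕ.≤ j → ∣ t i ℚ.- t j ∣ ℚ.≤ η)
  control {s} {t} cs ct ε 0<ε = case bounded {s} cs of λ where
    (A , 0<A , M , f) → case divide {A} {ε} 0<A 0<ε of λ where
      (η , 0<η , Aη≡ε) → case ct η 0<η of λ where
        (N , g) → A , 0<A , η , Aη≡ε , M ℕ.⊔ N ,
          (λ i p → f i (ℕ.m⊔n≤o⇒m≤o M N p)) ,
          (λ i j p q → g i j (ℕ.m⊔n≤o⇒n≤o M N p) (ℕ.m⊔n≤o⇒n≤o M N q))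

  *-cauchy : ∀ {s t} → Cauchy s → Cauchy t → Cauchy (λ i → s i ℚ.* t i)
  *-cauchy {s} {t} cs ct ε 0<ε = case halve {ε} 0<ε of λ where
    (δ , 0<δ , δ+δ≡ε) →
      case control {s} {t} cs ct δ 0<δ of λ where
        (A , 0<A , η , Aη≡δ , M , f , h) → case control {t} {s} ct cs δ 0<δ of λ where
          (B , 0<B , θ , Bθ≡δ , N , g , k) → M ℕ.⊔ N , λ i j p q → ℚ.≤-trans
            (*-estimate (s i) (t i) (s j) (t j) A B η θ 0<A 0<B
              (f i (ℕ.m⊔n≤o⇒m≤o M N p)) (g j (ℕ.m⊔n≤o⇒n≤o M N q))
              (h i j (ℕ.m⊔n≤o⇒m≤o M N p) (ℕ.m⊔n≤o⇒m≤o M N q))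
              (k i j (ℕ.m⊔n≤o⇒n≤o M N p) (ℕ.m⊔n≤o⇒n≤o M N q)))
            (ℚ.≤-reflexive (trans (cong₂ ℚ._+_ Aη≡δ Bθ≡δ) δ+δ≡ε))

infixl 6 _+_
infixl 7 _*_

_+_ : ℝ → ℝ → ℝ
x + y = mkℝ (λ i → seq x i ℚ.+ seq y i) (+-cauchy {seq x} {seq y} (cauchy x) (cauchy y))

_*_ : ℝ → ℝ → ℝ
x * y = mkℝ (λ i → seq x i ℚ.* seq y i) (*-cauchy {seq x} {seq y} (cauchy x) (cauchy y))

inverse : ∀ p → 0ℚ ℚ.< p → ℚ
inverse p 0<p = ℚ.1/_ p {{ℚ.pos⇒nonZero p {{ℚ.positive 0<p}}}}

private abstract
  inverse-estimate : ∀ p q δ ε (0<p : 0ℚ ℚ.< p) (0<q : 0ℚ ℚ.< q) → 0ℚ ℚ.< δ → 0ℚ ℚ.< ε →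
    δ ℚ.≤ p → δ ℚ.≤ q → ∣ q ℚ.- p ∣ ℚ.≤ ε ℚ.* (δ ℚ.* δ) →
    ∣ inverse p 0<p ℚ.- inverse q 0<q ∣ ℚ.≤ ε
  inverse-estimate p q δ ε 0<p 0<q 0<δ 0<ε δ≤p δ≤q q-p≤εδ² =
    go (inverse p 0<p) (inverse q 0<q)
      (ℚ.*-inverseˡ p {{ℚ.pos⇒nonZero p {{ℚ.positive 0<p}}}})
      (ℚ.*-inverseˡ q {{ℚ.pos⇒nonZero q {{ℚ.positive 0<q}}}})
    where
    open ℚ.≤-Reasoning
    rearrange : ∀ u v p q →
      (u ℚ.- v) ℚ.* (p ℚ.* q) ≡ (u ℚ.* p) ℚ.* q ℚ.- (v ℚ.* q) ℚ.* p
    rearrange = ℚ.+-*-Solver.solve 4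
      (λ u v p q → (u :- v) :* (p :* q) := (u :* p) :* q :- (v :* q) :* p) refl
      where open ℚ.+-*-Solver
    0<pq : 0ℚ ℚ.< p ℚ.* q
    0<pq = pos* {p} {q} 0<p 0<q
    go : ∀ u v → u ℚ.* p ≡ 1ℚ → v ℚ.* q ≡ 1ℚ → ∣ u ℚ.- v ∣ ℚ.≤ ε
    go u v up≡1 vq≡1 =
      ℚ.*-cancelʳ-≤-pos {∣ u ℚ.- v ∣} {ε} (p ℚ.* q) {{ℚ.positive 0<pq}} (begin
      ∣ u ℚ.- v ∣ ℚ.* (p ℚ.* q)
        ≡⟨ cong (∣ u ℚ.- v ∣ ℚ.*_) (sym (ℚ.0≤p⇒∣p∣≡p (ℚ.<⇒≤ 0<pq))) ⟩
      ∣ u ℚ.- v ∣ ℚ.* ∣ p ℚ.* q ∣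
        ≡⟨ sym (ℚ.∣p*q∣≡∣p∣*∣q∣ (u ℚ.- v) (p ℚ.* q)) ⟩
      ∣ (u ℚ.- v) ℚ.* (p ℚ.* q) ∣
        ≡⟨ cong ∣_∣ (rearrange u v p q) ⟩
      ∣ (u ℚ.* p) ℚ.* q ℚ.- (v ℚ.* q) ℚ.* p ∣
        ≡⟨ cong₂ (λ x y → ∣ x ℚ.* q ℚ.- y ℚ.* p ∣) up≡1 vq≡1 ⟩
      ∣ 1ℚ ℚ.* q ℚ.- 1ℚ ℚ.* p ∣
        ≡⟨ cong₂ (λ x y → ∣ x ℚ.- y ∣) (ℚ.*-identityˡ q) (ℚ.*-identityˡ p) ⟩
      ∣ q ℚ.- p ∣
        ≤⟨ q-p≤εδ² ⟩
      ε ℚ.* (δ ℚ.* δ)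
        ≤⟨ ℚ.*-monoˡ-≤-nonNeg ε {{ℚ.nonNegative (ℚ.<⇒≤ 0<ε)}}
             (*-mono-≤-nonNeg {δ} {p} {δ} {q} (ℚ.<⇒≤ 0<δ) (ℚ.<⇒≤ 0<p) δ≤p δ≤q) ⟩
      ε ℚ.* (p ℚ.* q) ∎)

max-pos : ∀ p {δ} → 0ℚ ℚ.< δ → 0ℚ ℚ.< p ℚ.⊔ δ
max-pos p {δ} 0<δ = ℚ.<-≤-trans 0<δ (ℚ.p≤q⊔p p δ)

-- Where s i is at least δ > 0 the maximum s i ⊔ δ is just s i; elsewhere it
-- makes the term invertible.
reciprocal : (ℕ → ℚ) → ∀ {δ} → 0ℚ ℚ.< δ → ℕ → ℚ
reciprocal s {δ} 0<δ i = inverse (s i ℚ.⊔ δ) (max-pos (s i) 0<δ)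

private abstract
  reciprocal-cauchy : ∀ {s δ} (0<δ : 0ℚ ℚ.< δ) → Cauchy s →
                      (N : ℕ) → (∀ i → N ℕ.≤ i → 0ℚ ℚ.+ δ ℚ.≤ s i) → Cauchy (reciprocal s 0<δ)
  reciprocal-cauchy {s} {δ} 0<δ cs N δ≤s ε 0<ε =
    case cs (ε ℚ.* (δ ℚ.* δ)) (pos* {ε} {δ ℚ.* δ} 0<ε (pos* {δ} {δ} 0<δ 0<δ)) of λ where
      (M , f) → M ℕ.⊔ N , λ i j p q →
        inverse-estimate (s i ℚ.⊔ δ) (s j ℚ.⊔ δ) δ ε (max-pos (s i) 0<δ) (max-pos (s j) 0<δ)
          0<δ 0<ε (ℚ.p≤q⊔p (s i) δ) (ℚ.p≤q⊔p (s j) δ)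
          (ℚ.≤-trans
            (ℚ.≤-reflexive (cong₂ (λ x y → ∣ x ℚ.- y ∣)
              (max≡ j (ℕ.m⊔n≤o⇒n≤o M N q)) (max≡ i (ℕ.m⊔n≤o⇒n≤o M N p))))
            (f j i (ℕ.m⊔n≤o⇒m≤o M N q) (ℕ.m⊔n≤o⇒m≤o M N p)))
    where
    max≡ : ∀ i → N ℕ.≤ i → s i ℚ.⊔ δ ≡ s i
    max≡ i p = ℚ.p≥q⇒p⊔q≡p (ℚ.≤-trans (ℚ.≤-reflexive (sym (ℚ.+-identityˡ δ))) (δ≤s i p))

inv : (x : ℝ) → 0ℝ < x → ℝ
inv x (δ , 0<δ , N , δ≤x) =
  mkℝ (reciprocal (seq x) 0<δ) (reciprocal-cauchy {seq x} {δ} 0<δ (cauchy x) N δ≤x)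

sum product : ∀ {n} → Vector ℝ n → ℝ
sum     = foldr _+_ 0ℝ
product = foldr _*_ 1ℝ

sumList : ∀ {A : Set} → (A → ℝ) → List A → ℝ
sumList f xs = List.foldr _+_ 0ℝ (List.map f xs)

-- Unconditional summation: s is the limit of the finite partial sums of f
-- along the finite subsets of A (duplicate-free lists) ordered by inclusion.
HasSum : {A : Set} → (A → ℝ) → ℝ → Set
HasSum {A} f s = ∀ ε → 0ℚ ℚ.< ε →
  ∃ λ (xs : List A) → ∀ ys → Unique ys → xs ⊆ ys →
    sumList f ys ≤ s + fromℚ ε × s ≤ sumList f ys + fromℚ ε

record Distribution (A : Set) : Set where
  field
    pmf    : A → ℝ
    nonNeg : ∀ a → 0ℝ ≤ pmf a
    total  : HasSum pmf 1ℝ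

open Distribution public

-- Prob μ E p: the event E has probability p under the mass function μ.
Prob : {A : Set} → (A → ℝ) → (A → Bool) → ℝ → Set
Prob μ E p = HasSum (λ a → if E a then μ a else 0ℝ) p

-- The mass function μ conditioned on E, where Z is the probability of E.
conditioned : {A : Set} → (A → ℝ) → (A → Bool) → (Z : ℝ) → 0ℝ < Z → A → ℝ
conditioned μ E Z 0<Z a = (if E a then μ a else 0ℝ) * inv Z 0<Z

-- Nested pairs rather than functions (i : Fin n) → D i, so that _≡_ on
-- assignments is equality of all coordinates without function extensionality.
Assignment : ∀ {n} → (Fin n → Set) → Set
Assignment {zero}  D = ⊤
Assignment {suc n} D = D zero × Assignment (D ∘ suc)

lookup : ∀ {n} (D : Fin n → Set) → Assignment D → (i : Fin n) → D i
lookup D (x , xs) zero    = x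
lookup D (x , xs) (suc i) = lookup (D ∘ suc) xs i

record Clause {n} (D : Fin n → Set) : Set where
  field
    scope    : Subset n
    nonempty : Nonempty scope
    eval     : Assignment D → Bool
    local    : ∀ x y → (∀ i → i ∈ scope → lookup D x i ≡ lookup D y i) → eval x ≡ eval y

open Clause public

record Instance (n m : ℕ) : Set₁ where
  field
    D         : Fin n → Set
    countable : ∀ i → D i ↣ ℕ
    𝒟         : ∀ i → Distribution (D i)
    clause    : Fin m → Clause D

module _ {n m : ℕ} (I : Instance n m) where

  open Instance I

  _≟ᵥ_ : ∀ {i} → DecidableEquality (D i)
  _≟ᵥ_ {i} = via-injection (countable i) ℕ._≟_

  assignment-≟ : DecidableEquality (Assignment D)
  assignment-≟ = go D (λ i → _≟ᵥ_ {i})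
    where
    go : ∀ {k} (E : Fin k → Set) → (∀ i → DecidableEquality (E i)) →
         DecidableEquality (Assignment E)
    go {zero}  E _≟_ tt tt = yes refl
    go {suc k} E _≟_       = ≡-dec (_≟_ zero) (go (E ∘ suc) (_≟_ ∘ suc))

  formula : Assignment D → Bool
  formula x = foldr _∧_ true (λ k → eval (clause k) x)

  productLaw : Assignment D → ℝ
  productLaw x = product (λ i → pmf (𝒟 i) (lookup D x i))

  Extremal : Set
  Extremal = ∀ k l → k Fin.< l → Nonempty (scope (clause k) ∩ scope (clause l)) →
             ∀ x → eval (clause k) x ∨ eval (clause l) x ≡ true

  -- The run of the algorithm so far: the sampled assignment, then for each
  -- iteration the chosen clause and the assignment after resampling.
  data History : Set where
    start : Assignment D → History
    step  : History → Fin m → Assignment D → History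

  current : History → Assignment D
  current (start x)    = x
  current (step _ _ x) = x

  -- choose h k is the conditional probability that clause k is selected given
  -- the history h. Values of choose strictly between 0 and 1 account for
  -- external randomness, including randomness shared between iterations: as it
  -- is independent of the resampling, only these conditional probabilities
  -- enter the law of the run.
  record Rule : Set where
    field
      choose         : History → Fin m → ℝ
      choose-nonNeg  : ∀ h k → 0ℝ ≤ choose h k
      choose-false   : ∀ h k → eval (clause k) (current h) ≡ true → choose h k ≃ 0ℝ
      choose-total   : ∀ h → formula (current h) ≡ false → sum (choose h) ≃ 1ℝ

  -- The probability that resampling clause k turns x into y.
  resample : Fin m → Assignment D → Assignment D → ℝ
  resample k x y = product λ i →
    if ⌊ i ∈? scope (clause k) ⌋
    then pmf (𝒟 i) (lookup D y i)
    else if ⌊ lookup D y i ≟ᵥ lookup D x i ⌋ then 1ℝ else 0ℝ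

  module _ (R : Rule) where

    open Rule R

    -- The probability that h is an initial segment of the run. No step is
    -- taken after the formula becomes true, since then every choose h k is 0.
    weight : History → ℝ
    weight (start x)    = productLaw x
    weight (step h k x) = weight h * choose h k * resample k (current h) x

    -- The probability that the algorithm terminates with h as its entire run.
    -- Distinct h give disjoint events, so summing over a set of histories gives
    -- the probability of terminating with a run in that set.
    finalLaw : History → ℝ
    finalLaw h = if formula (current h) then weight h else 0ℝ

    TerminatesAlmostSurely : Set
    TerminatesAlmostSurely = HasSum finalLaw 1ℝ

    -- For each y, the probability of terminating with assignment y is μ y.
    OutputLaw : (Assignment D → ℝ) → Set
    OutputLaw μ = ∀ y → Prob finalLaw (λ h → ⌊ assignment-≟ (current h) y ⌋) (μ y)

{-# OPTIONS --safe #-}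

-- Let G(x) be the expectation of f at termination when the current assignment is x.
-- Two false clauses have disjoint scopes, so resampling them commutes; hence
-- G(x) = E_S G(x), the average of G over the variables in S, for the scope S of every
-- clause false at x, and G does not depend on the rule. Let B be the product of the
-- indicators of falsity of r distinct clauses. If two of their scopes meet, B = 0;
-- otherwise, averaging over the scopes one after the other gives E[B G] = E[B] E[G].
-- By inclusion and exclusion E[Φ G] = E[Φ] E[G], and Φ G = Φ f, so that
-- E[G] = E[Φ f] / E[Φ].
--
-- If the run is stopped after fewer than N iterations then E[B G_N] = E[B] h(N - r)
-- with h(N) = E[G_N], so the identity holds up to 2^m (h(N) - h(N - m)). As h is
-- increasing and bounded, these errors telescope and their average tends to 0.
--
-- For a lower bound on the true probabilities the laws of the variables are replaced
-- by normalised restrictions to finite sets. The bounds for an event and for its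
-- complement, with total probability at most 1, give both limits.
module Submission where

open import Algebra.Bundles using (CommutativeRing)
import Algebra.Solver.Ring.NaturalCoefficients.Default
open import Data.Bool.Base using (Bool; true; false; if_then_else_; _∧_; not)
open import Data.Bool.Properties using (∧-zeroʳ)
open import Data.Fin.Base using (Fin; zero; suc)
open import Data.Fin.Properties using (<-cmp) renaming (_≟_ to _≟ᶠ_)
open import Data.Fin.Subset using (Subset; _∉_; Nonempty; _∩_) renaming (_∈_ to _∈ˢ_)
open import Data.Fin.Subset.Properties using (nonempty?; x∈p∩q⁺; ∩-comm; _∈?_)
open import Data.Integer.Base as ℤ using (+_)
import Data.Integer.Properties as ℤ
open import Data.List.Base as List using
  ( List; []; _∷_; _++_; cartesianProductWith; length; allFin; cartesianProduct; concatMap; deduplicate )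
open import Data.List.Membership.Propositional using (_∈_; find; lose)
open import Data.List.Membership.Propositional.Properties using
  ( ∈-∃++; ∈-++⁺ˡ; ∈-++⁺ʳ; ∈-++⁻; ∈-cartesianProductWith⁺; ∈-cartesianProductWith⁻; ∈-allFin; ∈-map⁺; ∈-map⁻
  ; ∈-cartesianProduct⁺; ∈-concatMap⁺; ∈-deduplicate⁺ )
open import Data.List.Properties using (length-tabulate)
open import Data.List.Relation.Binary.Subset.Propositional using (_⊆_)
open import Data.List.Relation.Unary.All as All using (All; []; _∷_)
open import Data.List.Relation.Unary.All.Properties using (¬Any⇒All¬)
open import Data.List.Relation.Unary.AllPairs.Core using ([]; _∷_)
open import Data.List.Relation.Unary.Any using (here; there; any?)
open import Data.List.Relation.Unary.Unique.DecPropositional.Properties using (deduplicate-!)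
open import Data.List.Relation.Unary.Unique.Propositional using (Unique)
import Data.List.Relation.Unary.Unique.Propositional.Properties as Unique
open import Data.Nat.Base as ℕ using (ℕ; zero; suc; _∸_)
import Data.Nat.Properties as ℕ
open import Data.Product.Base using (_,_; _×_; ∃; proj₁; proj₂)
open import Data.Rational.Base as ℚ using (ℚ; 0ℚ; 1ℚ; ∣_∣; mkℚ; ↥_; ½; toℚᵘ)
import Data.Rational.Properties as ℚ
open import Data.Rational.Unnormalised.Base as ℚᵘ using (mkℚᵘ)
import Data.Rational.Unnormalised.Properties as ℚᵘ
open import Data.Sum.Base using (inj₁; inj₂; _⊎_; [_,_]′)
open import Data.Unit.Base using (tt)
open import Data.Vec.Base as Vec using ([]; _∷_; here; there)
open import Data.Vec.Functional using (Vector; foldr)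
open import Data.Vec.Properties using ([]=⇒lookup; lookup⇒[]=)
open import Defs using
  ( Assignment; lookup; Instance; Extremal; formula; scope; eval; local; History; start; step; current; _≟ᵥ_
  ; assignment-≟ )
open import Function.Base using (_∘_; id)
open import Level using (0ℓ)
open import Relation.Binary.Bundles using (Poset)
open import Relation.Binary.Definitions using (DecidableEquality; tri<; tri≈; tri>)
open import Relation.Binary.PropositionalEquality as ≡ using (_≡_; _≢_)
import Relation.Binary.Reasoning.PartialOrder
open import Relation.Binary.Structures using (IsPartialOrder)
open import Relation.Nullary.Decidable using (yes; no; ⌊_⌋)
open import Relation.Nullary.Negation using (contradiction; ¬_)

-- Only finite sums are ever rearranged, so these axioms carry the proof up to the final limits, and
-- exchanging two averages is mere linearity. Restricting the laws to finite lists forces a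
-- normalisation, after which the comparison with the true masses goes one way only: a factor
-- slightly below 1 times the normalised average is at most the true sum. One such factor is lost
-- for each variable in each round of sampling. Hence a lower bound for the probability of success
-- is reached through an upper bound for that of failure.
--
-- A bounded increasing sequence of constructive reals need not converge, so no limit of h is
-- formed. Telescoping over M blocks of iterations yields the explicit error 2^m / M instead, and
-- the finite lists are chosen only after M.
--
-- The given rule meets the rule-free function G_s in a single inequality. The weight of a history
-- times G_s at its current assignment is, up to the loss factor, at most the terminated output plus
-- the same quantity, with s decreased by one, summed over all extensions. The probabilities of the
-- rule enter it only through their total, because G_s may be expanded by any false clause.

-- Over an abstract ring the operations of ℝ, which are slow to compare, are not unfolded.
record OrderedRing : Set₁ where
  infix 4 _≤_
  field
    commutativeRing : CommutativeRing 0ℓ 0ℓ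
  open CommutativeRing commutativeRing public hiding (zero)
  field
    _≤_            : Carrier → Carrier → Set
    isPartialOrder : IsPartialOrder _≈_ _≤_
    +-mono-≤       : ∀ {x y u v} → x ≤ y → u ≤ v → x + u ≤ y + v
    *-nonNeg       : ∀ {x y} → 0# ≤ x → 0# ≤ y → 0# ≤ x * y
    0≤1            : 0# ≤ 1#

  open IsPartialOrder isPartialOrder public
    using () renaming (refl to ≤-refl; trans to ≤-trans; reflexive to ≤-reflexive; antisym to ≤-antisym)

  poset : Poset 0ℓ 0ℓ 0ℓ
  poset = record { isPartialOrder = isPartialOrder }

-- Order algebra and finite sums over an abstract ring

module OrderedRingProperties (R : OrderedRing) where

  open OrderedRing R
  open Relation.Binary.Reasoning.PartialOrder poset

  module Solver = Algebra.Solver.Ring.NaturalCoefficients.Default commutativeSemiring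

  x-y+y≈x : ∀ x y → (x - y) + y ≈ x
  x-y+y≈x x y = trans (+-assoc x (- y) y) (trans (+-congˡ (-‿inverseˡ y)) (+-identityʳ x))

  +-cancelʳ-≤ : ∀ {x y} z → x + z ≤ y + z → x ≤ y
  +-cancelʳ-≤ {x} {y} z p = begin
    x              ≈⟨ lem x ⟨
    (x + z) - z    ≤⟨ +-mono-≤ p ≤-refl ⟩
    (y + z) - z    ≈⟨ lem y ⟩
    y              ∎
    where
    lem : ∀ w → (w + z) - z ≈ w
    lem w = trans (+-assoc w z (- z)) (trans (+-congˡ (-‿inverseʳ z)) (+-identityʳ w))

  ≤⇒0≤- : ∀ {x y} → x ≤ y → 0# ≤ y - x
  ≤⇒0≤- {x} {y} p = +-cancelʳ-≤ x (begin
    0# + x         ≈⟨ +-identityˡ x ⟩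
    x              ≤⟨ p ⟩
    y              ≈⟨ x-y+y≈x y x ⟨
    (y - x) + x    ∎)

  *-monoˡ-≤ : ∀ {x y z} → 0# ≤ z → x ≤ y → z * x ≤ z * y
  *-monoˡ-≤ {x} {y} {z} 0≤z x≤y = begin
    z * x                ≈⟨ +-identityˡ (z * x) ⟨
    0# + z * x           ≤⟨ +-mono-≤ (*-nonNeg 0≤z (≤⇒0≤- x≤y)) ≤-refl ⟩
    z * (y - x) + z * x  ≈⟨ distribˡ z (y - x) x ⟨
    z * ((y - x) + x)    ≈⟨ *-congˡ (x-y+y≈x y x) ⟩
    z * y                ∎

  +-nonNeg : ∀ {x y} → 0# ≤ x → 0# ≤ y → 0# ≤ x + y
  +-nonNeg p q = ≤-trans (≤-reflexive (sym (+-identityˡ 0#))) (+-mono-≤ p q)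

  x≤x+y : ∀ {x y} → 0# ≤ y → x ≤ x + y
  x≤x+y {x} p = ≤-trans (≤-reflexive (sym (+-identityʳ x))) (+-mono-≤ ≤-refl p)

  x≤1⇒z*x≤z : ∀ {x z} → 0# ≤ z → x ≤ 1# → z * x ≤ z
  x≤1⇒z*x≤z {x} {z} 0≤z x≤1 = ≤-trans (*-monoˡ-≤ 0≤z x≤1) (≤-reflexive (*-identityʳ z))

  if-nonNeg : ∀ b {x} → 0# ≤ x → 0# ≤ (if b then x else 0#)
  if-nonNeg true  p = p
  if-nonNeg false p = ≤-refl

  if-zero-one : ∀ b x → (if b then 1# else 0#) * x ≈ (if b then x else 0#)
  if-zero-one true  x = *-identityˡ x
  if-zero-one false x = zeroˡ x

  -- Sums over lists

  ∑ : {A : Set} → (A → Carrier) → List A → Carrier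
  ∑ f xs = List.foldr _+_ 0# (List.map f xs)

  module _ {A : Set} where

    ∑-cong : ∀ {f g : A → Carrier} → (∀ a → f a ≈ g a) → ∀ xs → ∑ f xs ≈ ∑ g xs
    ∑-cong p []       = refl
    ∑-cong p (x ∷ xs) = +-cong (p x) (∑-cong p xs)

    ∑-mono-∈ : ∀ {f g : A → Carrier} xs → (∀ {a} → a ∈ xs → f a ≤ g a) → ∑ f xs ≤ ∑ g xs
    ∑-mono-∈ []       p = ≤-refl
    ∑-mono-∈ (x ∷ xs) p = +-mono-≤ (p (here ≡.refl)) (∑-mono-∈ xs (p ∘ there))

    ∑-mono : ∀ {f g : A → Carrier} → (∀ a → f a ≤ g a) → ∀ xs → ∑ f xs ≤ ∑ g xs
    ∑-mono p xs = ∑-mono-∈ xs (λ {a} _ → p a)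

    ∑-zero : ∀ (xs : List A) → ∑ (λ _ → 0#) xs ≈ 0#
    ∑-zero []       = refl
    ∑-zero (x ∷ xs) = trans (+-identityˡ _) (∑-zero xs)

    ∑-nonNeg : ∀ {f : A → Carrier} → (∀ a → 0# ≤ f a) → ∀ xs → 0# ≤ ∑ f xs
    ∑-nonNeg p xs = ≤-trans (≤-reflexive (sym (∑-zero xs))) (∑-mono p xs)

    ∑-+ : ∀ (f g : A → Carrier) xs → ∑ (λ a → f a + g a) xs ≈ ∑ f xs + ∑ g xs
    ∑-+ f g []       = sym (+-identityˡ 0#)
    ∑-+ f g (x ∷ xs) = trans (+-congˡ (∑-+ f g xs))
      (solve 4 (λ a b c d → ((a :+ b) :+ (c :+ d)) := ((a :+ c) :+ (b :+ d))) refl (f x) (g x) (∑ f xs) (∑ g xs))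
      where open Solver using (solve; _:=_; _:+_; _:*_; con)

    ∑-*ˡ : ∀ c (f : A → Carrier) xs → ∑ (λ a → c * f a) xs ≈ c * ∑ f xs
    ∑-*ˡ c f []       = sym (zeroʳ c)
    ∑-*ˡ c f (x ∷ xs) = trans (+-congˡ (∑-*ˡ c f xs)) (sym (distribˡ c (f x) (∑ f xs)))

    ∑-*ʳ : ∀ c (f : A → Carrier) xs → ∑ (λ a → f a * c) xs ≈ ∑ f xs * c
    ∑-*ʳ c f xs = trans (∑-cong (λ a → *-comm (f a) c) xs) (trans (∑-*ˡ c f xs) (*-comm c (∑ f xs)))

    ∑-++ : ∀ (f : A → Carrier) xs ys → ∑ f (xs ++ ys) ≈ ∑ f xs + ∑ f ys
    ∑-++ f []       ys = sym (+-identityˡ (∑ f ys))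
    ∑-++ f (x ∷ xs) ys = trans (+-congˡ (∑-++ f xs ys)) (sym (+-assoc (f x) (∑ f xs) (∑ f ys)))

    -- Each element of `xs` is cut out of `ys` at its membership witness, so equality need not be
    -- decided and `ys` may contain repetitions.
    ∑-⊆ : ∀ {f : A → Carrier} → (∀ a → 0# ≤ f a) → ∀ {xs ys} → Unique xs → xs ⊆ ys → ∑ f xs ≤ ∑ f ys
    ∑-⊆ {f} 0≤f {[]} {ys} [] xs⊆ys = ∑-nonNeg 0≤f ys
    ∑-⊆ {f} 0≤f {x ∷ xs} {ys} (x∉xs ∷ !xs) xs⊆ys with ∈-∃++ (xs⊆ys (here ≡.refl))
    ... | ps , qs , ≡.refl = begin
      f x + ∑ f xs             ≤⟨ +-mono-≤ ≤-refl (∑-⊆ 0≤f !xs avoid) ⟩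
      f x + ∑ f (ps ++ qs)     ≈⟨ +-congˡ (∑-++ f ps qs) ⟩
      f x + (∑ f ps + ∑ f qs)  ≈⟨ solve 3 (λ a b c → a :+ (b :+ c) := b :+ (a :+ c)) refl (f x) (∑ f ps) (∑ f qs) ⟩
      ∑ f ps + (f x + ∑ f qs)  ≈⟨ ∑-++ f ps (x ∷ qs) ⟨
      ∑ f (ps ++ x ∷ qs)       ∎
      where
      open Solver using (solve; _:=_; _:+_; _:*_; con)
      avoid : xs ⊆ ps ++ qs
      avoid {z} z∈xs with ∈-++⁻ ps (xs⊆ys (there z∈xs))
      ... | inj₁ z∈ps            = ∈-++⁺ˡ z∈ps
      ... | inj₂ (here ≡.refl)   = contradiction ≡.refl (All.lookup x∉xs z∈xs)
      ... | inj₂ (there z∈qs)    = ∈-++⁺ʳ ps z∈qs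

    ∈⇒≤∑ : ∀ {f : A → Carrier} → (∀ a → 0# ≤ f a) → ∀ {x xs} → x ∈ xs → f x ≤ ∑ f xs
    ∈⇒≤∑ {f} 0≤f {x} x∈xs = ≤-trans (≤-reflexive (sym (+-identityʳ (f x))))
      (∑-⊆ {f} 0≤f {x ∷ []} ([] ∷ []) (λ where (here ≡.refl) → x∈xs))

    -- A duplicate-free list contains `b` at most once and may miss it, hence an inequality.
    ∑-point : ∀ {f : A → Carrier} → DecidableEquality A → ∀ {b} → 0# ≤ f b → (∀ a → a ≢ b → f a ≈ 0#) →
              ∀ {xs} → Unique xs → ∑ f xs ≤ f b
    ∑-point _≟_ 0≤fb f≈0 {[]} [] = 0≤fb
    ∑-point {f} _≟_ {b} 0≤fb f≈0 {x ∷ xs} (x∉xs ∷ !xs) with x ≟ b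
    ... | no x≢b     = ≤-trans (≤-reflexive (trans (+-congʳ (f≈0 x x≢b)) (+-identityˡ _))) (∑-point _≟_ 0≤fb f≈0 !xs)
    ... | yes ≡.refl = ≤-reflexive (trans (+-congˡ (rest x∉xs)) (+-identityʳ _))
      where
      rest : ∀ {ys} → All (b ≢_) ys → ∑ f ys ≈ 0#
      rest []               = refl
      rest {y ∷ ys} (p ∷ ps) = trans (+-cong (f≈0 y (p ∘ ≡.sym)) (rest ps)) (+-identityˡ 0#)

    ∑-map : ∀ {B : Set} (f : A → Carrier) (g : B → A) xs → ∑ f (List.map g xs) ≈ ∑ (f ∘ g) xs
    ∑-map f g []       = refl
    ∑-map f g (x ∷ xs) = +-congˡ (∑-map f g xs)

  ∑-cartesianProductWith : ∀ {A B C : Set} (f : C → Carrier) (g : A → B → C) xs ys →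
    ∑ f (cartesianProductWith g xs ys) ≈ ∑ (λ x → ∑ (λ y → f (g x y)) ys) xs
  ∑-cartesianProductWith f g []       ys = refl
  ∑-cartesianProductWith f g (x ∷ xs) ys =
    trans (∑-++ f (List.map (g x) ys) (cartesianProductWith g xs ys))
      (+-cong (∑-map f (g x) ys) (∑-cartesianProductWith f g xs ys))

  ∑-tabulate : ∀ {A : Set} {n} (f : A → Carrier) (g : Fin n → A) →
    ∑ f (List.tabulate g) ≈ foldr _+_ 0# (f ∘ g)
  ∑-tabulate {n = zero}  f g = refl
  ∑-tabulate {n = suc n} f g = +-congˡ (∑-tabulate f (g ∘ suc))

  -- Natural multiples and powers

  fromℕ : ℕ → Carrier
  fromℕ zero    = 0#
  fromℕ (suc n) = 1# + fromℕ n

  fromℕ-nonNeg : ∀ n → 0# ≤ fromℕ n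
  fromℕ-nonNeg zero    = ≤-refl
  fromℕ-nonNeg (suc n) = +-nonNeg 0≤1 (fromℕ-nonNeg n)

  pow : Carrier → ℕ → Carrier
  pow x zero    = 1#
  pow x (suc n) = x * pow x n

  -- 2 to the power `n`: the number of terms when `n` factors 1 - `fail k` are expanded.
  doubling : ℕ → Carrier
  doubling zero    = 1#
  doubling (suc n) = doubling n + doubling n

  doubling-nonNeg : ∀ n → 0# ≤ doubling n
  doubling-nonNeg zero    = 0≤1
  doubling-nonNeg (suc n) = +-nonNeg (doubling-nonNeg n) (doubling-nonNeg n)

  pow-nonNeg : ∀ {x} → 0# ≤ x → ∀ n → 0# ≤ pow x n
  pow-nonNeg p zero    = 0≤1
  pow-nonNeg p (suc n) = *-nonNeg p (pow-nonNeg p n)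

  pow≤1 : ∀ {x} → 0# ≤ x → x ≤ 1# → ∀ n → pow x n ≤ 1#
  pow≤1 p q zero    = ≤-refl
  pow≤1 p q (suc n) = ≤-trans (x≤1⇒z*x≤z p (pow≤1 p q n)) q

  -- Bernoulli's inequality with `e` in the role of 1 - x. It is applied twice in a row: over the
  -- variables of one round of sampling, then over the rounds.
  bernoulli : ∀ {x e} → 0# ≤ x → x ≤ 1# → 0# ≤ e → 1# ≤ x + e → ∀ n → 1# ≤ pow x n + fromℕ n * e
  bernoulli {x} {e} 0≤x x≤1 0≤e 1≤x+e zero = x≤x+y (≤-reflexive (sym (zeroˡ e)))
  bernoulli {x} {e} 0≤x x≤1 0≤e 1≤x+e (suc n) = begin
    1#                                        ≤⟨ 1≤x+e ⟩
    x + e                                     ≈⟨ +-congʳ (*-identityʳ x) ⟨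
    x * 1# + e                                ≤⟨ +-mono-≤ (*-monoˡ-≤ 0≤x (bernoulli 0≤x x≤1 0≤e 1≤x+e n)) ≤-refl ⟩
    x * (pow x n + fromℕ n * e) + e
      ≈⟨ solve 4 (λ x p k e → x :* (p :+ k :* e) :+ e := x :* p :+ (k :* (e :* x) :+ e)) refl x (pow x n) (fromℕ n) e ⟩
    x * pow x n + (fromℕ n * (e * x) + e)
      ≤⟨ +-mono-≤ ≤-refl (+-mono-≤ (*-monoˡ-≤ (fromℕ-nonNeg n) (x≤1⇒z*x≤z 0≤e x≤1)) ≤-refl) ⟩
    x * pow x n + (fromℕ n * e + e)
      ≈⟨ +-congˡ (solve 2 (λ k e → k :* e :+ e := (con 1 :+ k) :* e) refl (fromℕ n) e) ⟩
    x * pow x n + (1# + fromℕ n) * e          ∎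
    where open Solver using (solve; _:=_; _:+_; _:*_; con)

-- Finite boxes of assignments

box : ∀ {n} (D : Fin n → Set) → (∀ i → List (D i)) → List (Assignment D)
box {zero}  D L = tt ∷ []
box {suc n} D L = cartesianProductWith (λ xs x → x , xs) (box (D ∘ suc) (L ∘ suc)) (L zero)

∈-box⁺ : ∀ {n} (D : Fin n → Set) (L : ∀ i → List (D i)) x → (∀ i → lookup D x i ∈ L i) → x ∈ box D L
∈-box⁺ {zero}  D L tt       p = here ≡.refl
∈-box⁺ {suc n} D L (x , xs) p =
  ∈-cartesianProductWith⁺ (λ xs x → x , xs) (∈-box⁺ (D ∘ suc) (L ∘ suc) xs (p ∘ suc)) (p zero)

∈-box⁻ : ∀ {n} (D : Fin n → Set) (L : ∀ i → List (D i)) {x} → x ∈ box D L → ∀ i → lookup D x i ∈ L i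
∈-box⁻ {suc n} D L x∈box i
  with ∈-cartesianProductWith⁻ (λ xs x → x , xs) (box (D ∘ suc) (L ∘ suc)) (L zero) x∈box
∈-box⁻ {suc n} D L x∈box zero    | _ , _ , xs∈ , x∈ , ≡.refl = x∈
∈-box⁻ {suc n} D L x∈box (suc i) | _ , _ , xs∈ , x∈ , ≡.refl = ∈-box⁻ (D ∘ suc) (L ∘ suc) xs∈ i

box-unique : ∀ {n} (D : Fin n → Set) (L : ∀ i → List (D i)) → (∀ i → Unique (L i)) → Unique (box D L)
box-unique {zero}  D L !L = [] ∷ []
box-unique {suc n} D L !L = Unique.cartesianProductWith⁺ (λ xs x → x , xs)
  (λ where ≡.refl → ≡.refl , ≡.refl) (box-unique (D ∘ suc) (L ∘ suc) (!L ∘ suc)) (!L zero)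

AgreeOff : ∀ {n} (D : Fin n → Set) → Subset n → Assignment D → Assignment D → Set
AgreeOff D S x y = ∀ i → i ∉ S → lookup D x i ≡ lookup D y i

AgreeOn : ∀ {n} (D : Fin n → Set) → Subset n → Assignment D → Assignment D → Set
AgreeOn D S x y = ∀ i → i ∈ˢ S → lookup D x i ≡ lookup D y i

-- Averaging functionals on products

module Expectations (R : OrderedRing) where

  open OrderedRing R
  open OrderedRingProperties R
  open Relation.Binary.Reasoning.PartialOrder poset

  Functional : Set → Set
  Functional A = (A → Carrier) → Carrier

  record IsLinear {A : Set} (F : Functional A) : Set where
    field
      F-cong : ∀ {g h} → (∀ a → g a ≈ h a) → F g ≈ F h
      F-+    : ∀ g h → F (λ a → g a + h a) ≈ F g + F h
      F-*    : ∀ c g → F (λ a → c * g a) ≈ c * F g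

    F-*ʳ : ∀ c g → F (λ a → g a * c) ≈ F g * c
    F-*ʳ c g = trans (F-cong (λ a → *-comm (g a) c)) (trans (F-* c g) (*-comm c (F g)))

    F-zero : ∀ {g} → (∀ a → g a ≈ 0#) → F g ≈ 0#
    F-zero {g} p = trans (F-cong (λ a → trans (p a) (sym (zeroˡ 0#)))) (trans (F-* 0# (λ _ → 0#)) (zeroˡ _))

  -- Interchange is required against every linear functional on every type. Finite weighted sums
  -- have this property by linearity alone, and `iterated` inherits it coordinate by coordinate.
  record IsExpectation {A : Set} (F : Functional A) : Set₁ where
    field
      isLinear : IsLinear F
      F-one    : F (λ _ → 1#) ≈ 1#
      F-mono   : ∀ {g h} → (∀ a → g a ≤ h a) → F g ≤ F h
      fubini   : ∀ {B} {G : Functional B} → IsLinear G → ∀ (g : A → B → Carrier) →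
                 F (λ a → G (g a)) ≈ G (λ b → F (λ a → g a b))

    open IsLinear isLinear public

    F-const : ∀ c → F (λ _ → c) ≈ c
    F-const c = trans (F-cong (λ _ → sym (*-identityʳ c)))
      (trans (F-* c (λ _ → 1#)) (trans (*-congˡ F-one) (*-identityʳ c)))

    F-nonNeg : ∀ {g} → (∀ a → 0# ≤ g a) → 0# ≤ F g
    F-nonNeg p = ≤-trans (≤-reflexive (sym (F-const 0#))) (F-mono p)

    F-≤1 : ∀ {g} → (∀ a → g a ≤ 1#) → F g ≤ 1#
    F-≤1 p = ≤-trans (F-mono p) (≤-reflexive F-one)

    F-*-constant : ∀ {g} → (∀ a b → g a ≈ g b) → ∀ h → F (λ a → g a * h a) ≈ F g * F h
    F-*-constant {g} g-const h = begin-equality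
      F (λ a → g a * h a)    ≈⟨ F-cong (λ a → *-congʳ (trans (sym (F-const (g a))) (F-cong (g-const a)))) ⟩
      F (λ a → F g * h a)    ≈⟨ F-* (F g) h ⟩
      F g * F h              ∎

  at : ∀ {A : Set} → A → Functional A
  at x g = g x

  at-isExpectation : ∀ {A : Set} (x : A) → IsExpectation (at x)
  at-isExpectation x = record
    { isLinear = record { F-cong = λ p → p x ; F-+ = λ _ _ → refl ; F-* = λ _ _ → refl }
    ; F-one    = refl
    ; F-mono   = λ p → p x
    ; fubini   = λ _ _ → refl
    }

  weighted : ∀ {A : Set} → (A → Carrier) → List A → Functional A
  weighted q xs g = ∑ (λ a → q a * g a) xs

  weighted-isExpectation : ∀ {A : Set} {q : A → Carrier} {xs} → (∀ a → 0# ≤ q a) → ∑ q xs ≈ 1# →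
                           IsExpectation (weighted q xs)
  weighted-isExpectation {A} {q} {xs} 0≤q total = record
    { isLinear = record
      { F-cong = λ p → ∑-cong (λ a → *-congˡ (p a)) xs
      ; F-+    = λ g h → trans (∑-cong (λ a → distribˡ (q a) (g a) (h a)) xs) (∑-+ _ _ xs)
      ; F-*    = λ c g → trans (∑-cong (λ a → swap (q a) c (g a)) xs) (∑-*ˡ c _ xs)
      }
    ; F-one    = trans (∑-cong (λ a → *-identityʳ (q a)) xs) total
    ; F-mono   = λ p → ∑-mono (λ a → *-monoˡ-≤ (0≤q a) (p a)) xs
    ; fubini   = λ L g → exchange L g xs
    }
    where
    swap : ∀ a b c → a * (b * c) ≈ b * (a * c)
    swap = solve 3 (λ a b c → a :* (b :* c) := b :* (a :* c)) refl where open Solver using (solve; _:=_; _:+_; _:*_; con)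
    exchange : ∀ {B} {G : Functional B} → IsLinear G → ∀ (g : A → B → Carrier) ys →
               ∑ (λ a → q a * G (g a)) ys ≈ G (λ b → ∑ (λ a → q a * g a b) ys)
    exchange L g []       = sym (IsLinear.F-zero L (λ _ → refl))
    exchange L g (y ∷ ys) = trans (+-cong (sym (IsLinear.F-* L (q y) (g y))) (exchange L g ys))
      (sym (IsLinear.F-+ L _ _))

  -- The tail is the outer loop, as in `box`, so that averages and sums over boxes unfold in
  -- parallel.
  iterated : ∀ {n} (D : Fin n → Set) → (∀ i → Functional (D i)) → Functional (Assignment D)
  iterated {zero}  D op g = g tt
  iterated {suc n} D op g = iterated (D ∘ suc) (op ∘ suc) (λ xs → op zero (λ x → g (x , xs)))

  iterated-isExpectation : ∀ {n} (D : Fin n → Set) {op : ∀ i → Functional (D i)} →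
    (∀ i → IsExpectation (op i)) → IsExpectation (iterated D op)
  iterated-isExpectation {zero}  D e = at-isExpectation tt
  iterated-isExpectation {suc n} D {op} e = record
    { isLinear = record
      { F-cong = λ p → I.F-cong (λ xs → O.F-cong (λ x → p (x , xs)))
      ; F-+    = λ g h → trans (I.F-cong (λ xs → O.F-+ _ _)) (I.F-+ _ _)
      ; F-*    = λ c g → trans (I.F-cong (λ xs → O.F-* c _)) (I.F-* c _)
      }
    ; F-one    = trans (I.F-cong (λ _ → O.F-one)) I.F-one
    ; F-mono   = λ p → I.F-mono (λ xs → O.F-mono (λ x → p (x , xs)))
    ; fubini   = λ L g → trans (I.F-cong (λ xs → O.fubini L (λ x → g (x , xs))))
                           (I.fubini L (λ xs b → op zero (λ x → g (x , xs) b)))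
    }
    where
    module I = IsExpectation (iterated-isExpectation (D ∘ suc) {op ∘ suc} (e ∘ suc))
    module O = IsExpectation (e zero)

  ∏ : ∀ {n} → Vector Carrier n → Carrier
  ∏ = foldr _*_ 1#

  ∏-nonNeg : ∀ {n} {v : Vector Carrier n} → (∀ i → 0# ≤ v i) → 0# ≤ ∏ v
  ∏-nonNeg {zero}  p = 0≤1
  ∏-nonNeg {suc n} p = *-nonNeg (p zero) (∏-nonNeg (p ∘ suc))

  ∑-box≤1 : ∀ {n} (D : Fin n → Set) (L : ∀ i → List (D i)) {φ : ∀ i → D i → Carrier} →
    (∀ i a → 0# ≤ φ i a) → (∀ i → ∑ (φ i) (L i) ≤ 1#) → ∑ (λ x → ∏ (λ i → φ i (lookup D x i))) (box D L) ≤ 1#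
  ∑-box≤1 {zero}  D L 0≤φ p = ≤-reflexive (+-identityʳ 1#)
  ∑-box≤1 {suc n} D L {φ} 0≤φ p = begin
    ∑ (λ x → ∏ (λ i → φ i (lookup D x i))) (box D L)
      ≈⟨ ∑-cartesianProductWith _ (λ xs x → x , xs) (box (D ∘ suc) (L ∘ suc)) (L zero) ⟩
    ∑ (λ xs → ∑ (λ x → φ zero x * rest xs) (L zero)) (box (D ∘ suc) (L ∘ suc))
      ≤⟨ ∑-mono (λ xs → bound xs) (box (D ∘ suc) (L ∘ suc)) ⟩
    ∑ rest (box (D ∘ suc) (L ∘ suc))
      ≤⟨ ∑-box≤1 (D ∘ suc) (L ∘ suc) {φ ∘ suc} (0≤φ ∘ suc) (p ∘ suc) ⟩
    1# ∎
    where
    rest : Assignment (D ∘ suc) → Carrier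
    rest xs = ∏ (λ i → φ (suc i) (lookup (D ∘ suc) xs i))
    bound : ∀ xs → ∑ (λ x → φ zero x * rest xs) (L zero) ≤ rest xs
    bound xs = begin
      ∑ (λ x → φ zero x * rest xs) (L zero)    ≈⟨ ∑-*ʳ (rest xs) (φ zero) (L zero) ⟩
      ∑ (φ zero) (L zero) * rest xs            ≈⟨ *-comm _ (rest xs) ⟩
      rest xs * ∑ (φ zero) (L zero)            ≤⟨ x≤1⇒z*x≤z (∏-nonNeg (λ i → 0≤φ (suc i) _)) (p zero) ⟩
      rest xs                                  ∎

  -- Each coordinate costs one factor `ρ`, whence the exponent `n`. The weights `φ` are arbitrary so
  -- that both the product law and the resampling kernels are covered.
  iterated≤∑-box : ∀ {n} (D : Fin n → Set) (L : ∀ i → List (D i)) {φ : ∀ i → D i → Carrier}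
    {op : ∀ i → Functional (D i)} {ρ} → 0# ≤ ρ → (∀ i a → 0# ≤ φ i a) → (∀ i → IsExpectation (op i)) →
    (∀ i g → (∀ a → 0# ≤ g a) → ρ * op i g ≤ ∑ (λ a → φ i a * g a) (L i)) →
    ∀ g → (∀ x → 0# ≤ g x) →
    pow ρ n * iterated D op g ≤ ∑ (λ x → ∏ (λ i → φ i (lookup D x i)) * g x) (box D L)
  iterated≤∑-box {zero}  D L 0≤ρ 0≤φ e p g 0≤g = ≤-reflexive (sym (+-identityʳ _))
  iterated≤∑-box {suc n} D L {φ} {op} {ρ} 0≤ρ 0≤φ e p g 0≤g = begin
    (ρ * pow ρ n) * iterated (D ∘ suc) (op ∘ suc) (λ xs → op zero (λ x → g (x , xs)))
      ≈⟨ *-assoc ρ (pow ρ n) _ ⟩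
    ρ * (pow ρ n * iterated (D ∘ suc) (op ∘ suc) (λ xs → op zero (λ x → g (x , xs))))
      ≤⟨ *-monoˡ-≤ 0≤ρ (iterated≤∑-box (D ∘ suc) (L ∘ suc) {φ ∘ suc} 0≤ρ (0≤φ ∘ suc) (e ∘ suc) (p ∘ suc)
           (λ xs → op zero (λ x → g (x , xs))) (λ xs → IsExpectation.F-nonNeg (e zero) (λ x → 0≤g (x , xs)))) ⟩
    ρ * ∑ (λ xs → rest xs * op zero (λ x → g (x , xs))) (box (D ∘ suc) (L ∘ suc))
      ≈⟨ ∑-*ˡ ρ _ (box (D ∘ suc) (L ∘ suc)) ⟨
    ∑ (λ xs → ρ * (rest xs * op zero (λ x → g (x , xs)))) (box (D ∘ suc) (L ∘ suc))
      ≤⟨ ∑-mono bound (box (D ∘ suc) (L ∘ suc)) ⟩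
    ∑ (λ xs → ∑ (λ x → (φ zero x * rest xs) * g (x , xs)) (L zero)) (box (D ∘ suc) (L ∘ suc))
      ≈⟨ ∑-cartesianProductWith _ (λ xs x → x , xs) (box (D ∘ suc) (L ∘ suc)) (L zero) ⟨
    ∑ (λ x → ∏ (λ i → φ i (lookup D x i)) * g x) (box D L) ∎
    where
    open Solver using (solve; _:=_; _:+_; _:*_; con)
    rest : Assignment (D ∘ suc) → Carrier
    rest xs = ∏ (λ i → φ (suc i) (lookup (D ∘ suc) xs i))
    bound : ∀ xs → ρ * (rest xs * op zero (λ x → g (x , xs))) ≤
                   ∑ (λ x → (φ zero x * rest xs) * g (x , xs)) (L zero)
    bound xs = begin
      ρ * (rest xs * op zero (λ x → g (x , xs)))
        ≈⟨ solve 3 (λ a b c → a :* (b :* c) := b :* (a :* c)) refl ρ (rest xs) _ ⟩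
      rest xs * (ρ * op zero (λ x → g (x , xs)))
        ≤⟨ *-monoˡ-≤ (∏-nonNeg (λ i → 0≤φ (suc i) _)) (p zero (λ x → g (x , xs)) (λ x → 0≤g (x , xs))) ⟩
      rest xs * ∑ (λ x → φ zero x * g (x , xs)) (L zero)
        ≈⟨ ∑-*ˡ (rest xs) _ (L zero) ⟨
      ∑ (λ x → rest xs * (φ zero x * g (x , xs))) (L zero)
        ≈⟨ ∑-cong (λ x → solve 3 (λ a b c → a :* (b :* c) := (b :* a) :* c) refl (rest xs) (φ zero x) (g (x , xs))) (L zero) ⟩
      ∑ (λ x → (φ zero x * rest xs) * g (x , xs)) (L zero) ∎

  -- Averaging over some or all variables

  choose-at : ∀ {A : Set} → Bool → Functional A → A → Functional A
  choose-at b F x = if b then F else at x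

  choose-at-isExpectation : ∀ {A : Set} b {F : Functional A} → IsExpectation F → ∀ x →
                            IsExpectation (choose-at b F x)
  choose-at-isExpectation true  e x = e
  choose-at-isExpectation false e x = at-isExpectation x

  -- The conditional expectation of `g` given the coordinates outside `S`, as a function of the
  -- assignment.
  resampled : ∀ {n} (D : Fin n → Set) → (∀ i → Functional (D i)) → Subset n →
              (Assignment D → Carrier) → Assignment D → Carrier
  resampled D avg S g x = iterated D (λ i → choose-at (Vec.lookup S i) (avg i) (lookup D x i)) g

  module _ {n} (D : Fin n → Set) {avg : ∀ i → Functional (D i)} (e : ∀ i → IsExpectation (avg i)) where

    resampled-isExpectation : ∀ S x → IsExpectation (λ g → resampled D avg S g x)
    resampled-isExpectation S x =
      iterated-isExpectation D (λ i → choose-at-isExpectation (Vec.lookup S i) (e i) (lookup D x i))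

  -- The average at `x` evaluates its argument only at assignments that agree with `x` off `S`.
  -- Through this, a clause whose scope avoids `S` keeps its truth value under the average.
  resampled-cong : ∀ {n} (D : Fin n → Set) {avg : ∀ i → Functional (D i)} (e : ∀ i → IsExpectation (avg i)) →
    ∀ S x {g h} → (∀ y → AgreeOff D S x y → g y ≈ h y) → resampled D avg S g x ≈ resampled D avg S h x
  resampled-cong {zero}  D e []          x        p = p tt (λ ())
  resampled-cong {suc n} D e (true ∷ S)  (x , xs) p =
    resampled-cong (D ∘ suc) (e ∘ suc) S xs (λ ys q → IsExpectation.F-cong (e zero) (λ a → p (a , ys) λ where
      zero    z∉ → contradiction here z∉
      (suc i) i∉ → q i (i∉ ∘ there)))
  resampled-cong {suc n} D e (false ∷ S) (x , xs) p =
    resampled-cong (D ∘ suc) (e ∘ suc) S xs (λ ys q → p (x , ys) λ where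
      zero    z∉ → ≡.refl
      (suc i) i∉ → q i (i∉ ∘ there))

  -- On one coordinate each operation is either the same average or the identity, and these commute;
  -- `fubini` moves the head past the tail of the other operation.
  resampled-comm : ∀ {n} (D : Fin n → Set) {avg : ∀ i → Functional (D i)} (e : ∀ i → IsExpectation (avg i)) →
    ∀ S T g x → resampled D avg S (resampled D avg T g) x ≈ resampled D avg T (resampled D avg S g) x
  resampled-comm {zero}  D e []      []      g x = refl
  resampled-comm {suc n} D {avg} e (s ∷ S) (t ∷ T) g (x , xs) = begin-equality
    resampled D₁ avg₁ S (λ ys → op s x (λ a → resampled D₁ avg₁ T (λ zs → op t a (λ b → g (b , zs))) ys)) xs
      ≈⟨ IsExpectation.F-cong (resampled-isExpectation D₁ e₁ S xs) (λ ys →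
           IsExpectation.fubini (choose-at-isExpectation s (e zero) x)
             (IsExpectation.isLinear (resampled-isExpectation D₁ e₁ T ys)) (λ a zs → op t a (λ b → g (b , zs)))) ⟩
    resampled D₁ avg₁ S (resampled D₁ avg₁ T (λ zs → op s x (λ a → op t a (λ b → g (b , zs))))) xs
      ≈⟨ resampled-comm D₁ e₁ S T _ xs ⟩
    resampled D₁ avg₁ T (resampled D₁ avg₁ S (λ zs → op s x (λ a → op t a (λ b → g (b , zs))))) xs
      ≈⟨ IsExpectation.F-cong (resampled-isExpectation D₁ e₁ T xs) (λ ys →
           IsExpectation.F-cong (resampled-isExpectation D₁ e₁ S ys) (λ zs → op-comm s t (λ b → g (b , zs)))) ⟩
    resampled D₁ avg₁ T (resampled D₁ avg₁ S (λ zs → op t x (λ a → op s a (λ b → g (b , zs))))) xs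
      ≈⟨ IsExpectation.F-cong (resampled-isExpectation D₁ e₁ T xs) (λ ys →
           IsExpectation.fubini (choose-at-isExpectation t (e zero) x)
             (IsExpectation.isLinear (resampled-isExpectation D₁ e₁ S ys)) (λ a zs → op s a (λ b → g (b , zs)))) ⟨
    resampled D₁ avg₁ T (λ ys → op t x (λ a → resampled D₁ avg₁ S (λ zs → op s a (λ b → g (b , zs))) ys)) xs ∎
    where
    D₁ : Fin n → Set
    D₁ = D ∘ suc
    avg₁ : ∀ i → Functional (D₁ i)
    avg₁ = avg ∘ suc
    e₁ : ∀ i → IsExpectation (avg₁ i)
    e₁ = e ∘ suc
    op : Bool → D zero → Functional (D zero)
    op b a = choose-at b (avg zero) a
    op-comm : ∀ s t h → op s x (λ a → op t a h) ≈ op t x (λ a → op s a h)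
    op-comm true  true  h = refl
    op-comm true  false h = refl
    op-comm false true  h = refl
    op-comm false false h = refl

  -- `F` reads only coordinates in `S` and the average over `S` reads only the others, so the
  -- factors are independent. At each coordinate one of the two is constant and leaves the average
  -- over that coordinate.
  uncorrelated : ∀ {n} (D : Fin n → Set) {avg : ∀ i → Functional (D i)} (e : ∀ i → IsExpectation (avg i)) →
    ∀ S {F : Assignment D → Carrier} → (∀ x y → AgreeOn D S x y → F x ≈ F y) → ∀ g →
    iterated D avg (λ x → F x * resampled D avg S g x) ≈ iterated D avg F * iterated D avg g
  uncorrelated {zero}  D e [] F-local g = refl
  uncorrelated {suc n} D {avg} e (true ∷ S) {F} F-local g = trans
    (IsExpectation.F-cong (iterated-isExpectation (D ∘ suc) (e ∘ suc)) (λ xs → IsExpectation.F-*ʳ (e zero) _ _))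
    (uncorrelated (D ∘ suc) (e ∘ suc) S (λ xs ys p → IsExpectation.F-cong (e zero)
      (λ a → F-local (a , xs) (a , ys) λ where
        zero    _         → ≡.refl
        (suc i) (there q) → p i q)) _)
  uncorrelated {suc n} D {avg} e (false ∷ S) {F} F-local g = trans
    (IsExpectation.F-cong (iterated-isExpectation (D ∘ suc) (e ∘ suc)) (λ xs → trans
      (IsExpectation.F-*-constant (e zero) (λ a b → F-local (a , xs) (b , xs) λ where
        (suc i) (there q) → ≡.refl) _)
      (*-congˡ (IsExpectation.fubini (e zero)
        (IsExpectation.isLinear (resampled-isExpectation (D ∘ suc) (e ∘ suc) S xs)) (λ a zs → g (a , zs))))))
    (uncorrelated (D ∘ suc) (e ∘ suc) S (λ xs ys p → IsExpectation.F-cong (e zero)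
      (λ a → F-local (a , xs) (a , ys) λ where
        zero    _         → ≡.refl
        (suc i) (there q) → p i q)) _)

-- Products of approximately known quantities

module Estimates (R : OrderedRing) where

  open OrderedRing R
  open OrderedRingProperties R
  open Relation.Binary.Reasoning.PartialOrder poset

  product-nearly-nonNeg : ∀ {x y δ η B C} → 0# ≤ x + δ → 0# ≤ y + η → 0# ≤ δ → 0# ≤ η →
    x ≤ B → y + η ≤ C → 0# ≤ x * y + (B * η + C * δ)
  product-nearly-nonNeg {x} {y} {δ} {η} {B} {C} 0≤x+δ 0≤y+η 0≤δ 0≤η x≤B y+η≤C = begin
    0#                             ≤⟨ *-nonNeg 0≤x+δ 0≤y+η ⟩
    (x + δ) * (y + η)
      ≈⟨ solve 4 (λ x y d e → (x :+ d) :* (y :+ e) := x :* y :+ (e :* x :+ d :* (y :+ e))) refl x y δ η ⟩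
    x * y + (η * x + δ * (y + η))  ≤⟨ +-mono-≤ ≤-refl (+-mono-≤ (*-monoˡ-≤ 0≤η x≤B) (*-monoˡ-≤ 0≤δ y+η≤C)) ⟩
    x * y + (η * B + δ * C)        ≈⟨ +-congˡ (+-cong (*-comm η B) (*-comm δ C)) ⟩
    x * y + (B * η + C * δ)        ∎
    where open Solver using (solve; _:=_; _:+_; _:*_)

  -- `y` may be negative, so the first inequality is multiplied by y + B instead, at a cost of 2Bδ.
  -- The surplus multiple of `B` is exchanged by the second inequality, which costs another Bδ.
  product-nearly-equal : ∀ {x x′ y δ B} → x ≤ x′ + δ → x′ ≤ x + δ → 0# ≤ δ → 0# ≤ y + B → y ≤ B → 0# ≤ B →
    x * y ≤ x′ * y + (B + (B + B)) * δ
  product-nearly-equal {x} {x′} {y} {δ} {B} x≤ x′≤ 0≤δ 0≤y+B y≤B 0≤B = +-cancelʳ-≤ (x * B) (begin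
    x * y + x * B                       ≈⟨ trans (*-comm _ _) (distribˡ _ _ _) ⟨
    (y + B) * x                         ≤⟨ *-monoˡ-≤ 0≤y+B x≤ ⟩
    (y + B) * (x′ + δ)
      ≈⟨ solve 4 (λ x y d b → (y :+ b) :* (x :+ d) := b :* x :+ (x :* y :+ d :* (y :+ b))) refl x′ y δ B ⟩
    B * x′ + (x′ * y + δ * (y + B))
      ≤⟨ +-mono-≤ (*-monoˡ-≤ 0≤B x′≤) (+-mono-≤ ≤-refl (*-monoˡ-≤ 0≤δ (+-mono-≤ y≤B ≤-refl))) ⟩
    B * (x + δ) + (x′ * y + δ * (B + B))
      ≈⟨ solve 4 (λ x p d b → b :* (x :+ d) :+ (p :+ d :* (b :+ b)) := (p :+ (b :+ (b :+ b)) :* d) :+ x :* b) refl x (x′ * y) δ B ⟩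
    (x′ * y + (B + (B + B)) * δ) + x * B ∎)
    where open Solver using (solve; _:=_; _:+_; _:*_)

-- Extremal instances: correlation of false clauses with the output

all-or-false : ∀ {m} (p : Vector Bool m) → (∀ k → p k ≡ true) ⊎ ∃ λ k → p k ≡ false
all-or-false {zero}  p = inj₁ λ ()
all-or-false {suc m} p with p zero in eq
... | false = inj₂ (zero , eq)
... | true  with all-or-false (p ∘ suc)
...   | inj₁ q       = inj₁ λ where zero → eq ; (suc k) → q k
...   | inj₂ (k , q) = inj₂ (suc k , q)

∧-true : ∀ {m} (p : Vector Bool m) → (∀ k → p k ≡ true) → foldr _∧_ true p ≡ true
∧-true {zero}  p q = ≡.refl
∧-true {suc m} p q rewrite q zero = ∧-true (p ∘ suc) (q ∘ suc)

∧-false : ∀ {m} (p : Vector Bool m) k → p k ≡ false → foldr _∧_ true p ≡ false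
∧-false p zero    q rewrite q = ≡.refl
∧-false p (suc k) q rewrite ∧-false (p ∘ suc) k q = ∧-zeroʳ (p zero)

false≢true : ∀ {b} → b ≡ false → b ≢ true
false≢true ≡.refl ()

module ExtremalInstance {n m} (I : Instance n m) (extremal : Extremal I) where

  open Instance I

  Overlap : Fin m → Fin m → Set
  Overlap k l = Nonempty (scope (clause k) ∩ scope (clause l))

  search : ∀ x → (∀ k → eval (clause k) x ≡ true) ⊎ ∃ λ k → eval (clause k) x ≡ false
  search x = all-or-false (λ k → eval (clause k) x)

  exclusive : ∀ {k l} → k ≢ l → Overlap k l → ∀ x → eval (clause k) x ≡ false → eval (clause l) x ≡ true
  exclusive {k} {l} k≢l o x q with <-cmp k l
  ... | tri< k<l _ _ with extremal k l k<l o x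
  ...   | p rewrite q = p
  exclusive {k} {l} k≢l o x q | tri≈ _ k≡l _ = contradiction k≡l k≢l
  exclusive {k} {l} k≢l o x q | tri> _ _ l<k
    with eval (clause l) x | extremal l k l<k (≡.subst Nonempty (∩-comm (scope (clause k)) (scope (clause l))) o) x
  ...   | true  | p = ≡.refl
  ...   | false | p = contradiction p (false≢true q)

  unaffected : ∀ {k l} → ¬ Overlap k l → ∀ {x y} → AgreeOff D (scope (clause k)) x y →
               eval (clause l) x ≡ eval (clause l) y
  unaffected {k} {l} ¬o {x} {y} p =
    local (clause l) x y (λ i i∈l → p i (λ i∈k → ¬o (i , x∈p∩q⁺ (i∈k , i∈l))))

  module _ (R : OrderedRing) where

    open OrderedRing R
    open Expectations R

    module FiniteRuns {avg : ∀ i → Functional (D i)} (e : ∀ i → IsExpectation (avg i))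
      (f : Assignment D → Carrier) (0≤f : ∀ x → 0# ≤ f x) (f≤1 : ∀ x → f x ≤ 1#) where

      open OrderedRingProperties R
      open Relation.Binary.Reasoning.PartialOrder poset

      𝔼 : Functional (Assignment D)
      𝔼 = iterated D avg

      𝔼-isExpectation : IsExpectation 𝔼
      𝔼-isExpectation = iterated-isExpectation D e

      module 𝔼 = IsExpectation 𝔼-isExpectation

      resampleClause : Fin m → (Assignment D → Carrier) → Assignment D → Carrier
      resampleClause k = resampled D avg (scope (clause k))

      module Resample k x = IsExpectation (resampled-isExpectation D e (scope (clause k)) x)

      -- The expectation of f at termination, restricted to runs from x that make
      -- fewer than N iterations, when the first false clause is always chosen.
      output : ℕ → Assignment D → Carrier
      output zero    x = 0#
      output (suc N) x = [ (λ _ → f x) , (λ (k , _) → resampleClause k (output N) x) ]′ (search x)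

      output-true : ∀ N x → (∀ k → eval (clause k) x ≡ true) → output (suc N) x ≈ f x
      output-true N x p with search x
      ... | inj₁ _       = refl
      ... | inj₂ (k , q) = contradiction (p k) (false≢true q)

      -- Two false clauses have disjoint scopes, so their resampling commutes.
      output-false : ∀ N k x → eval (clause k) x ≡ false → output (suc N) x ≈ resampleClause k (output N) x
      output-false N k x p with search x
      ... | inj₁ q = contradiction (q k) (false≢true p)
      ... | inj₂ (l , q) with l ≟ᶠ k
      ...   | yes ≡.refl = refl
      ...   | no l≢k     = commute N
        where
        k≁l : ¬ Overlap k l
        k≁l o = false≢true q (exclusive (l≢k ∘ ≡.sym) o x p)
        l≁k : ¬ Overlap l k
        l≁k o = false≢true p (exclusive l≢k o x q)
        commute : ∀ N → resampleClause l (output N) x ≈ resampleClause k (output N) x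
        commute zero    = trans (Resample.F-zero l x (λ _ → refl)) (sym (Resample.F-zero k x (λ _ → refl)))
        commute (suc N) = begin-equality
          resampleClause l (output (suc N)) x
            -- Clause `k` is still false at every assignment reached by resampling `l`, so the
            -- induction hypothesis may expand the output there by `k`.
            ≈⟨ resampled-cong D e (scope (clause l)) x
                 (λ y r → output-false N k y (≡.trans (≡.sym (unaffected l≁k {x} {y} r)) p)) ⟩
          resampleClause l (resampleClause k (output N)) x
            ≈⟨ resampled-comm D e (scope (clause l)) (scope (clause k)) (output N) x ⟩
          resampleClause k (resampleClause l (output N)) x
            ≈⟨ resampled-cong D e (scope (clause k)) x
                 (λ y r → output-false N l y (≡.trans (≡.sym (unaffected k≁l {x} {y} r)) q)) ⟨
          resampleClause k (output (suc N)) x ∎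

      output-nonNeg : ∀ N x → 0# ≤ output N x
      output-nonNeg zero    x = ≤-refl
      output-nonNeg (suc N) x with search x
      ... | inj₁ _       = 0≤f x
      ... | inj₂ (k , _) = Resample.F-nonNeg k x (output-nonNeg N)

      output≤1 : ∀ N x → output N x ≤ 1#
      output≤1 zero    x = 0≤1
      output≤1 (suc N) x with search x
      ... | inj₁ _       = f≤1 x
      ... | inj₂ (k , _) = Resample.F-≤1 k x (output≤1 N)

      output-step : ∀ N x → output N x ≤ output (suc N) x
      output-step zero    x = output-nonNeg 1 x
      output-step (suc N) x with search x
      ... | inj₁ _       = ≤-refl
      ... | inj₂ (k , _) = Resample.F-mono k x (output-step N)

      h : ℕ → Carrier
      h N = 𝔼 (output N)

      h-nonNeg : ∀ N → 0# ≤ h N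
      h-nonNeg N = 𝔼.F-nonNeg (output-nonNeg N)

      h≤1 : ∀ N → h N ≤ 1#
      h≤1 N = 𝔼.F-≤1 (output≤1 N)

      h-mono : ∀ {M N} → M ℕ.≤ N → h M ≤ h N
      h-mono {M} M≤N = go (ℕ.≤⇒≤′ M≤N)
        where
        go : ∀ {N} → M ℕ.≤′ N → h M ≤ h N
        go (ℕ.≤′-reflexive ≡.refl) = ≤-refl
        go (ℕ.≤′-step {N} p)       = ≤-trans (go p) (𝔼.F-mono (output-step N))

      fail hold : Fin m → Assignment D → Carrier
      fail k x = if eval (clause k) x then 0# else 1#
      hold k x = if eval (clause k) x then 1# else 0#

      fails holds : List (Fin m) → Assignment D → Carrier
      fails []       x = 1#
      fails (k ∷ ks) x = fail k x * fails ks x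
      holds []       x = 1#
      holds (k ∷ ks) x = hold k x * holds ks x

      fail+hold : ∀ k x → hold k x + fail k x ≈ 1#
      fail+hold k x with eval (clause k) x
      ... | true  = +-identityʳ 1#
      ... | false = +-identityˡ 1#

      fails-bounds : ∀ ks x → 0# ≤ fails ks x × fails ks x ≤ 1#
      fails-bounds []       x = 0≤1 , ≤-refl
      fails-bounds (k ∷ ks) x with eval (clause k) x | fails-bounds ks x
      ... | true  | _     = ≤-reflexive (sym (zeroˡ _)) , ≤-trans (≤-reflexive (zeroˡ _)) 0≤1
      ... | false | p , q = ≤-trans p (≤-reflexive (sym (*-identityˡ _))) , ≤-trans (≤-reflexive (*-identityˡ _)) q

      fails-unaffected : ∀ {k ls} → All (λ l → ¬ Overlap k l) ls → ∀ {x y} →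
        AgreeOff D (scope (clause k)) x y → fails ls x ≡ fails ls y
      fails-unaffected []              p = ≡.refl
      fails-unaffected {k} {l ∷ ls} (¬o ∷ ¬os) {x} {y} p = ≡.cong₂ (λ b z → (if b then 0# else 1#) * z)
        (unaffected {k} {l} ¬o {x} {y} p) (fails-unaffected ¬os {x} {y} p)

      fails-zero : ∀ {l ls} → l ∈ ls → ∀ x → eval (clause l) x ≡ true → fails ls x ≈ 0#
      fails-zero {l} (here ≡.refl) x p rewrite p = zeroˡ _
      fails-zero (there l∈ls) x p = trans (*-congˡ (fails-zero l∈ls x p)) (zeroʳ _)

      fails-overlap : ∀ {k l ls} → l ∈ ls → k ≢ l → Overlap k l → ∀ x → fail k x * fails ls x ≈ 0#
      fails-overlap {k} {l} {ls} l∈ls k≢l o x with eval (clause k) x in eq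
      ... | true  = zeroˡ _
      ... | false = trans (*-congˡ (fails-zero l∈ls x (exclusive k≢l o x eq))) (zeroʳ _)

      fail-local : ∀ k x y → AgreeOn D (scope (clause k)) x y → fail k x ≈ fail k y
      fail-local k x y p = reflexive (≡.cong (λ b → if b then 0# else 1#) (local (clause k) x y p))

      -- Each clause of the product uses up one iteration, its own resampling, which explains the
      -- delay `length ks`. Truncated subtraction gives the right value for small `N`, because `h 0`
      -- vanishes.
      fails-output : ∀ ks → Unique ks → ∀ N → 𝔼 (λ x → fails ks x * output N x) ≈ 𝔼 (fails ks) * h (N ∸ length ks)
      fails-output [] _ N = trans (𝔼.F-* 1# (output N)) (*-congʳ (sym 𝔼.F-one))
      fails-output (k ∷ ks) _ zero = trans (𝔼.F-zero (λ x → zeroʳ _))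
        (sym (trans (*-congˡ (𝔼.F-zero (λ _ → refl))) (zeroʳ _)))
      fails-output (k ∷ ks) (k∉ks ∷ !ks) (suc N)
        with any? (λ l → nonempty? (scope (clause k) ∩ scope (clause l))) ks
      ... | yes o with find o
      ...   | (l , l∈ks , o) = trans (𝔼.F-zero (λ x → trans (*-congʳ (zero-product x)) (zeroˡ _)))
                               (sym (trans (*-congʳ (𝔼.F-zero zero-product)) (zeroˡ _)))
        where
        zero-product : ∀ x → fail k x * fails ks x ≈ 0#
        zero-product = fails-overlap l∈ks (All.lookup k∉ks l∈ks) o
      fails-output (k ∷ ks) (k∉ks ∷ !ks) (suc N) | no ¬o = begin-equality
        𝔼 (λ x → (fail k x * fails ks x) * output (suc N) x)
          ≈⟨ 𝔼.F-cong pull-out ⟩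
        𝔼 (λ x → fail k x * resampleClause k (λ y → fails ks y * output N y) x)
          ≈⟨ uncorrelated D e (scope (clause k)) (fail-local k) _ ⟩
        𝔼 (fail k) * 𝔼 (λ y → fails ks y * output N y)
          ≈⟨ *-congˡ (fails-output ks !ks N) ⟩
        𝔼 (fail k) * (𝔼 (fails ks) * h (N ∸ length ks))
          ≈⟨ *-assoc _ _ _ ⟨
        (𝔼 (fail k) * 𝔼 (fails ks)) * h (N ∸ length ks)
          ≈⟨ *-congʳ factor ⟨
        𝔼 (λ x → fail k x * fails ks x) * h (N ∸ length ks) ∎
        where
        disjoint : All (λ l → ¬ Overlap k l) ks
        disjoint = ¬Any⇒All¬ ks ¬o
        constant : ∀ g x → fails ks x * resampleClause k g x ≈ resampleClause k (λ y → fails ks y * g y) x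
        constant g x = trans (sym (Resample.F-* k x (fails ks x) g))
          (resampled-cong D e (scope (clause k)) x (λ y p → *-congʳ (reflexive (fails-unaffected disjoint {x} {y} p))))
        pull-out : ∀ x → (fail k x * fails ks x) * output (suc N) x ≈
                         fail k x * resampleClause k (λ y → fails ks y * output N y) x
        pull-out x = trans (*-assoc _ _ _) (cases (eval (clause k) x) ≡.refl)
          where
          cases : ∀ b → b ≡ eval (clause k) x → (if b then 0# else 1#) * (fails ks x * output (suc N) x) ≈
                  (if b then 0# else 1#) * resampleClause k (λ y → fails ks y * output N y) x
          cases true  _ = trans (zeroˡ _) (sym (zeroˡ _))
          cases false q = *-congˡ (trans (*-congˡ (output-false N k x (≡.sym q))) (constant (output N) x))
        -- Since the scopes are disjoint, `fails ks` is its own average over the scope of `k`, so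
        -- `uncorrelated` applies to it too.
        factor : 𝔼 (λ x → fail k x * fails ks x) ≈ 𝔼 (fail k) * 𝔼 (fails ks)
        factor = trans (𝔼.F-cong (λ x → *-congˡ (begin-equality
            fails ks x                                   ≈⟨ *-identityʳ _ ⟨
            fails ks x * 1#                              ≈⟨ *-congˡ (Resample.F-one k x) ⟨
            fails ks x * resampleClause k (λ _ → 1#) x   ≈⟨ constant (λ _ → 1#) x ⟩
            resampleClause k (λ y → fails ks y * 1#) x   ≈⟨ Resample.F-cong k x (λ y → *-identityʳ _) ⟩
            resampleClause k (fails ks) x                ∎)))
          (uncorrelated D e (scope (clause k)) (fail-local k) _)

      -- Expanding each factor hold k = 1 - fail k, the correlations of the products of
      -- fail with the output are known, up to a delay of at most m iterations.
      module _ (N : ℕ) (Δ : Carrier) (0≤Δ : 0# ≤ Δ) (delay : h N ≤ h (N ∸ m) + Δ) where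

        private
          A B : List (Fin m) → List (Fin m) → Carrier
          A ks js = 𝔼 (λ x → (fails js x * holds ks x) * output N x)
          B ks js = 𝔼 (λ x → fails js x * holds ks x)

        split : ∀ k ks js x → (fails js x * holds (k ∷ ks) x) + (fails (k ∷ js) x * holds ks x) ≈ fails js x * holds ks x
        split k ks js x = begin-equality
          fails js x * (hold k x * holds ks x) + (fail k x * fails js x) * holds ks x
            ≈⟨ solve 4 (λ p q a b → p :* (a :* q) :+ (b :* p) :* q := (a :+ b) :* (p :* q)) refl
                 (fails js x) (holds ks x) (hold k x) (fail k x) ⟩
          (hold k x + fail k x) * (fails js x * holds ks x)
            ≈⟨ trans (*-congʳ (fail+hold k x)) (*-identityˡ _) ⟩
          fails js x * holds ks x ∎
          where open Solver using (solve; _:=_; _:+_; _:*_)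

        A-split : ∀ k ks js → A (k ∷ ks) js + A ks (k ∷ js) ≈ A ks js
        A-split k ks js = trans (sym (𝔼.F-+ _ _))
          (𝔼.F-cong (λ x → trans (sym (distribʳ _ _ _)) (*-congʳ (split k ks js x))))

        B-split : ∀ k ks js → B (k ∷ ks) js + B ks (k ∷ js) ≈ B ks js
        B-split k ks js = trans (sym (𝔼.F-+ _ _)) (𝔼.F-cong (split k ks js))

        -- Both bounds are proved together: `hold k` is 1 - `fail k`, so the upper bound for
        -- `k ∷ ks` uses the lower bound with `k` moved to `js`, and conversely. The two errors add
        -- up, so the constant doubles with each clause. Disjointness of `ks` and `js` keeps the
        -- extended `js` duplicate-free, and the bound on the lengths keeps the delay of `fails js`
        -- within `m`.
        nearly-independent : ∀ ks js → Unique ks → Unique js → All (λ k → All (k ≢_) js) ks →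
          length ks ℕ.+ length js ℕ.≤ m →
          A ks js ≤ B ks js * h N + doubling (length ks) * Δ ×
          B ks js * h N ≤ A ks js + doubling (length ks) * Δ
        nearly-independent [] js _ !js _ j≤m = upper , lower
          where
          P : Carrier
          P = 𝔼 (fails js)
          0≤P : 0# ≤ P
          0≤P = 𝔼.F-nonNeg (λ x → proj₁ (fails-bounds js x))
          P≤1 : P ≤ 1#
          P≤1 = 𝔼.F-≤1 (λ x → proj₂ (fails-bounds js x))
          A≈ : A [] js ≈ P * h (N ∸ length js)
          A≈ = trans (𝔼.F-cong (λ x → *-congʳ (*-identityʳ _))) (fails-output js !js N)
          B≈ : B [] js ≈ P
          B≈ = 𝔼.F-cong (λ x → *-identityʳ _)
          1Δ : 1# * Δ ≈ Δ
          1Δ = *-identityˡ Δ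
          upper : A [] js ≤ B [] js * h N + 1# * Δ
          upper = begin
            A [] js                   ≈⟨ A≈ ⟩
            P * h (N ∸ length js)     ≤⟨ *-monoˡ-≤ 0≤P (h-mono (ℕ.m∸n≤m N (length js))) ⟩
            P * h N                   ≤⟨ x≤x+y 0≤Δ ⟩
            P * h N + Δ               ≈⟨ +-cong (*-congʳ B≈) 1Δ ⟨
            B [] js * h N + 1# * Δ    ∎
          lower : B [] js * h N ≤ A [] js + 1# * Δ
          lower = begin
            B [] js * h N                         ≈⟨ *-congʳ B≈ ⟩
            P * h N
              ≤⟨ *-monoˡ-≤ 0≤P (≤-trans delay (+-mono-≤ (h-mono (ℕ.∸-monoʳ-≤ N j≤m)) ≤-refl)) ⟩
            P * (h (N ∸ length js) + Δ)           ≈⟨ trans (distribˡ _ _ _) (+-congˡ (*-comm P Δ)) ⟩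
            P * h (N ∸ length js) + Δ * P         ≤⟨ +-mono-≤ ≤-refl (x≤1⇒z*x≤z 0≤Δ P≤1) ⟩
            P * h (N ∸ length js) + Δ             ≈⟨ +-cong A≈ 1Δ ⟨
            A [] js + 1# * Δ                      ∎
        nearly-independent (k ∷ ks) js (k∉ks ∷ !ks) !js (k∉js ∷ ks∉js) len = upper , lower
          where
          open Solver using (solve; _:=_; _:+_; _:*_)
          ih₀ ih₁ : _ × _
          ih₀ = nearly-independent ks js !ks !js ks∉js (ℕ.≤-trans (ℕ.n≤1+n _) len)
          ih₁ = nearly-independent ks (k ∷ js) !ks (k∉js ∷ !js)
            (All.zipWith (λ (k≢l , l∉js) → (k≢l ∘ ≡.sym) ∷ l∉js) (k∉ks , ks∉js))
            (ℕ.≤-trans (ℕ.≤-reflexive (ℕ.+-suc (length ks) (length js))) len)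
          c : Carrier
          c = doubling (length ks) * Δ
          A₁ A₂ B₁ B₂ : Carrier
          A₁ = A (k ∷ ks) js
          A₂ = A ks (k ∷ js)
          B₁ = B (k ∷ ks) js
          B₂ = B ks (k ∷ js)
          regroup : ∀ x → x + c + c ≈ x + (doubling (length ks) + doubling (length ks)) * Δ
          regroup x = solve 3 (λ x d e → x :+ d :* e :+ d :* e := x :+ (d :+ d) :* e) refl x (doubling (length ks)) Δ
          upper : A₁ ≤ B₁ * h N + doubling (suc (length ks)) * Δ
          upper = +-cancelʳ-≤ A₂ (begin
            A₁ + A₂                     ≈⟨ A-split k ks js ⟩
            A ks js                     ≤⟨ proj₁ ih₀ ⟩
            B ks js * h N + c           ≈⟨ +-congʳ (trans (*-congʳ (sym (B-split k ks js))) (distribʳ _ _ _)) ⟩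
            (B₁ * h N + B₂ * h N) + c   ≤⟨ +-mono-≤ (+-mono-≤ ≤-refl (proj₂ ih₁)) ≤-refl ⟩
            (B₁ * h N + (A₂ + c)) + c
              ≈⟨ solve 3 (λ a b c → (a :+ (b :+ c)) :+ c := (a :+ c :+ c) :+ b) refl (B₁ * h N) A₂ c ⟩
            (B₁ * h N + c + c) + A₂     ≈⟨ +-congʳ (regroup _) ⟩
            (B₁ * h N + doubling (suc (length ks)) * Δ) + A₂ ∎)
          lower : B₁ * h N ≤ A₁ + doubling (suc (length ks)) * Δ
          lower = +-cancelʳ-≤ (B₂ * h N) (begin
            B₁ * h N + B₂ * h N         ≈⟨ trans (*-congʳ (sym (B-split k ks js))) (distribʳ _ _ _) ⟨
            B ks js * h N               ≤⟨ proj₂ ih₀ ⟩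
            A ks js + c                 ≈⟨ +-congʳ (A-split k ks js) ⟨
            (A₁ + A₂) + c               ≤⟨ +-mono-≤ (+-mono-≤ ≤-refl (proj₁ ih₁)) ≤-refl ⟩
            (A₁ + (B₂ * h N + c)) + c
              ≈⟨ solve 3 (λ a b c → (a :+ (b :+ c)) :+ c := (a :+ c :+ c) :+ b) refl A₁ (B₂ * h N) c ⟩
            (A₁ + c + c) + B₂ * h N     ≈⟨ +-congʳ (regroup _) ⟩
            (A₁ + doubling (suc (length ks)) * Δ) + B₂ * h N ∎)

      satisfied : Assignment D → Carrier
      satisfied x = if formula I x then 1# else 0#

      holds-one : ∀ ks x → (∀ k → eval (clause k) x ≡ true) → holds ks x ≈ 1#
      holds-one []       x p = refl
      holds-one (k ∷ ks) x p rewrite p k = trans (*-identityˡ _) (holds-one ks x p)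

      holds-zero : ∀ {k ks} → k ∈ ks → ∀ x → eval (clause k) x ≡ false → holds ks x ≈ 0#
      holds-zero (here ≡.refl) x p rewrite p = zeroˡ _
      holds-zero (there k∈ks)  x p = trans (*-congˡ (holds-zero k∈ks x p)) (zeroʳ _)

      holds-all : ∀ x → holds (allFin m) x ≈ satisfied x
      holds-all x with search x
      ... | inj₁ p       = trans (holds-one (allFin m) x p)
        (reflexive (≡.cong (λ b → if b then 1# else 0#) (≡.sym (∧-true (λ k → eval (clause k) x) p))))
      ... | inj₂ (k , p) = trans (holds-zero (∈-allFin k) x p)
        (reflexive (≡.cong (λ b → if b then 1# else 0#) (≡.sym (∧-false (λ k → eval (clause k) x) k p))))

      satisfied-output : ∀ N x → satisfied x * output (suc N) x ≈ satisfied x * f x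
      satisfied-output N x with search x
      ... | inj₁ _       = refl
      ... | inj₂ (k , p) rewrite ∧-false (λ k → eval (clause k) x) k p = trans (zeroˡ _) (sym (zeroˡ _))

      mass goal : Carrier
      mass = 𝔼 satisfied
      goal = 𝔼 (λ x → satisfied x * f x)

      mass-nonNeg : 0# ≤ mass
      mass-nonNeg = 𝔼.F-nonNeg (λ x → if-nonNeg (formula I x) 0≤1)

      -- The expansion starts from all clauses as `hold` factors and no `fail` factor. The budget is
      -- a successor because `output zero` vanishes even on satisfied assignments.
      goal≤ : ∀ N Δ → 0# ≤ Δ → h (suc N) ≤ h (suc N ∸ m) + Δ → goal ≤ mass * h (suc N) + doubling m * Δ
      goal≤ N Δ 0≤Δ delay = begin
        goal
          ≈⟨ 𝔼.F-cong (λ x → trans (*-congʳ (trans (*-identityˡ _) (holds-all x))) (satisfied-output N x)) ⟨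
        𝔼 (λ x → (fails [] x * holds (allFin m) x) * output (suc N) x)
          ≤⟨ proj₁ (nearly-independent (suc N) Δ 0≤Δ delay (allFin m) [] (Unique.allFin⁺ m) []
               (All.universal (λ _ → []) (allFin m))
               (ℕ.≤-reflexive (≡.trans (ℕ.+-identityʳ _) len))) ⟩
        𝔼 (λ x → fails [] x * holds (allFin m) x) * h (suc N) + doubling (length (allFin m)) * Δ
          ≈⟨ +-cong (*-congʳ (𝔼.F-cong (λ x → trans (*-identityˡ _) (holds-all x))))
               (reflexive (≡.cong (λ j → doubling j * Δ) len)) ⟩
        mass * h (suc N) + doubling m * Δ ∎
        where
        len : length (allFin m) ≡ m
        len = length-tabulate {n = m} id

      -- With stride `suc m` each new horizon is a successor even for `m` = 0, as `goal≤` requires,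
      -- and going back `m` iterations from it does not pass the previous horizon.
      horizon : ℕ → ℕ
      horizon M = M ℕ.* suc m

      -- The sum of the inequalities goal≤ over N = horizon 1, …, horizon M telescopes.
      goal-multiple : ∀ M → fromℕ M * goal ≤ mass * (fromℕ M * h (horizon M)) + doubling m * h (horizon M)
      goal-multiple zero = begin
        0# * goal      ≈⟨ zeroˡ _ ⟩
        0#
          ≤⟨ +-nonNeg (*-nonNeg mass-nonNeg (≤-reflexive (sym (zeroˡ _)))) (*-nonNeg (doubling-nonNeg m) (h-nonNeg 0)) ⟩
        mass * (0# * h 0) + doubling m * h 0 ∎
      goal-multiple (suc M) = begin
        (1# + κ) * goal
          ≈⟨ trans (distribʳ _ _ _) (+-congʳ (*-identityˡ _)) ⟩
        goal + κ * goal
          ≤⟨ +-mono-≤ (goal≤ _ Δ (≤⇒0≤- g≤g′) delay) (goal-multiple M) ⟩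
        (mass * g′ + d * Δ) + (mass * (κ * g) + d * g)
          -- Monotonicity of `h` moves the earlier main terms to the last horizon; the error terms
          -- then combine by Δ + g = g′.
          ≤⟨ +-mono-≤ ≤-refl (+-mono-≤ (*-monoˡ-≤ mass-nonNeg (*-monoˡ-≤ (fromℕ-nonNeg M) g≤g′)) ≤-refl) ⟩
        (mass * g′ + d * Δ) + (mass * (κ * g′) + d * g)
          ≈⟨ solve 6 (λ z g′ d Δ k g → (z :* g′ :+ d :* Δ) :+ (z :* (k :* g′) :+ d :* g) :=
               z :* ((con 1 :+ k) :* g′) :+ d :* (Δ :+ g)) refl mass g′ d Δ κ g ⟩
        mass * ((1# + κ) * g′) + d * (Δ + g)
          ≈⟨ +-congˡ (*-congˡ (x-y+y≈x g′ g)) ⟩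
        mass * ((1# + κ) * g′) + d * g′ ∎
        where
        open Solver using (solve; _:=_; _:+_; _:*_; con)
        κ d g g′ Δ : Carrier
        κ  = fromℕ M
        d  = doubling m
        g  = h (horizon M)
        g′ = h (horizon (suc M))
        Δ  = g′ - g
        g≤g′ : g ≤ g′
        g≤g′ = h-mono (ℕ.m≤n+m (horizon M) (suc m))
        delay : g′ ≤ h (horizon (suc M) ∸ m) + Δ
        delay = begin
          g′        ≈⟨ x-y+y≈x g′ g ⟨
          Δ + g     ≤⟨ +-mono-≤ ≤-refl (h-mono (ℕ.≤-trans (ℕ.n≤1+n (horizon M)) (ℕ.≤-reflexive (≡.sym (≡.trans
                         (≡.cong (_∸ m) (≡.sym (ℕ.+-suc m (horizon M)))) (ℕ.m+n∸m≡n m (suc (horizon M)))))))) ⟩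
          Δ + h (horizon (suc M) ∸ m)  ≈⟨ +-comm _ _ ⟩
          h (horizon (suc M) ∸ m) + Δ ∎

      -- `τ` is 1/M, supplied as a witness since the ring has no division. The telescoped error is
      -- at most 2^m because `h` stays below 1, so its average is at most 2^m / M.
      goal-bound : ∀ M {τ} → 0# ≤ τ → fromℕ M * τ ≈ 1# → goal ≤ mass * h (horizon M) + doubling m * τ
      goal-bound M {τ} 0≤τ κτ≈1 = begin
        goal                         ≈⟨ trans (*-congʳ κτ≈1) (*-identityˡ goal) ⟨
        (κ * τ) * goal               ≈⟨ solve 3 (λ k t b → (k :* t) :* b := t :* (k :* b)) refl κ τ goal ⟩
        τ * (κ * goal)               ≤⟨ *-monoˡ-≤ 0≤τ (goal-multiple M) ⟩
        τ * (mass * (κ * g) + d * g)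
          ≈⟨ solve 5 (λ t z k g d → t :* (z :* (k :* g) :+ d :* g) := (k :* t) :* (z :* g) :+ (d :* t) :* g) refl τ mass κ g d ⟩
        (κ * τ) * (mass * g) + (d * τ) * g
          ≤⟨ +-mono-≤ (≤-reflexive (trans (*-congʳ κτ≈1) (*-identityˡ _)))
               (x≤1⇒z*x≤z (*-nonNeg (doubling-nonNeg m) 0≤τ) (h≤1 (horizon M))) ⟩
        mass * g + d * τ ∎
        where
        open Solver using (solve; _:=_; _:+_; _:*_)
        κ g d : Carrier
        κ = fromℕ M
        g = h (horizon M)
        d = doubling m

∧-true⁻ : ∀ {m} (p : Fin m → Bool) → foldr _∧_ true p ≡ true → ∀ k → p k ≡ true
∧-true⁻ p q k with p k in eq
... | true  = ≡.refl
... | false = contradiction q (false≢true (∧-false p k eq))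

⌊∈?⌋≡lookup : ∀ {n} i (S : Subset n) → ⌊ i ∈? S ⌋ ≡ Vec.lookup S i
⌊∈?⌋≡lookup i S with i ∈? S | Vec.lookup S i in eq
... | yes i∈S | b     = ≡.trans (≡.sym ([]=⇒lookup i∈S)) eq
... | no  i∉S | false = ≡.refl
... | no  i∉S | true  = contradiction (lookup⇒[]= i S eq) i∉S

-- Finite enumeration of histories

module Histories {n m} (I : Instance n m) where

  open Instance I

  depth : History I → ℕ
  depth (start x)    = 0
  depth (step h k x) = suc (depth h)

  states : History I → List (Assignment D)
  states (start x)    = x ∷ []
  states (step h k x) = x ∷ states h

  module Levels (L : ∀ i → List (D i)) where

    extensions : List (Fin m × Assignment D)
    extensions = cartesianProduct (allFin m) (box D L)

    extend : History I → Fin m × Assignment D → History I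
    extend h (k , x) = step h k x

    -- `upTo N` contains the histories with fewer than `N` iterations, the ones that `output N`
    -- accounts for.
    level upTo : ℕ → List (History I)
    level zero    = List.map start (box D L)
    level (suc j) = cartesianProductWith extend (level j) extensions
    upTo zero     = []
    upTo (suc j)  = upTo j ++ level j

    ∈-level : ∀ h → (∀ {x} → x ∈ states h → x ∈ box D L) → h ∈ level (depth h)
    ∈-level (start x)    p = ∈-map⁺ start (p (here ≡.refl))
    ∈-level (step h k x) p = ∈-cartesianProductWith⁺ extend (∈-level h (p ∘ there))
      (∈-cartesianProduct⁺ (∈-allFin k) (p (here ≡.refl)))

    ∈-upTo : ∀ {h N} → h ∈ level (depth h) → depth h ℕ.< N → h ∈ upTo N
    ∈-upTo {h} {suc N} h∈ d<N with ℕ.m<1+n⇒m<n∨m≡n d<N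
    ... | inj₁ d<N    = ∈-++⁺ˡ (∈-upTo h∈ d<N)
    ... | inj₂ ≡.refl = ∈-++⁺ʳ (upTo N) h∈

    level-depth : ∀ j {h} → h ∈ level j → depth h ≡ j
    level-depth zero h∈ with ∈-map⁻ start h∈
    ... | _ , _ , ≡.refl = ≡.refl
    level-depth (suc j) h∈ with ∈-cartesianProductWith⁻ extend (level j) extensions h∈
    ... | _ , _ , h′∈ , _ , ≡.refl = ≡.cong suc (level-depth j h′∈)

    level-current : ∀ j {h} → h ∈ level j → current I h ∈ box D L
    level-current zero h∈ with ∈-map⁻ start h∈
    ... | _ , x∈ , ≡.refl = x∈
    level-current (suc j) h∈ with ∈-cartesianProductWith⁻ extend (level j) extensions h∈
    ... | _ , _ , _ , kx∈ , ≡.refl with ∈-cartesianProductWith⁻ _,_ (allFin m) (box D L) kx∈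
    ...   | _ , _ , _ , x∈ , ≡.refl = x∈

    upTo-depth : ∀ N {h} → h ∈ upTo N → depth h ℕ.< N
    upTo-depth (suc N) h∈ with ∈-++⁻ (upTo N) h∈
    ... | inj₁ p = ℕ.m<n⇒m<1+n (upTo-depth N p)
    ... | inj₂ p = ℕ.s≤s (ℕ.≤-reflexive (level-depth N p))

    module _ (!L : ∀ i → Unique (L i)) where

      level-unique : ∀ j → Unique (level j)
      level-unique zero    = Unique.map⁺ (λ where ≡.refl → ≡.refl) (box-unique D L !L)
      level-unique (suc j) = Unique.cartesianProductWith⁺ extend (λ where ≡.refl → ≡.refl , ≡.refl)
        (level-unique j) (Unique.cartesianProduct⁺ (Unique.allFin⁺ m) (box-unique D L !L))

      upTo-unique : ∀ N → Unique (upTo N)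
      upTo-unique zero    = []
      upTo-unique (suc N) = Unique.++⁺ (upTo-unique N) (level-unique N)
        (λ (p , q) → ℕ.<⇒≢ (upTo-depth N p) (level-depth N q))

-- The law of the run with values in an ordered ring: mass i is the mass function
-- of the i-th variable and rule h k the probability of choosing clause k after h.
record Process {n m} (I : Instance n m) (R : OrderedRing) : Set where
  open Instance I
  open OrderedRing R
  open Expectations R using (∏)
  field
    mass        : ∀ i → D i → Carrier
    mass-nonNeg : ∀ i a → 0# ≤ mass i a
    rule        : History I → Fin m → Carrier
    rule-nonNeg : ∀ h k → 0# ≤ rule h k
    rule-true   : ∀ h k → eval (clause k) (current I h) ≡ true → rule h k ≈ 0#
    rule-total  : ∀ h → formula I (current I h) ≡ false → foldr _+_ 0# (rule h) ≈ 1#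

  law : Assignment D → Carrier
  law x = ∏ (λ i → mass i (lookup D x i))

  kernel : Fin m → Assignment D → ∀ i → D i → Carrier
  kernel k x i a =
    if ⌊ i ∈? scope (clause k) ⌋
    then mass i a
    else if ⌊ _≟ᵥ_ I a (lookup D x i) ⌋ then 1# else 0#

  weight : History I → Carrier
  weight (start x)    = law x
  weight (step h k x) = weight h * rule h k * ∏ (λ i → kernel k (current I h) i (lookup D x i))

  final : History I → Carrier
  final h = if formula I (current I h) then weight h else 0#

-- Mass of the terminated runs, from above and from below

module ProcessProperties {n m} {I : Instance n m} {R : OrderedRing} (P : Process I R) where

  open Instance I
  open OrderedRing R
  open OrderedRingProperties R
  open Expectations R
  open Process P
  open Relation.Binary.Reasoning.PartialOrder poset hiding (start)

  law-nonNeg : ∀ x → 0# ≤ law x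
  law-nonNeg x = ∏-nonNeg (λ i → mass-nonNeg i (lookup D x i))

  kernel-nonNeg : ∀ k x i a → 0# ≤ kernel k x i a
  kernel-nonNeg k x i a with ⌊ i ∈? scope (clause k) ⌋ | ⌊ _≟ᵥ_ I a (lookup D x i) ⌋
  ... | true  | _     = mass-nonNeg i a
  ... | false | true  = 0≤1
  ... | false | false = ≤-refl

  weight-nonNeg : ∀ h → 0# ≤ weight h
  weight-nonNeg (start x)    = law-nonNeg x
  weight-nonNeg (step h k x) = *-nonNeg (*-nonNeg (weight-nonNeg h) (rule-nonNeg h k))
    (∏-nonNeg (λ i → kernel-nonNeg k (current I h) i (lookup D x i)))

  final-nonNeg : ∀ h → 0# ≤ final h
  final-nonNeg h = if-nonNeg (formula I (current I h)) (weight-nonNeg h)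

  module _ (L : ∀ i → List (D i)) (!L : ∀ i → Unique (L i)) (mass≤1 : ∀ i → ∑ (mass i) (L i) ≤ 1#) where

    open Histories I
    open Levels L

    kernel≤1 : ∀ k x i → ∑ (kernel k x i) (L i) ≤ 1#
    kernel≤1 k x i with ⌊ i ∈? scope (clause k) ⌋
    ... | true  = mass≤1 i
    ... | false = ≤-trans (∑-point (_≟ᵥ_ I) (if-nonNeg ⌊ _≟ᵥ_ I b b ⌋ 0≤1) off (!L i)) (at-most-one b)
      where
      b : D i
      b = lookup D x i
      at-most-one : ∀ a → (if ⌊ _≟ᵥ_ I a b ⌋ then 1# else 0#) ≤ 1#
      at-most-one a with ⌊ _≟ᵥ_ I a b ⌋
      ... | true  = ≤-refl
      ... | false = 0≤1
      off : ∀ a → a ≢ b → (if ⌊ _≟ᵥ_ I a b ⌋ then 1# else 0#) ≈ 0#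
      off a a≢b with _≟ᵥ_ I a b
      ... | yes a≡b = contradiction a≡b a≢b
      ... | no  _   = refl

    law≤1 : ∑ law (box D L) ≤ 1#
    law≤1 = ∑-box≤1 D L mass-nonNeg mass≤1

    ∑-extensions : ∀ (F : Fin m × Assignment D → Carrier) →
      ∑ F extensions ≈ ∑ (λ k → ∑ (λ x → F (k , x)) (box D L)) (allFin m)
    ∑-extensions F = ∑-cartesianProductWith F _,_ (allFin m) (box D L)

    ∑-rule : ∀ h → formula I (current I h) ≡ false → ∑ (rule h) (allFin m) ≈ 1#
    ∑-rule h p = trans (∑-tabulate (rule h) id) (rule-total h p)

    ∑-rule-final : ∀ h → formula I (current I h) ≡ true → ∑ (rule h) (allFin m) ≈ 0#
    ∑-rule-final h p = trans (∑-cong (λ k → rule-true h k (∧-true⁻ _ p k)) (allFin m)) (∑-zero (allFin m))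

    -- Conservation of mass in one step: a satisfied history keeps its weight as `final`, an
    -- unsatisfied one passes it on to its extensions, and only what leaves the box is lost.
    extensions-upper : ∀ h → final h + ∑ (λ e → weight (extend h e)) extensions ≤ weight h
    extensions-upper h = begin
      final h + ∑ (λ e → weight (extend h e)) extensions
        ≈⟨ +-congˡ (∑-extensions _) ⟩
      final h + ∑ (λ k → ∑ (λ x → weight (step h k x)) (box D L)) (allFin m)
        ≤⟨ +-mono-≤ ≤-refl (∑-mono bound (allFin m)) ⟩
      final h + ∑ (λ k → weight h * rule h k) (allFin m)
        ≈⟨ +-congˡ (∑-*ˡ (weight h) (rule h) (allFin m)) ⟩
      final h + weight h * ∑ (rule h) (allFin m)
        ≈⟨ cases (formula I (current I h)) ≡.refl ⟩
      weight h ∎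
      where
      bound : ∀ k → ∑ (λ x → weight (step h k x)) (box D L) ≤ weight h * rule h k
      bound k = ≤-trans (≤-reflexive (∑-*ˡ (weight h * rule h k) _ (box D L)))
        (x≤1⇒z*x≤z (*-nonNeg (weight-nonNeg h) (rule-nonNeg h k))
          (∑-box≤1 D L (kernel-nonNeg k (current I h)) (kernel≤1 k (current I h))))
      cases : ∀ b → b ≡ formula I (current I h) →
              (if b then weight h else 0#) + weight h * ∑ (rule h) (allFin m) ≈ weight h
      cases true  p = trans (+-congˡ (trans (*-congˡ (∑-rule-final h (≡.sym p))) (zeroʳ _))) (+-identityʳ _)
      cases false p = trans (+-congˡ (trans (*-congˡ (∑-rule h (≡.sym p))) (*-identityʳ _))) (+-identityˡ _)

    -- The second sum, the mass still present after `N` iterations, is what makes the induction go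
    -- through.
    upTo-upper : ∀ N → ∑ final (upTo N) + ∑ weight (level N) ≤ 1#
    upTo-upper zero = begin
      0# + ∑ weight (List.map start (box D L))    ≈⟨ trans (+-identityˡ _) (∑-map weight start (box D L)) ⟩
      ∑ law (box D L)                             ≤⟨ law≤1 ⟩
      1# ∎
    upTo-upper (suc N) = begin
      ∑ final (upTo N ++ level N) + ∑ weight (level (suc N))
        ≈⟨ +-cong (∑-++ final (upTo N) (level N)) (∑-cartesianProductWith weight extend (level N) extensions) ⟩
      (∑ final (upTo N) + ∑ final (level N)) + ∑ (λ h → ∑ (λ e → weight (extend h e)) extensions) (level N)
        ≈⟨ trans (+-assoc _ _ _) (+-congˡ (sym (∑-+ _ _ (level N)))) ⟩
      ∑ final (upTo N) + ∑ (λ h → final h + ∑ (λ e → weight (extend h e)) extensions) (level N)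
        ≤⟨ +-mono-≤ ≤-refl (∑-mono extensions-upper (level N)) ⟩
      ∑ final (upTo N) + ∑ weight (level N)
        ≤⟨ upTo-upper N ⟩
      1# ∎

    final≤1 : ∀ N → ∑ final (upTo N) ≤ 1#
    final≤1 N = ≤-trans (x≤x+y (∑-nonNeg weight-nonNeg (level N))) (upTo-upper N)

    module LowerBound (extremal : Extremal I) {avg : ∀ i → Functional (D i)} (e : ∀ i → IsExpectation (avg i))
      {ρ : Carrier} (0≤ρ : 0# ≤ ρ) (ρ≤1 : ρ ≤ 1#)
      (avg≤mass : ∀ i g → (∀ a → 0# ≤ g a) → ρ * avg i g ≤ ∑ (λ a → mass i a * g a) (L i))
      (f : Assignment D → Carrier) (0≤f : ∀ x → 0# ≤ f x) (f≤1 : ∀ x → f x ≤ 1#) where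

      open ExtremalInstance I extremal
      open FiniteRuns R e f 0≤f f≤1 hiding (mass; mass-nonNeg)
      module Runs = FiniteRuns R e f 0≤f f≤1

      r : Carrier
      r = pow ρ n

      0≤r : 0# ≤ r
      0≤r = pow-nonNeg 0≤ρ n

      r≤1 : r ≤ 1#
      r≤1 = pow≤1 0≤ρ ρ≤1 n

      𝔼≤law : ∀ g → (∀ x → 0# ≤ g x) → r * 𝔼 g ≤ ∑ (λ x → law x * g x) (box D L)
      𝔼≤law = iterated≤∑-box D L 0≤ρ mass-nonNeg e avg≤mass

      -- A coordinate outside the scope keeps its value, and the sum over the list sees that value
      -- only if the list contains it; hence `x` is taken from the box.
      resampleClause≤kernel : ∀ k {x} → x ∈ box D L → ∀ g → (∀ y → 0# ≤ g y) →
        r * resampleClause k g x ≤ ∑ (λ y → ∏ (λ i → kernel k x i (lookup D y i)) * g y) (box D L)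
      resampleClause≤kernel k {x} x∈ = iterated≤∑-box D L 0≤ρ (kernel-nonNeg k x)
        (λ i → choose-at-isExpectation (Vec.lookup (scope (clause k)) i) (e i) (lookup D x i)) op≤
        where
        op≤ : ∀ i g → (∀ a → 0# ≤ g a) →
          ρ * choose-at (Vec.lookup (scope (clause k)) i) (avg i) (lookup D x i) g ≤ ∑ (λ a → kernel k x i a * g a) (L i)
        op≤ i g 0≤g rewrite ⌊∈?⌋≡lookup i (scope (clause k)) with Vec.lookup (scope (clause k)) i
        ... | true  = avg≤mass i g 0≤g
        ... | false = begin
          ρ * g b            ≈⟨ *-comm ρ (g b) ⟩
          g b * ρ            ≤⟨ x≤1⇒z*x≤z (0≤g b) ρ≤1 ⟩
          g b                ≤⟨ own ⟩
          φ b                ≤⟨ ∈⇒≤∑ {f = φ} φ-nonNeg (∈-box⁻ D L x∈ i) ⟩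
          ∑ φ (L i)          ∎
          where
          b : D i
          b = lookup D x i
          φ : D i → Carrier
          φ a = (if ⌊ _≟ᵥ_ I a b ⌋ then 1# else 0#) * g a
          φ-nonNeg : ∀ a → 0# ≤ φ a
          φ-nonNeg a = *-nonNeg (if-nonNeg ⌊ _≟ᵥ_ I a b ⌋ 0≤1) (0≤g a)
          own : g b ≤ φ b
          own with _≟ᵥ_ I b b
          ... | yes _  = ≤-reflexive (sym (*-identityˡ _))
          ... | no b≢b = contradiction ≡.refl b≢b

      -- The expected output if the algorithm is stopped s iterations after h.
      potential : ℕ → History I → Carrier
      potential s h = weight h * output s (current I h)

      outcome : History I → Carrier
      outcome h = final h * f (current I h)

      outcome-nonNeg : ∀ h → 0# ≤ outcome h
      outcome-nonNeg h = *-nonNeg (final-nonNeg h) (0≤f (current I h))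

      -- A satisfied history turns its potential into `outcome`. Otherwise `output-false` expands
      -- the output by whichever clause the rule selects, so every clause with positive probability
      -- gives the same bound and the probabilities sum to 1. The factor `r` pays for one round of
      -- normalised sampling.
      extensions-lower : ∀ s h → current I h ∈ box D L →
        r * potential (suc s) h ≤ outcome h + ∑ (λ e → potential s (extend h e)) extensions
      extensions-lower s h x∈ = cases (formula I x) ≡.refl
        where
        x : Assignment D
        x = current I h
        rest : Carrier
        rest = ∑ (λ e → potential s (extend h e)) extensions
        0≤rest : 0# ≤ rest
        0≤rest = ∑-nonNeg (λ (k , y) → *-nonNeg (weight-nonNeg (step h k y)) (output-nonNeg s y)) extensions
        per-clause : ∀ k → (weight h * rule h k) * (r * output (suc s) x) ≤
                     ∑ (λ y → potential s (step h k y)) (box D L)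
        per-clause k = ≤-trans (go (eval (clause k) x) ≡.refl) (≤-reflexive (trans
            (sym (∑-*ˡ (weight h * rule h k) _ (box D L)))
            (∑-cong (λ y → sym (*-assoc _ _ _)) (box D L))))
          where
          κ : Assignment D → Carrier
          κ y = ∏ (λ i → kernel k x i (lookup D y i)) * output s y
          go : ∀ b → b ≡ eval (clause k) x →
               (weight h * rule h k) * (r * output (suc s) x) ≤ (weight h * rule h k) * ∑ κ (box D L)
          go true  p = ≤-reflexive (trans (vanish _) (sym (vanish _)))
            where
            vanish : ∀ c → (weight h * rule h k) * c ≈ 0#
            vanish c = trans (*-congʳ (trans (*-congˡ (rule-true h k (≡.sym p))) (zeroʳ _))) (zeroˡ c)
          go false p = *-monoˡ-≤ (*-nonNeg (weight-nonNeg h) (rule-nonNeg h k)) (≤-trans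
            (≤-reflexive (*-congˡ (output-false s k x (≡.sym p))))
            (resampleClause≤kernel k x∈ (output s) (output-nonNeg s)))
        cases : ∀ b → b ≡ formula I x →
          r * potential (suc s) h ≤ (if b then weight h else 0#) * f x + rest
        cases true  p = begin
          r * (weight h * output (suc s) x)    ≈⟨ *-comm r _ ⟩
          (weight h * output (suc s) x) * r    ≤⟨ x≤1⇒z*x≤z (*-nonNeg (weight-nonNeg h) (output-nonNeg (suc s) x)) r≤1 ⟩
          weight h * output (suc s) x          ≈⟨ *-congˡ (output-true s x (∧-true⁻ _ (≡.sym p))) ⟩
          weight h * f x                       ≤⟨ x≤x+y 0≤rest ⟩
          weight h * f x + rest                ∎
        cases false p = begin
          r * (weight h * output (suc s) x)
            ≈⟨ solve 3 (λ r w o → r :* (w :* o) := w :* (r :* o)) refl r (weight h) (output (suc s) x) ⟩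
          weight h * c
            ≈⟨ *-congʳ (trans (*-congˡ (∑-rule h (≡.sym p))) (*-identityʳ _)) ⟨
          (weight h * ∑ (rule h) (allFin m)) * c
            ≈⟨ *-congʳ (∑-*ˡ (weight h) (rule h) (allFin m)) ⟨
          ∑ (λ k → weight h * rule h k) (allFin m) * c
            ≈⟨ ∑-*ʳ c _ (allFin m) ⟨
          ∑ (λ k → (weight h * rule h k) * c) (allFin m)
            ≤⟨ ∑-mono per-clause (allFin m) ⟩
          ∑ (λ k → ∑ (λ y → potential s (step h k y)) (box D L)) (allFin m)
            ≈⟨ ∑-extensions _ ⟨
          rest
            ≈⟨ trans (+-congʳ (zeroˡ _)) (+-identityˡ _) ⟨
          0# * f x + rest ∎
          where
          open Solver using (solve; _:=_; _:+_; _:*_)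
          c : Carrier
          c = r * output (suc s) x

      -- Each level consumes one unit of the iteration budget; the budget `s` left over is what the
      -- induction varies.
      upTo-lower : ∀ N s → pow r N * ∑ (potential (N ℕ.+ s)) (level 0) ≤
                   ∑ outcome (upTo N) + ∑ (potential s) (level N)
      upTo-lower zero    s = ≤-reflexive (trans (*-identityˡ _) (sym (+-identityˡ _)))
      upTo-lower (suc N) s = begin
        (r * pow r N) * ∑ (potential (suc N ℕ.+ s)) (level 0)
          ≈⟨ *-assoc _ _ _ ⟩
        r * (pow r N * ∑ (potential (suc N ℕ.+ s)) (level 0))
          ≈⟨ reflexive (≡.cong (λ j → r * (pow r N * ∑ (potential j) (level 0))) (≡.sym (ℕ.+-suc N s))) ⟩
        r * (pow r N * ∑ (potential (N ℕ.+ suc s)) (level 0))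
          ≤⟨ *-monoˡ-≤ 0≤r (upTo-lower N (suc s)) ⟩
        r * (∑ outcome (upTo N) + ∑ (potential (suc s)) (level N))
          ≈⟨ distribˡ _ _ _ ⟩
        r * ∑ outcome (upTo N) + r * ∑ (potential (suc s)) (level N)
          ≤⟨ +-mono-≤ (≤-trans (≤-reflexive (*-comm r _)) (x≤1⇒z*x≤z (∑-nonNeg outcome-nonNeg (upTo N)) r≤1))
               (≤-trans (≤-reflexive (sym (∑-*ˡ r _ (level N))))
                 (∑-mono-∈ (level N) (λ {h} h∈ → extensions-lower s h (level-current N h∈)))) ⟩
        ∑ outcome (upTo N) + ∑ (λ h → outcome h + ∑ (λ e → potential s (extend h e)) extensions) (level N)
          ≈⟨ +-congˡ (∑-+ _ _ (level N)) ⟩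
        ∑ outcome (upTo N) + (∑ outcome (level N) + ∑ (λ h → ∑ (λ e → potential s (extend h e)) extensions) (level N))
          ≈⟨ +-assoc _ _ _ ⟨
        (∑ outcome (upTo N) + ∑ outcome (level N)) + ∑ (λ h → ∑ (λ e → potential s (extend h e)) extensions) (level N)
          ≈⟨ +-cong (∑-++ outcome (upTo N) (level N)) (∑-cartesianProductWith _ extend (level N) extensions) ⟨
        ∑ outcome (upTo N ++ level N) + ∑ (potential s) (level (suc N)) ∎

      -- One factor `r` for the initial sample and one for each of `N` rounds. With no budget left
      -- the potential of the last level is zero.
      output-lower : ∀ N → pow r (suc N) * h N ≤ ∑ outcome (upTo N)
      output-lower N = begin
        (r * pow r N) * h N
          ≈⟨ solve 3 (λ r p x → (r :* p) :* x := p :* (r :* x)) refl r (pow r N) (h N) ⟩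
        pow r N * (r * h N)
          ≤⟨ *-monoˡ-≤ (pow-nonNeg 0≤r N) (𝔼≤law (output N) (output-nonNeg N)) ⟩
        pow r N * ∑ (λ x → law x * output N x) (box D L)
          ≈⟨ *-congˡ (∑-map (potential N) start (box D L)) ⟨
        pow r N * ∑ (potential N) (level 0)
          ≈⟨ reflexive (≡.cong (λ j → pow r N * ∑ (potential j) (level 0)) (≡.sym (ℕ.+-identityʳ N))) ⟩
        pow r N * ∑ (potential (N ℕ.+ 0)) (level 0)
          ≤⟨ upTo-lower N 0 ⟩
        ∑ outcome (upTo N) + ∑ (potential 0) (level N)
          ≈⟨ +-congˡ (trans (∑-cong (λ h → zeroʳ (weight h)) (level N)) (∑-zero (level N))) ⟩
        ∑ outcome (upTo N) + 0#
          ≈⟨ +-identityʳ _ ⟩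
        ∑ outcome (upTo N) ∎
        where open Solver using (solve; _:=_; _:+_; _:*_)

      -- The normalised expectation of the complement `g` is bounded by its true sum, hence by 1 - p
      -- up to the factor `r`; since `goal` and `𝔼 g` add up to 1, this bounds `p` by `r * goal`
      -- plus one `θ`. The second `θ` comes from replacing `h` by the finite sum of outcomes.
      outcome-lower : ∀ M {τ θ Z p} → 0# ≤ τ → fromℕ M * τ ≈ 1# →
        0# ≤ θ → 1# ≤ pow r (suc (horizon M)) + θ →
        ∑ (λ x → law x * satisfied x) (box D L) ≤ Z →
        (g : Assignment D → Carrier) → (∀ x → 0# ≤ g x) → (∀ x → satisfied x * f x + g x ≈ 1#) →
        ∑ (λ x → law x * g x) (box D L) + p ≤ 1# →
        p ≤ Z * ∑ outcome (upTo (horizon M)) + ((θ + θ) + doubling m * τ)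
      outcome-lower M {τ} {θ} {Z} {p} 0≤τ κτ≈1 0≤θ 1≤rᴺ+θ mass≤Z g 0≤g f+g≈1 g+p≤1 = +-cancelʳ-≤ (r * 𝔼 g) (begin
        p + r * 𝔼 g                         ≤⟨ +-mono-≤ ≤-refl (𝔼≤law g 0≤g) ⟩
        p + ∑ (λ x → law x * g x) (box D L) ≈⟨ +-comm _ _ ⟩
        ∑ (λ x → law x * g x) (box D L) + p ≤⟨ g+p≤1 ⟩
        1#                                  ≤⟨ 1≤r+θ ⟩
        r + θ                               ≈⟨ +-congʳ (trans (*-congˡ goal+g≈1) (*-identityʳ r)) ⟨
        r * (goal + 𝔼 g) + θ
          ≈⟨ solve 4 (λ r x y t → r :* (x :+ y) :+ t := (r :* x :+ t) :+ r :* y) refl r goal (𝔼 g) θ ⟩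
        (r * goal + θ) + r * 𝔼 g            ≤⟨ +-mono-≤ (+-mono-≤ goal-upper ≤-refl) ≤-refl ⟩
        ((Z * s + (θ + d)) + θ) + r * 𝔼 g
          ≈⟨ +-congʳ (solve 3 (λ a t d → (a :+ (t :+ d)) :+ t := a :+ ((t :+ t) :+ d)) refl (Z * s) θ d) ⟩
        (Z * s + ((θ + θ) + d)) + r * 𝔼 g   ∎)
        where
        open Solver using (solve; _:=_; _:+_; _:*_)
        N : ℕ
        N = horizon M
        s d : Carrier
        s = ∑ outcome (upTo N)
        d = doubling m * τ
        0≤s : 0# ≤ s
        0≤s = ∑-nonNeg outcome-nonNeg (upTo N)
        0≤d : 0# ≤ d
        0≤d = *-nonNeg (doubling-nonNeg m) 0≤τ
        1≤r+θ : 1# ≤ r + θ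
        1≤r+θ = ≤-trans 1≤rᴺ+θ (+-mono-≤ (x≤1⇒z*x≤z 0≤r (pow≤1 0≤r r≤1 N)) ≤-refl)
        goal+g≈1 : goal + 𝔼 g ≈ 1#
        goal+g≈1 = trans (sym (𝔼.F-+ _ g)) (trans (𝔼.F-cong f+g≈1) 𝔼.F-one)
        h≤s+θ : h N ≤ s + θ
        h≤s+θ = begin
          h N                            ≈⟨ *-identityʳ _ ⟨
          h N * 1#                       ≤⟨ *-monoˡ-≤ (h-nonNeg N) 1≤rᴺ+θ ⟩
          h N * (pow r (suc N) + θ)
            ≈⟨ solve 3 (λ h r t → h :* (r :+ t) := r :* h :+ t :* h) refl (h N) (pow r (suc N)) θ ⟩
          pow r (suc N) * h N + θ * h N  ≤⟨ +-mono-≤ (output-lower N) (x≤1⇒z*x≤z 0≤θ (h≤1 N)) ⟩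
          s + θ                          ∎
        0≤satisfied : ∀ x → 0# ≤ satisfied x
        0≤satisfied x = if-nonNeg (formula I x) 0≤1
        satisfied≤1 : ∀ x → satisfied x ≤ 1#
        satisfied≤1 x with formula I x
        ... | true  = ≤-refl
        ... | false = 0≤1
        -- Normalisation can push the satisfied mass above `Z`; the factor `r` carried along from
        -- `goal` compensates for this.
        rmass≤Z : r * Runs.mass ≤ Z
        rmass≤Z = ≤-trans (𝔼≤law satisfied 0≤satisfied) mass≤Z
        rmass≤1 : r * Runs.mass ≤ 1#
        rmass≤1 = ≤-trans (x≤1⇒z*x≤z 0≤r (𝔼.F-≤1 satisfied≤1)) r≤1
        goal-upper : r * goal ≤ Z * s + (θ + d)
        goal-upper = begin
          r * goal                       ≤⟨ *-monoˡ-≤ 0≤r (goal-bound M 0≤τ κτ≈1) ⟩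
          r * (Runs.mass * h N + d)
            ≈⟨ solve 4 (λ r z h d → r :* (z :* h :+ d) := (r :* z) :* h :+ d :* r) refl r Runs.mass (h N) d ⟩
          (r * Runs.mass) * h N + d * r
            ≤⟨ +-mono-≤ (*-monoˡ-≤ (*-nonNeg 0≤r Runs.mass-nonNeg) h≤s+θ) (x≤1⇒z*x≤z 0≤d r≤1) ⟩
          (r * Runs.mass) * (s + θ) + d
            ≈⟨ solve 4 (λ q s t d → q :* (s :+ t) :+ d := s :* q :+ (t :* q :+ d)) refl (r * Runs.mass) s θ d ⟩
          s * (r * Runs.mass) + (θ * (r * Runs.mass) + d)
            ≤⟨ +-mono-≤ (*-monoˡ-≤ 0≤s rmass≤Z) (+-mono-≤ (x≤1⇒z*x≤z 0≤θ rmass≤1) ≤-refl) ⟩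
          s * Z + (θ + d)                ≈⟨ +-congʳ (*-comm s Z) ⟩
          Z * s + (θ + d)                ∎

-- Tolerances and unordered sums

∃-upper-bound : ∀ {A : Set} (f : A → ℕ) xs → ∃ λ N → ∀ {x} → x ∈ xs → f x ℕ.< N
∃-upper-bound f []       = 0 , λ ()
∃-upper-bound f (x ∷ xs) with ∃-upper-bound f xs
... | N , p = suc (f x) ℕ.⊔ N , λ where
  (here ≡.refl) → ℕ.m≤m⊔n (suc (f x)) N
  (there x∈xs)  → ℕ.≤-trans (p x∈xs) (ℕ.m≤n⊔m (suc (f x)) N)

-- An abstract substitute for the positive rationals. The ring has no strict order, so positivity is
-- expressed by its use: `tol-inverse` provides a `ρ` close to 1 above which every element has a
-- nonnegative inverse.
record Tolerance (R : OrderedRing) : Set₁ where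
  open OrderedRing R
  open OrderedRingProperties R using (fromℕ)
  field
    Tol         : Set
    ⟦_⟧         : Tol → Carrier
    tol-nonNeg  : ∀ ε → 0# ≤ ⟦ ε ⟧
    tol-≤       : ∀ {x y} → (∀ ε → x ≤ y + ⟦ ε ⟧) → x ≤ y
    tol-*       : ∀ x ε → ∃ λ δ → x * ⟦ δ ⟧ ≤ ⟦ ε ⟧
    tol-1/n     : ∀ ε → ∃ λ n → ∃ λ τ → 0# ≤ τ × fromℕ n * τ ≈ 1# × τ ≤ ⟦ ε ⟧
    tol-inverse : ∀ ε → ∃ λ δ → ∃ λ ρ → ⟦ δ ⟧ ≤ ⟦ ε ⟧ × 0# ≤ ρ × ρ + ⟦ δ ⟧ ≈ 1# ×
                  (∀ t → ρ ≤ t → ∃ λ τ → 0# ≤ τ × t * τ ≈ 1#)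

module Summation {R : OrderedRing} (T : Tolerance R) where

  open OrderedRing R
  open OrderedRingProperties R
  open Tolerance T
  open Relation.Binary.Reasoning.PartialOrder poset

  halve : ∀ ε → ∃ λ δ → ⟦ δ ⟧ + ⟦ δ ⟧ ≤ ⟦ ε ⟧
  halve ε with tol-* (1# + 1#) ε
  ... | δ , p = δ , ≤-trans (≤-reflexive (solve 1 (λ d → d :+ d := (con 1 :+ con 1) :* d) refl ⟦ δ ⟧)) p
    where open Solver using (solve; _:=_; _:+_; _:*_; con)

  Sums : {A : Set} → (A → Carrier) → Carrier → Set
  Sums {A} f s = ∀ ε → ∃ λ (xs : List A) → ∀ ys → Unique ys → xs ⊆ ys →
    ∑ f ys ≤ s + ⟦ ε ⟧ × s ≤ ∑ f ys + ⟦ ε ⟧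

  module _ {A : Set} where

    Sums-cong : ∀ {f g : A → Carrier} {s t} → (∀ a → f a ≈ g a) → s ≈ t → Sums f s → Sums g t
    Sums-cong f≈g s≈t sums ε with sums ε
    ... | xs , p = xs , λ ys !ys xs⊆ys →
      ≤-trans (≤-reflexive (sym (∑-cong f≈g ys))) (≤-trans (proj₁ (p ys !ys xs⊆ys)) (≤-reflexive (+-congʳ s≈t))) ,
      ≤-trans (≤-reflexive (sym s≈t)) (≤-trans (proj₂ (p ys !ys xs⊆ys)) (≤-reflexive (+-congʳ (∑-cong f≈g ys))))

    module _ (_≟_ : DecidableEquality A) where

      union : List A → List A → List A
      union xs ys = deduplicate _≟_ (xs ++ ys)

      union-unique : ∀ xs ys → Unique (union xs ys)
      union-unique xs ys = deduplicate-! _≟_ (xs ++ ys)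

      ⊆-unionˡ : ∀ xs ys → xs ⊆ union xs ys
      ⊆-unionˡ xs ys p = ∈-deduplicate⁺ _≟_ (∈-++⁺ˡ p)

      ⊆-unionʳ : ∀ xs ys → ys ⊆ union xs ys
      ⊆-unionʳ xs ys p = ∈-deduplicate⁺ _≟_ (∈-++⁺ʳ xs p)

      -- Merging `xs` with an approximating list only increases the sum. The merged list has to be
      -- duplicate-free, which is why equality is decided.
      Sums-upper : ∀ {f : A → Carrier} {s} → (∀ a → 0# ≤ f a) → Sums f s → ∀ {xs} → Unique xs → ∑ f xs ≤ s
      Sums-upper {f} {s} 0≤f sums {xs} !xs = tol-≤ bound
        where
        bound : ∀ ε → ∑ f xs ≤ s + ⟦ ε ⟧
        bound ε with sums ε
        ... | zs , p = ≤-trans (∑-⊆ 0≤f !xs (⊆-unionˡ xs zs))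
          (proj₁ (p (union xs zs) (union-unique xs zs) (⊆-unionʳ xs zs)))

      Sums-lower : ∀ {f : A → Carrier} {s} → Sums f s → ∀ ε → ∃ λ xs → Unique xs × s ≤ ∑ f xs + ⟦ ε ⟧
      Sums-lower sums ε with sums ε
      -- The union with the empty list serves only to remove repetitions.
      ... | xs , p = union xs [] , union-unique xs [] ,
        proj₂ (p (union xs []) (union-unique xs []) (⊆-unionˡ xs []))

-- Convergence to the conditional law

module _ {n m} {I : Instance n m} {R : OrderedRing} (T : Tolerance R) (P : Process I R) where

  open OrderedRing R
  open Process P
  open Summation T

  module Convergence (extremal : Extremal I)
    (mass-total : ∀ i → Sums (mass i) 1#)
    {Z Z⁻¹ : Carrier} (Z-sum : Sums (λ x → if formula I x then law x else 0#) Z)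
    (0≤Z⁻¹ : 0# ≤ Z⁻¹) (ZZ⁻¹≈1 : Z * Z⁻¹ ≈ 1#) where

    open Instance I
    open OrderedRingProperties R
    open Tolerance T
    open Expectations R
    open ProcessProperties P
    open Relation.Binary.Reasoning.PartialOrder poset hiding (start)

    mass≤1 : ∀ i {as} → Unique as → ∑ (mass i) as ≤ 1#
    mass≤1 i = Sums-upper (_≟ᵥ_ I) (mass-nonNeg i) (mass-total i)

    values : List (Assignment D) → ∀ i → List (D i)
    values xs i = deduplicate (_≟ᵥ_ I) (List.map (λ x → lookup D x i) xs)

    values-unique : ∀ xs i → Unique (values xs i)
    values-unique xs i = deduplicate-! (_≟ᵥ_ I) (List.map (λ x → lookup D x i) xs)

    ⊆-box-values : ∀ xs → xs ⊆ box D (values xs)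
    ⊆-box-values xs {x} x∈xs = ∈-box⁺ D (values xs) x
      (λ i → ∈-deduplicate⁺ (_≟ᵥ_ I) (∈-map⁺ (λ x → lookup D x i) x∈xs))

    ∑-law≤1 : ∀ {xs} → Unique xs → ∑ law xs ≤ 1#
    ∑-law≤1 {xs} !xs = ≤-trans (∑-⊆ law-nonNeg !xs (⊆-box-values xs))
      (law≤1 (values xs) (values-unique xs) (λ i → mass≤1 i (values-unique xs i)))

    -- Finitely many histories visit finitely many values and have bounded depth, so a single `upTo`
    -- over a single box contains them all.
    ∑-final≤1 : ∀ {hs} → Unique hs → ∑ final hs ≤ 1#
    ∑-final≤1 {hs} !hs = ≤-trans (∑-⊆ final-nonNeg !hs hs⊆)
      (final≤1 L (values-unique xs) (λ i → mass≤1 i (values-unique xs i)) N)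
      where
      open Histories I
      open Levels
      xs : List (Assignment D)
      xs = concatMap states hs
      L : ∀ i → List (D i)
      L = values xs
      bound : ∃ λ N → ∀ {h} → h ∈ hs → depth h ℕ.< N
      bound = ∃-upper-bound (depth) hs
      N : ℕ
      N = proj₁ bound
      hs⊆ : hs ⊆ upTo L N
      hs⊆ {h} h∈hs = ∈-upTo L (∈-level L h (λ x∈ → ⊆-box-values xs (∈-concatMap⁺ states (lose h∈hs x∈))))
        (proj₂ bound h∈hs)

    indicator success failure : (Assignment D → Bool) → Assignment D → Carrier
    indicator E x = if E x then 1# else 0#
    success   E x = if formula I x ∧ E x then 1# else 0#
    failure   E x = if formula I x ∧ E x then 0# else 1#

    outcome : (Assignment D → Bool) → History I → Carrier
    outcome E h = final h * indicator E (current I h)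

    -- p is at most the probability that both the formula and E hold.
    Below : (Assignment D → Bool) → Carrier → Set
    Below E p = ∀ {xs} → Unique xs → ∑ (λ x → law x * failure E x) xs + p ≤ 1#

    failure-nonNeg : ∀ E x → 0# ≤ law x * failure E x
    failure-nonNeg E x = *-nonNeg (law-nonNeg x) (lem (formula I x ∧ E x))
      where
      lem : ∀ b → 0# ≤ (if b then 0# else 1#)
      lem true  = ≤-refl
      lem false = 0≤1

    success-nonNeg : ∀ E x → 0# ≤ law x * success E x
    success-nonNeg E x = *-nonNeg (law-nonNeg x) (if-nonNeg (formula I x ∧ E x) 0≤1)

    indicator-nonNeg : ∀ E x → 0# ≤ indicator E x
    indicator-nonNeg E x = if-nonNeg (E x) 0≤1

    indicator≤1 : ∀ E x → indicator E x ≤ 1#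
    indicator≤1 E x with E x
    ... | true  = ≤-refl
    ... | false = 0≤1

    -- On one merged list the failing and the succeeding masses add up to at most 1, so a lower
    -- approximation of the latter caps the former.
    below-intro : ∀ {E p} → (∀ ε → ∃ λ ys → Unique ys × p ≤ ∑ (λ x → law x * success E x) ys + ⟦ ε ⟧) → Below E p
    below-intro {E} {p} approx {xs} !xs = tol-≤ bound
      where
      F S : Assignment D → Carrier
      F x = law x * failure E x
      S x = law x * success E x
      F+S : ∀ x → F x + S x ≈ law x
      F+S x = trans (sym (distribˡ _ _ _)) (trans (*-congˡ (lem (formula I x ∧ E x))) (*-identityʳ _))
        where
        lem : ∀ b → (if b then 0# else 1#) + (if b then 1# else 0#) ≈ 1#
        lem true  = +-identityˡ 1#
        lem false = +-identityʳ 1#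
      bound : ∀ ε → ∑ F xs + p ≤ 1# + ⟦ ε ⟧
      bound ε with approx ε
      ... | ys , !ys , p≤ = begin
        ∑ F xs + p                   ≤⟨ +-mono-≤ (∑-⊆ (failure-nonNeg E) !xs (⊆-unionˡ _≟_ xs ys)) p≤ ⟩
        ∑ F zs + (∑ S ys + ⟦ ε ⟧)
          ≤⟨ +-mono-≤ ≤-refl (+-mono-≤ (∑-⊆ (success-nonNeg E) !ys (⊆-unionʳ _≟_ xs ys)) ≤-refl) ⟩
        ∑ F zs + (∑ S zs + ⟦ ε ⟧)    ≈⟨ +-assoc _ _ _ ⟨
        (∑ F zs + ∑ S zs) + ⟦ ε ⟧    ≈⟨ +-congʳ (trans (sym (∑-+ F S zs)) (∑-cong F+S zs)) ⟩
        ∑ law zs + ⟦ ε ⟧             ≤⟨ +-mono-≤ (∑-law≤1 (union-unique _≟_ xs ys)) ≤-refl ⟩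
        1# + ⟦ ε ⟧                   ∎
        where
        _≟_ : DecidableEquality (Assignment D)
        _≟_ = assignment-≟ I
        zs : List (Assignment D)
        zs = union _≟_ xs ys

    -- M and hence the number of iterations must be fixed before ρ, since the loss per
    -- iteration from using a finite approximation of the law is a power of ρ.
    record Parameters (ε : Tol) : Set where
      field
        M     : ℕ
        η     : Tol
        ρ τ θ : Carrier
        0≤τ   : 0# ≤ τ
        Mτ≈1  : fromℕ M * τ ≈ 1#
        0≤ρ   : 0# ≤ ρ
        ρ+η≈1 : ρ + ⟦ η ⟧ ≈ 1#
        invert : ∀ t → ρ ≤ t → ∃ λ t⁻¹ → 0# ≤ t⁻¹ × t * t⁻¹ ≈ 1#
        0≤θ   : 0# ≤ θ
        Kη≤θ  : (fromℕ (suc (M ℕ.* suc m)) * fromℕ n) * ⟦ η ⟧ ≤ θ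
        loss≤ε : (θ + θ) + doubling m * τ ≤ ⟦ ε ⟧

    -- Half of `ε` covers the two `θ`, the other half the averaging error 2^m / M. The coefficient
    -- of `η` is the combined Bernoulli exponent: `n` variables in each of `suc (M * suc m)` rounds,
    -- the initial sample included.
    parameters : ∀ ε → Parameters ε
    parameters ε with halve ε
    ... | δ , 2δ≤ε with halve δ | tol-* (doubling m) δ
    ...   | γ , 2γ≤δ | σ , dσ≤δ with tol-1/n σ
    ...     | M , τ , 0≤τ , Mτ≈1 , τ≤σ with tol-* (fromℕ (suc (M ℕ.* suc m)) * fromℕ n) γ
    ...       | η₀ , Kη₀≤γ with tol-inverse η₀
    ...         | η , ρ , η≤η₀ , 0≤ρ , ρ+η≈1 , invert = record
      { M = M ; η = η ; ρ = ρ ; τ = τ ; θ = ⟦ γ ⟧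
      ; 0≤τ = 0≤τ ; Mτ≈1 = Mτ≈1 ; 0≤ρ = 0≤ρ ; ρ+η≈1 = ρ+η≈1 ; invert = invert ; 0≤θ = tol-nonNeg γ
      ; Kη≤θ = ≤-trans (*-monoˡ-≤ (*-nonNeg (fromℕ-nonNeg (suc (M ℕ.* suc m))) (fromℕ-nonNeg n)) η≤η₀) Kη₀≤γ
      ; loss≤ε = ≤-trans (+-mono-≤ 2γ≤δ (≤-trans (*-monoˡ-≤ (doubling-nonNeg m) τ≤σ) dσ≤δ)) 2δ≤ε
      }

    module _ {E : Assignment D → Bool} {p : Carrier} (below : Below E p) where

      approximation : ∀ ε → ∃ λ hs → Unique hs × p ≤ Z * ∑ (outcome E) hs + ⟦ ε ⟧
      approximation ε = upTo N , upTo-unique L-unique N , ≤-trans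
        (outcome-lower M 0≤τ Mτ≈1 0≤θ 1≤rᴺ+θ mass≤Z (failure E) failure-nonNeg′ failure-complement
          (below (box-unique D L L-unique)))
        (+-mono-≤ ≤-refl loss≤ε)
        where
        open Parameters (parameters ε)
        N : ℕ
        N = M ℕ.* suc m
        ρ≤1 : ρ ≤ 1#
        ρ≤1 = ≤-trans (x≤x+y (tol-nonNeg η)) (≤-reflexive ρ+η≈1)
        -- Each list carries all but `η` of the mass, hence at least `ρ`. Its total is therefore
        -- invertible, and `t i` normalises the restricted law.
        support : ∀ i → ∃ λ as → Unique as × 1# ≤ ∑ (mass i) as + ⟦ η ⟧
        support i = Sums-lower (_≟ᵥ_ I) (mass-total i) η
        L : ∀ i → List (D i)
        L i = proj₁ (support i)
        L-unique : ∀ i → Unique (L i)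
        L-unique i = proj₁ (proj₂ (support i))
        ρ≤total : ∀ i → ρ ≤ ∑ (mass i) (L i)
        ρ≤total i = +-cancelʳ-≤ ⟦ η ⟧ (≤-trans (≤-reflexive ρ+η≈1) (proj₂ (proj₂ (support i))))
        scale : ∀ i → ∃ λ t → 0# ≤ t × ∑ (mass i) (L i) * t ≈ 1#
        scale i = invert (∑ (mass i) (L i)) (ρ≤total i)
        t : ∀ i → Carrier
        t i = proj₁ (scale i)
        avg : ∀ i → Functional (D i)
        avg i = weighted (λ a → mass i a * t i) (L i)
        avg-isExpectation : ∀ i → IsExpectation (avg i)
        avg-isExpectation i = weighted-isExpectation {xs = L i} (λ a → *-nonNeg (mass-nonNeg i a) (proj₁ (proj₂ (scale i))))
          (trans (∑-*ʳ (t i) (mass i) (L i)) (proj₂ (proj₂ (scale i))))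
        avg≤mass : ∀ i g → (∀ a → 0# ≤ g a) → ρ * avg i g ≤ ∑ (λ a → mass i a * g a) (L i)
        avg≤mass i g 0≤g = begin
          ρ * ∑ (λ a → (mass i a * t i) * g a) (L i)
            ≈⟨ *-congˡ (trans (∑-cong (λ a → solve 3 (λ u v w → (u :* v) :* w := v :* (u :* w)) refl (mass i a) (t i) (g a)) (L i)) (∑-*ˡ (t i) _ (L i))) ⟩
          ρ * (t i * s)    ≈⟨ solve 3 (λ r t s → r :* (t :* s) := s :* (t :* r)) refl ρ (t i) s ⟩
          s * (t i * ρ)    ≤⟨ x≤1⇒z*x≤z (∑-nonNeg (λ a → *-nonNeg (mass-nonNeg i a) (0≤g a)) (L i)) tρ≤1 ⟩
          s                ∎
          where
          open Solver using (solve; _:=_; _:+_; _:*_)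
          s : Carrier
          s = ∑ (λ a → mass i a * g a) (L i)
          tρ≤1 : t i * ρ ≤ 1#
          tρ≤1 = ≤-trans (*-monoˡ-≤ (proj₁ (proj₂ (scale i))) (ρ≤total i))
            (≤-reflexive (trans (*-comm _ _) (proj₂ (proj₂ (scale i)))))
        open Histories I
        open Levels L
        open LowerBound L L-unique (λ i → mass≤1 i (L-unique i)) extremal avg-isExpectation 0≤ρ ρ≤1 avg≤mass
          (indicator E) (indicator-nonNeg E) (indicator≤1 E) using (r; 0≤r; r≤1; outcome-lower)
        1≤rᴺ+θ : 1# ≤ pow r (suc N) + θ
        1≤rᴺ+θ = begin
          1#
            ≤⟨ bernoulli 0≤r r≤1 (*-nonNeg (fromℕ-nonNeg n) (tol-nonNeg η))
                 (bernoulli 0≤ρ ρ≤1 (tol-nonNeg η) (≤-reflexive (sym ρ+η≈1)) n) (suc N) ⟩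
          pow r (suc N) + fromℕ (suc N) * (fromℕ n * ⟦ η ⟧)
            ≈⟨ +-congˡ (*-assoc _ _ _) ⟨
          pow r (suc N) + (fromℕ (suc N) * fromℕ n) * ⟦ η ⟧
            ≤⟨ +-mono-≤ ≤-refl Kη≤θ ⟩
          pow r (suc N) + θ ∎
        mass≤Z : ∑ (λ x → law x * (if formula I x then 1# else 0#)) (box D L) ≤ Z
        mass≤Z = ≤-trans
          (≤-reflexive (∑-cong (λ x → trans (*-comm _ _) (if-zero-one (formula I x) (law x))) (box D L)))
          (Sums-upper (assignment-≟ I) (λ x → if-nonNeg (formula I x) (law-nonNeg x)) Z-sum (box-unique D L L-unique))
        failure-nonNeg′ : ∀ x → 0# ≤ failure E x
        failure-nonNeg′ x with formula I x ∧ E x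
        ... | true  = ≤-refl
        ... | false = 0≤1
        failure-complement : ∀ x → (if formula I x then 1# else 0#) * indicator E x + failure E x ≈ 1#
        failure-complement x with formula I x | E x
        ... | true  | true  = trans (+-identityʳ _) (*-identityˡ 1#)
        ... | true  | false = trans (+-congʳ (*-identityˡ 0#)) (+-identityˡ 1#)
        ... | false | _     = trans (+-congʳ (zeroˡ _)) (+-identityˡ 1#)

      lower : ∀ ε → ∃ λ hs → Unique hs × p * Z⁻¹ ≤ ∑ (outcome E) hs + ⟦ ε ⟧
      lower ε = hs , proj₁ (proj₂ approximated) , (begin
        p * Z⁻¹                        ≈⟨ *-comm p Z⁻¹ ⟩
        Z⁻¹ * p                        ≤⟨ *-monoˡ-≤ 0≤Z⁻¹ (proj₂ (proj₂ approximated)) ⟩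
        Z⁻¹ * (Z * s + ⟦ δ ⟧)
          ≈⟨ solve 4 (λ w z s d → w :* (z :* s :+ d) := (z :* w) :* s :+ w :* d) refl Z⁻¹ Z s ⟦ δ ⟧ ⟩
        (Z * Z⁻¹) * s + Z⁻¹ * ⟦ δ ⟧
          ≤⟨ +-mono-≤ (≤-reflexive (trans (*-congʳ ZZ⁻¹≈1) (*-identityˡ s))) (proj₂ (tol-* Z⁻¹ ε)) ⟩
        s + ⟦ ε ⟧                      ∎)
        where
        open Solver using (solve; _:=_; _:+_; _:*_)
        δ : Tol
        δ = proj₁ (tol-* Z⁻¹ ε)
        approximated : ∃ λ hs → Unique hs × p ≤ Z * ∑ (outcome E) hs + ⟦ δ ⟧
        approximated = approximation δ
        hs : List (History I)
        hs = proj₁ approximated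
        s : Carrier
        s = ∑ (outcome E) hs

    outcome-nonNeg : ∀ E h → 0# ≤ outcome E h
    outcome-nonNeg E h = *-nonNeg (final-nonNeg h) (indicator-nonNeg E (current I h))

    law-success : ∀ E x → law x * success E x ≈ (if formula I x ∧ E x then law x else 0#)
    law-success E x = trans (*-comm _ _) (if-zero-one (formula I x ∧ E x) (law x))

    Z-lower : ∀ ε → ∃ λ xs → Unique xs × Z ≤ ∑ (λ x → if formula I x then law x else 0#) xs + ⟦ ε ⟧
    Z-lower = Sums-lower (assignment-≟ I) Z-sum

    always : Assignment D → Bool
    always _ = true

    below-always : Below always Z
    below-always = below-intro λ ε → let xs , !xs , Z≤ = Z-lower ε in
      xs , !xs , ≤-trans Z≤ (+-mono-≤ (≤-reflexive (∑-cong (λ x → trans (lem x (formula I x)) (sym (law-success always x))) xs)) ≤-refl)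
      where
      lem : ∀ x b → (if b then law x else 0#) ≈ (if b ∧ true then law x else 0#)
      lem x true  = refl
      lem x false = refl

    -- For the event that always holds, `p` is `Z` and the lower bound Z * Z⁻¹ is already 1.
    terminates : Sums final 1#
    terminates ε = hs , λ ys !ys hs⊆ys →
      ≤-trans (∑-final≤1 !ys) (x≤x+y (tol-nonNeg ε)) ,
      (begin
        1#                        ≈⟨ ZZ⁻¹≈1 ⟨
        Z * Z⁻¹                   ≤⟨ proj₂ (proj₂ lower-bound) ⟩
        ∑ (outcome always) hs + ⟦ ε ⟧ ≈⟨ +-congʳ (∑-cong (λ h → *-identityʳ (final h)) hs) ⟩
        ∑ final hs + ⟦ ε ⟧        ≤⟨ +-mono-≤ (∑-⊆ final-nonNeg (proj₁ (proj₂ lower-bound)) hs⊆ys) ≤-refl ⟩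
        ∑ final ys + ⟦ ε ⟧        ∎)
      where
      lower-bound : ∃ λ hs → Unique hs × Z * Z⁻¹ ≤ ∑ (outcome always) hs + ⟦ ε ⟧
      lower-bound = lower below-always ε
      hs : List (History I)
      hs = proj₁ lower-bound

    module _ (y : Assignment D) where

      at-y off-y : Assignment D → Bool
      at-y  x = ⌊ assignment-≟ I x y ⌋
      off-y x = not (at-y x)

      p : Carrier
      p = if formula I y then law y else 0#

      below-at-y : Below at-y p
      below-at-y = below-intro λ ε → y ∷ [] , [] ∷ [] , (begin
        p                                              ≈⟨ own ⟩
        law y * success at-y y                         ≈⟨ +-identityʳ _ ⟨
        ∑ (λ x → law x * success at-y x) (y ∷ [])      ≤⟨ x≤x+y (tol-nonNeg ε) ⟩
        ∑ (λ x → law x * success at-y x) (y ∷ []) + ⟦ ε ⟧ ∎)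
        where
        own : p ≈ law y * success at-y y
        own = trans lem (sym (law-success at-y y))
          where
          lem : p ≈ (if formula I y ∧ at-y y then law y else 0#)
          lem with formula I y | assignment-≟ I y y
          ... | false | _       = refl
          ... | true  | yes _   = refl
          ... | true  | no  y≢y = contradiction ≡.refl y≢y

      -- A duplicate-free list approximating `Z` contains `y` at most once, so discarding `y` costs
      -- at most `p`.
      below-off-y : Below off-y (Z - p)
      below-off-y = below-intro λ ε → let xs , !xs , Z≤ = Z-lower ε in xs , !xs , +-cancelʳ-≤ p (begin
        (Z - p) + p                                        ≈⟨ x-y+y≈x Z p ⟩
        Z                                                  ≤⟨ Z≤ ⟩
        ∑ (λ x → if formula I x then law x else 0#) xs + ⟦ ε ⟧  ≈⟨ +-congʳ (trans (∑-cong split xs) (∑-+ on off xs)) ⟩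
        (∑ on xs + ∑ off xs) + ⟦ ε ⟧
          ≤⟨ +-mono-≤ (+-mono-≤ (∑-point (assignment-≟ I) (on-nonNeg y) on-zero !xs) ≤-refl) ≤-refl ⟩
        (on y + ∑ off xs) + ⟦ ε ⟧                          ≤⟨ +-mono-≤ (+-mono-≤ on-y≤p ≤-refl) ≤-refl ⟩
        (p + ∑ off xs) + ⟦ ε ⟧
          ≈⟨ solve 3 (λ p s e → (p :+ s) :+ e := (s :+ e) :+ p) refl p (∑ off xs) ⟦ ε ⟧ ⟩
        (∑ off xs + ⟦ ε ⟧) + p
          ≈⟨ +-congʳ (+-congʳ (∑-cong (λ x → sym (law-success off-y x)) xs)) ⟩
        (∑ (λ x → law x * success off-y x) xs + ⟦ ε ⟧) + p ∎)
        where
        open Solver using (solve; _:=_; _:+_; _:*_)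
        on off : Assignment D → Carrier
        on  x = if formula I x ∧ at-y x then law x else 0#
        off x = if formula I x ∧ off-y x then law x else 0#
        on-nonNeg : ∀ x → 0# ≤ on x
        on-nonNeg x = if-nonNeg (formula I x ∧ at-y x) (law-nonNeg x)
        split : ∀ x → (if formula I x then law x else 0#) ≈ on x + off x
        split x with formula I x | at-y x
        ... | false | _     = sym (+-identityˡ 0#)
        ... | true  | true  = sym (+-identityʳ _)
        ... | true  | false = sym (+-identityˡ _)
        on-zero : ∀ x → x ≢ y → on x ≈ 0#
        on-zero x x≢y with formula I x | assignment-≟ I x y
        ... | false | _       = refl
        ... | true  | yes x≡y = contradiction x≡y x≢y
        ... | true  | no  _   = refl
        on-y≤p : on y ≤ p
        on-y≤p with formula I y | at-y y
        ... | false | _     = ≤-refl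
        ... | true  | true  = ≤-refl
        ... | true  | false = law-nonNeg y

      outcome-split : ∀ hs → ∑ (outcome at-y) hs + ∑ (outcome off-y) hs ≈ ∑ final hs
      outcome-split hs = trans (sym (∑-+ _ _ hs)) (∑-cong (λ h → trans (sym (distribˡ _ _ _))
        (trans (*-congˡ (lem (at-y (current I h)))) (*-identityʳ _))) hs)
        where
        lem : ∀ b → (if b then 1# else 0#) + (if not b then 1# else 0#) ≈ 1#
        lem true  = +-identityʳ 1#
        lem false = +-identityˡ 1#

      output-law′ : Sums (outcome at-y) (p * Z⁻¹)
      -- `as` secures the lower bound at `y`; `bs` secures it off `y`, which, with total mass at
      -- most 1, is the upper bound at `y`.
      output-law′ ε = as ++ bs , λ ys !ys ⊆ys →
        +-cancelʳ-≤ (∑ (outcome off-y) ys) (begin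
          ∑ (outcome at-y) ys + ∑ (outcome off-y) ys    ≈⟨ outcome-split ys ⟩
          ∑ final ys                                    ≤⟨ ∑-final≤1 !ys ⟩
          1#                                            ≈⟨ total ⟩
          p * Z⁻¹ + (Z - p) * Z⁻¹                       ≤⟨ +-mono-≤ ≤-refl (proj₂ (proj₂ off-lower)) ⟩
          p * Z⁻¹ + (∑ (outcome off-y) bs + ⟦ ε ⟧)
            ≤⟨ +-mono-≤ ≤-refl (+-mono-≤ (∑-⊆ (outcome-nonNeg off-y) (proj₁ (proj₂ off-lower)) (⊆ys ∘ ∈-++⁺ʳ as)) ≤-refl) ⟩
          p * Z⁻¹ + (∑ (outcome off-y) ys + ⟦ ε ⟧)
            ≈⟨ solve 3 (λ p s e → p :+ (s :+ e) := (p :+ e) :+ s) refl (p * Z⁻¹) (∑ (outcome off-y) ys) ⟦ ε ⟧ ⟩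
          (p * Z⁻¹ + ⟦ ε ⟧) + ∑ (outcome off-y) ys      ∎) ,
        ≤-trans (proj₂ (proj₂ at-lower))
          (+-mono-≤ (∑-⊆ (outcome-nonNeg at-y) (proj₁ (proj₂ at-lower)) (⊆ys ∘ ∈-++⁺ˡ)) ≤-refl)
        where
        at-lower : ∃ λ hs → Unique hs × p * Z⁻¹ ≤ ∑ (outcome at-y) hs + ⟦ ε ⟧
        at-lower = lower below-at-y ε
        off-lower : ∃ λ hs → Unique hs × (Z - p) * Z⁻¹ ≤ ∑ (outcome off-y) hs + ⟦ ε ⟧
        off-lower = lower below-off-y ε
        as bs : List (History I)
        as = proj₁ at-lower
        bs = proj₁ off-lower
        open Solver using (solve; _:=_; _:+_; _:*_)
        total : 1# ≈ p * Z⁻¹ + (Z - p) * Z⁻¹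
        total = begin-equality
          1#                          ≈⟨ ZZ⁻¹≈1 ⟨
          Z * Z⁻¹                     ≈⟨ *-congʳ (x-y+y≈x Z p) ⟨
          ((Z - p) + p) * Z⁻¹         ≈⟨ solve 3 (λ q p w → (q :+ p) :* w := p :* w :+ q :* w) refl (Z - p) p Z⁻¹ ⟩
          p * Z⁻¹ + (Z - p) * Z⁻¹     ∎

      output-law : Sums (λ h → if at-y (current I h) then final h else 0#) (p * Z⁻¹)
      output-law = Sums-cong (λ h → trans (*-comm _ _) (if-zero-one (at-y (current I h)) (final h))) refl output-law′

-- The Cauchy reals as an ordered ring

open Defs using
  ( ℝ; seq; cauchy; fromℚ; 0ℝ; 1ℝ; _≤_; _<_; _≃_; _+_; _*_; inverse; max-pos; inv; pmf; nonNeg; total; Prob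
  ; productLaw; Rule; resample; weight; finalLaw; TerminatesAlmostSurely; OutputLaw; conditioned )

ℚ-orderedRing : OrderedRing
ℚ-orderedRing = record
  { commutativeRing = record { isCommutativeRing = ℚ.+-*-isCommutativeRing }
  ; _≤_             = ℚ._≤_
  ; isPartialOrder  = ℚ.≤-isPartialOrder
  ; +-mono-≤        = ℚ.+-mono-≤
  ; *-nonNeg        = λ {p} {q} 0≤p 0≤q → ℚ.≤-trans (ℚ.≤-reflexive (≡.sym (ℚ.*-zeroʳ p)))
                        (ℚ.*-monoˡ-≤-nonNeg p {{ℚ.nonNegative 0≤p}} 0≤q)
  ; 0≤1             = ℚ.<⇒≤ (ℚ.positive⁻¹ 1ℚ)
  }

module ℚ-Lemmas where

  open OrderedRingProperties ℚ-orderedRing public using (+-cancelʳ-≤; x-y+y≈x)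
  open Estimates ℚ-orderedRing public

  *-pos : ∀ p q → 0ℚ ℚ.< p → 0ℚ ℚ.< q → 0ℚ ℚ.< p ℚ.* q
  *-pos p q 0<p 0<q = ℚ.positive⁻¹ (p ℚ.* q) {{ℚ.pos*pos⇒pos p {{ℚ.positive 0<p}} q {{ℚ.positive 0<q}}}}

  inverse-pos : ∀ p (0<p : 0ℚ ℚ.< p) → 0ℚ ℚ.< inverse p 0<p
  inverse-pos p 0<p = ℚ.positive⁻¹ (inverse p 0<p) {{ℚ.1/pos⇒pos p {{ℚ.positive 0<p}}}}

  inverseʳ : ∀ p (0<p : 0ℚ ℚ.< p) → p ℚ.* inverse p 0<p ≡ 1ℚ
  inverseʳ p 0<p = ℚ.*-inverseʳ p {{ℚ.pos⇒nonZero p {{ℚ.positive 0<p}}}}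

  quotient : ∀ ε c → 0ℚ ℚ.< ε → 0ℚ ℚ.< c → ∃ λ δ → 0ℚ ℚ.< δ × c ℚ.* δ ≡ ε
  quotient ε c 0<ε 0<c = inverse c 0<c ℚ.* ε , *-pos (inverse c 0<c) ε (inverse-pos c 0<c) 0<ε ,
    ≡.trans (≡.sym (ℚ.*-assoc c (inverse c 0<c) ε)) (≡.trans (≡.cong (ℚ._* ε) (inverseʳ c 0<c)) (ℚ.*-identityˡ ε))

  half : ∀ ε → 0ℚ ℚ.< ε → ∃ λ δ → 0ℚ ℚ.< δ × δ ℚ.+ δ ≡ ε
  half ε 0<ε with quotient ε (1ℚ ℚ.+ 1ℚ) 0<ε (ℚ.positive⁻¹ (1ℚ ℚ.+ 1ℚ))
  ... | δ , 0<δ , p = δ , 0<δ , ≡.trans (≡.cong₂ ℚ._+_ (≡.sym (ℚ.*-identityˡ δ)) (≡.sym (ℚ.*-identityˡ δ)))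
                                 (≡.trans (≡.sym (ℚ.*-distribʳ-+ δ 1ℚ 1ℚ)) p)

  p≤∣p∣ : ∀ p → p ℚ.≤ ∣ p ∣
  p≤∣p∣ p with ℚ.≤-total 0ℚ p
  ... | inj₁ 0≤p = ℚ.≤-reflexive (≡.sym (ℚ.0≤p⇒∣p∣≡p 0≤p))
  ... | inj₂ p≤0 = ℚ.≤-trans p≤0 (ℚ.0≤∣p∣ p)

  0≤p+∣p∣ : ∀ p → 0ℚ ℚ.≤ p ℚ.+ ∣ p ∣
  0≤p+∣p∣ p = ℚ.≤-trans (ℚ.≤-reflexive (≡.sym (ℚ.+-inverseʳ p)))
    (ℚ.+-monoʳ-≤ p (ℚ.≤-trans (p≤∣p∣ (ℚ.- p)) (ℚ.≤-reflexive (ℚ.∣-p∣≡∣p∣ p))))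

  ∣p-q∣≤r⇒p≤q+r : ∀ p q r → ∣ p ℚ.- q ∣ ℚ.≤ r → p ℚ.≤ q ℚ.+ r
  ∣p-q∣≤r⇒p≤q+r p q r h = ℚ.≤-trans (ℚ.≤-reflexive (≡.trans (≡.sym (x-y+y≈x p q)) (ℚ.+-comm (p ℚ.- q) q)))
    (ℚ.+-monoʳ-≤ q (ℚ.≤-trans (p≤∣p∣ (p ℚ.- q)) h))

Eventually : (ℕ → Set) → Set
Eventually P = ∃ λ N → ∀ i → N ℕ.≤ i → P i

eventually₂ : ∀ {P Q S : ℕ → Set} → (∀ i → P i → Q i → S i) → Eventually P → Eventually Q → Eventually S
eventually₂ f (M , p) (N , q) = M ℕ.⊔ N , λ i r →
  f i (p i (ℕ.m⊔n≤o⇒m≤o M N r)) (q i (ℕ.m⊔n≤o⇒n≤o M N r))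

eventually : ∀ {P Q : ℕ → Set} → (∀ i → P i → Q i) → Eventually P → Eventually Q
eventually f (N , p) = N , λ i r → f i (p i r)

module ℝ-Lemmas where

  open ℚ-Lemmas

  pointwise-≤ : ∀ {x y} → (∀ i → seq x i ℚ.≤ seq y i) → x ≤ y
  pointwise-≤ {x} {y} p ε 0<ε = 0 , λ i _ → ℚ.≤-trans (p i)
    (ℚ.≤-trans (ℚ.≤-reflexive (≡.sym (ℚ.+-identityʳ (seq y i)))) (ℚ.+-monoʳ-≤ (seq y i) (ℚ.<⇒≤ 0<ε)))

  pointwise-≃ : ∀ {x y} → (∀ i → seq x i ≡ seq y i) → x ≃ y
  pointwise-≃ {x} {y} p = pointwise-≤ {x} {y} (λ i → ℚ.≤-reflexive (p i)) ,
                          pointwise-≤ {y} {x} (λ i → ℚ.≤-reflexive (≡.sym (p i)))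

  ≤-refl : ∀ {x} → x ≤ x
  ≤-refl {x} = pointwise-≤ {x} {x} (λ _ → ℚ.≤-refl)

  ≤-trans : ∀ {x y z} → x ≤ y → y ≤ z → x ≤ z
  ≤-trans {x} {y} {z} p q ε 0<ε with half ε 0<ε
  ... | δ , 0<δ , δ+δ≡ε = eventually₂ combine (p δ 0<δ) (q δ 0<δ)
    where
    combine : ∀ i → seq x i ℚ.≤ seq y i ℚ.+ δ → seq y i ℚ.≤ seq z i ℚ.+ δ → seq x i ℚ.≤ seq z i ℚ.+ ε
    combine i a b = ℚ.≤-trans a (ℚ.≤-trans (ℚ.+-monoˡ-≤ δ b)
      (ℚ.≤-reflexive (≡.trans (ℚ.+-assoc (seq z i) δ δ) (≡.cong (seq z i ℚ.+_) δ+δ≡ε))))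

  +-mono-≤ : ∀ {x y u v} → x ≤ y → u ≤ v → x + u ≤ y + v
  +-mono-≤ {x} {y} {u} {v} p q ε 0<ε with half ε 0<ε
  ... | δ , 0<δ , δ+δ≡ε = eventually₂ combine (p δ 0<δ) (q δ 0<δ)
    where
    open OrderedRingProperties ℚ-orderedRing using (module Solver)
    open Solver using (solve; _:=_; _:+_)
    combine : ∀ i → seq x i ℚ.≤ seq y i ℚ.+ δ → seq u i ℚ.≤ seq v i ℚ.+ δ →
              seq x i ℚ.+ seq u i ℚ.≤ (seq y i ℚ.+ seq v i) ℚ.+ ε
    combine i a b = ℚ.≤-trans (ℚ.+-mono-≤ a b) (ℚ.≤-reflexive (≡.trans
      (solve 3 (λ y v d → (y :+ d) :+ (v :+ d) := (y :+ v) :+ (d :+ d)) ≡.refl (seq y i) (seq v i) δ)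
      (≡.cong ((seq y i ℚ.+ seq v i) ℚ.+_) δ+δ≡ε)))

  bounded : ∀ x → ∃ λ B → 0ℚ ℚ.< B × Eventually (λ i → 0ℚ ℚ.≤ seq x i ℚ.+ B × seq x i ℚ.≤ B)
  bounded x with cauchy x 1ℚ (ℚ.positive⁻¹ 1ℚ)
  ... | N , close = B , ℚ.+-mono-≤-< (ℚ.0≤∣p∣ (seq x N)) (ℚ.positive⁻¹ 1ℚ) , N , λ i r →
      below i (∣p-q∣≤r⇒p≤q+r (seq x N) (seq x i) 1ℚ (close N i ℕ.≤-refl r)) ,
      above i (∣p-q∣≤r⇒p≤q+r (seq x i) (seq x N) 1ℚ (close i N r ℕ.≤-refl))
    where
    B : ℚ
    B = ∣ seq x N ∣ ℚ.+ 1ℚ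
    above : ∀ i → seq x i ℚ.≤ seq x N ℚ.+ 1ℚ → seq x i ℚ.≤ B
    above i a = ℚ.≤-trans a (ℚ.+-monoˡ-≤ 1ℚ (p≤∣p∣ (seq x N)))
    below : ∀ i → seq x N ℚ.≤ seq x i ℚ.+ 1ℚ → 0ℚ ℚ.≤ seq x i ℚ.+ B
    below i a = ℚ.≤-trans (0≤p+∣p∣ (seq x N)) (ℚ.≤-trans (ℚ.+-monoˡ-≤ ∣ seq x N ∣ a)
      (ℚ.≤-reflexive (≡.trans (ℚ.+-assoc (seq x i) 1ℚ ∣ seq x N ∣)
        (≡.cong (seq x i ℚ.+_) (ℚ.+-comm 1ℚ ∣ seq x N ∣)))))

  *-nonNeg : ∀ {x y} → 0ℝ ≤ x → 0ℝ ≤ y → 0ℝ ≤ x * y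
  *-nonNeg {x} {y} 0≤x 0≤y ε 0<ε with half ε 0<ε | bounded x | bounded y
  ... | ε′ , 0<ε′ , ε′+ε′≡ε | B , 0<B , x-bound | C , 0<C , y-bound with quotient ε′ B 0<ε′ 0<B
  -- `δ` is chosen after `η`, because its coefficient is the bound `C + η` on `y + η`.
  ...   | η , 0<η , Bη≡ with quotient ε′ (C ℚ.+ η) 0<ε′ (ℚ.+-mono-< 0<C 0<η)
  ...     | δ , 0<δ , Cδ≡ = eventually₂ combine
              (eventually₂ {λ i → 0ℚ ℚ.≤ seq x i ℚ.+ δ} {λ i → 0ℚ ℚ.≤ seq y i ℚ.+ η} (λ i → _,_) (0≤x δ 0<δ) (0≤y η 0<η))
              (eventually₂ (λ i (_ , b) (_ , c) → b , c) x-bound y-bound)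
    where
    combine : ∀ i → 0ℚ ℚ.≤ seq x i ℚ.+ δ × 0ℚ ℚ.≤ seq y i ℚ.+ η → seq x i ℚ.≤ B × seq y i ℚ.≤ C →
              0ℚ ℚ.≤ seq x i ℚ.* seq y i ℚ.+ ε
    combine i (p , q) (b , c) = ℚ.≤-trans
      (product-nearly-nonNeg {seq x i} {seq y i} {δ} {η} {B} {C ℚ.+ η} p q (ℚ.<⇒≤ 0<δ) (ℚ.<⇒≤ 0<η) b (ℚ.+-monoˡ-≤ η c))
      (ℚ.≤-reflexive (≡.cong (seq x i ℚ.* seq y i ℚ.+_) (≡.trans (≡.cong₂ ℚ._+_ Bη≡ Cδ≡) ε′+ε′≡ε)))

  -- The sign of `y` is unknown, so even this one inequality uses both halves of the equivalence.
  *-congʳ-≤ : ∀ {x x′} y → x ≃ x′ → x * y ≤ x′ * y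
  *-congʳ-≤ {x} {x′} y (p , q) ε 0<ε with bounded y
  ... | B , 0<B , y-bound with quotient ε (B ℚ.+ (B ℚ.+ B)) 0<ε (ℚ.+-mono-< 0<B (ℚ.+-mono-< 0<B 0<B))
  ...   | δ , 0<δ , 3Bδ≡ε = eventually₂ combine y-bound
              (eventually₂ {λ i → seq x i ℚ.≤ seq x′ i ℚ.+ δ} {λ i → seq x′ i ℚ.≤ seq x i ℚ.+ δ} (λ i → _,_) (p δ 0<δ) (q δ 0<δ))
    where
    combine : ∀ i → 0ℚ ℚ.≤ seq y i ℚ.+ B × seq y i ℚ.≤ B →
              seq x i ℚ.≤ seq x′ i ℚ.+ δ × seq x′ i ℚ.≤ seq x i ℚ.+ δ →
              seq x i ℚ.* seq y i ℚ.≤ seq x′ i ℚ.* seq y i ℚ.+ ε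
    combine i (b , c) (r , s) = ℚ.≤-trans
      (product-nearly-equal {seq x i} {seq x′ i} {seq y i} {δ} {B} r s (ℚ.<⇒≤ 0<δ) b c (ℚ.<⇒≤ 0<B))
      (ℚ.≤-reflexive (≡.cong (seq x′ i ℚ.* seq y i ℚ.+_) 3Bδ≡ε))

  ≃-trans : ∀ {x y z} → x ≃ y → y ≃ z → x ≃ z
  ≃-trans {x} {y} {z} (p , q) (r , s) = ≤-trans {x} {y} {z} p r , ≤-trans {z} {y} {x} s q

  *-congʳ : ∀ {x x′} y → x ≃ x′ → x * y ≃ x′ * y
  *-congʳ {x} {x′} y (p , q) = *-congʳ-≤ {x} {x′} y (p , q) , *-congʳ-≤ {x′} {x} y (q , p)

  *-comm : ∀ x y → x * y ≃ y * x
  *-comm x y = pointwise-≃ {x * y} {y * x} (λ i → ℚ.*-comm (seq x i) (seq y i))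

  *-cong : ∀ {x x′ y y′} → x ≃ x′ → y ≃ y′ → x * y ≃ x′ * y′
  *-cong {x} {x′} {y} {y′} p q = ≃-trans {x * y} {x′ * y} {x′ * y′} (*-congʳ {x} {x′} y p)
    (≃-trans {x′ * y} {y * x′} {x′ * y′} (*-comm x′ y)
      (≃-trans {y * x′} {y′ * x′} {x′ * y′} (*-congʳ {y} {y′} x′ q) (*-comm y′ x′)))

  infix 8 -_
  -- Multiplication by -1 reuses the Cauchy proof of `_*_`.
  -_ : ℝ → ℝ
  - x = fromℚ (ℚ.- 1ℚ) * x

  private
    neg : ∀ x i → seq (- x) i ≡ ℚ.- seq x i
    neg x i = ≡.trans (≡.sym (ℚ.neg-distribˡ-* 1ℚ (seq x i))) (≡.cong ℚ.-_ (ℚ.*-identityˡ (seq x i)))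

  isPartialOrder : IsPartialOrder _≃_ _≤_
  isPartialOrder = record
    { isPreorder = record
      { isEquivalence = record
        { refl  = λ {x} → ≤-refl {x} , ≤-refl {x}
        ; sym   = λ (p , q) → q , p
        ; trans = λ {x} {y} {z} → ≃-trans {x} {y} {z}
        }
      ; reflexive = proj₁
      ; trans     = λ {x} {y} {z} → ≤-trans {x} {y} {z}
      }
    ; antisym = _,_
    }

  commutativeRing : CommutativeRing _ _
  commutativeRing = record
    { Carrier = ℝ ; _≈_ = _≃_ ; _+_ = _+_ ; _*_ = _*_ ; -_ = -_ ; 0# = 0ℝ ; 1# = 1ℝ
    ; isCommutativeRing = record
      { isRing = record
        { +-isAbelianGroup = record
          { isGroup = record
            { isMonoid = record
              { isSemigroup = record
                { isMagma = record
                  { isEquivalence = IsPartialOrder.isEquivalence isPartialOrder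
                  ; ∙-cong = λ {x} {y} {u} {v} (p , q) (r , s) →
                      +-mono-≤ {x} {y} {u} {v} p r , +-mono-≤ {y} {x} {v} {u} q s
                  }
                ; assoc = λ x y z → pointwise-≃ {(x + y) + z} {x + (y + z)} (λ i → ℚ.+-assoc (seq x i) (seq y i) (seq z i))
                }
              ; identity = (λ x → pointwise-≃ {0ℝ + x} {x} (λ i → ℚ.+-identityˡ (seq x i))) ,
                           (λ x → pointwise-≃ {x + 0ℝ} {x} (λ i → ℚ.+-identityʳ (seq x i)))
              }
            ; inverse = (λ x → pointwise-≃ {(- x) + x} {0ℝ} (λ i →
                          ≡.trans (≡.cong (ℚ._+ seq x i) (neg x i)) (ℚ.+-inverseˡ (seq x i)))) ,
                        (λ x → pointwise-≃ {x + (- x)} {0ℝ} (λ i →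
                          ≡.trans (≡.cong (seq x i ℚ.+_) (neg x i)) (ℚ.+-inverseʳ (seq x i))))
            ; ⁻¹-cong = λ {x} {y} p → *-cong {fromℚ (ℚ.- 1ℚ)} {fromℚ (ℚ.- 1ℚ)} {x} {y}
                          (≤-refl {fromℚ (ℚ.- 1ℚ)} , ≤-refl {fromℚ (ℚ.- 1ℚ)}) p
            }
          ; comm = λ x y → pointwise-≃ {x + y} {y + x} (λ i → ℚ.+-comm (seq x i) (seq y i))
          }
        ; *-cong = λ {x} {y} {u} {v} → *-cong {x} {y} {u} {v}
        ; *-assoc = λ x y z → pointwise-≃ {(x * y) * z} {x * (y * z)} (λ i → ℚ.*-assoc (seq x i) (seq y i) (seq z i))
        ; *-identity = (λ x → pointwise-≃ {1ℝ * x} {x} (λ i → ℚ.*-identityˡ (seq x i))) ,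
                       (λ x → pointwise-≃ {x * 1ℝ} {x} (λ i → ℚ.*-identityʳ (seq x i)))
        ; distrib = (λ x y z → pointwise-≃ {x * (y + z)} {x * y + x * z}
                      (λ i → ℚ.*-distribˡ-+ (seq x i) (seq y i) (seq z i))) ,
                    (λ x y z → pointwise-≃ {(y + z) * x} {y * x + z * x}
                      (λ i → ℚ.*-distribʳ-+ (seq x i) (seq y i) (seq z i)))
        }
      ; *-comm = *-comm
      }
    }

  ℝ-orderedRing : OrderedRing
  ℝ-orderedRing = record
    { commutativeRing = commutativeRing
    ; _≤_             = _≤_
    ; isPartialOrder  = isPartialOrder
    ; +-mono-≤        = λ {x} {y} {u} {v} → +-mono-≤ {x} {y} {u} {v}
    ; *-nonNeg        = λ {x} {y} → *-nonNeg {x} {y}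
    ; 0≤1             = pointwise-≤ {0ℝ} {1ℝ} (λ _ → ℚ.<⇒≤ (ℚ.positive⁻¹ 1ℚ))
    }

  ε-≤ : ∀ {x y} → (∀ ε → 0ℚ ℚ.< ε → x ≤ y + fromℚ ε) → x ≤ y
  ε-≤ {x} {y} p ε 0<ε with half ε 0<ε
  ... | δ , 0<δ , δ+δ≡ε = eventually (λ i a → ℚ.≤-trans a (ℚ.≤-reflexive
          (≡.trans (ℚ.+-assoc (seq y i) δ δ) (≡.cong (seq y i ℚ.+_) δ+δ≡ε)))) (p δ 0<δ δ 0<δ)

  -- `inv` cuts the sequence off below at `δ`, so the termwise product is known to be 1 only from
  -- index `N` on; hence `half-≤` in place of `pointwise-≃`.
  inv-≃ : ∀ x (0<x : 0ℝ < x) → x * inv x 0<x ≃ 1ℝ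
  inv-≃ x 0<x@(δ , 0<δ , N , δ≤x) = half-≤ (x * inv x 0<x) 1ℝ eq , half-≤ 1ℝ (x * inv x 0<x) (λ i r → ≡.sym (eq i r))
    where
    half-≤ : ∀ u v → (∀ i → N ℕ.≤ i → seq u i ≡ seq v i) → u ≤ v
    half-≤ u v p ε 0<ε = N , λ i r → ℚ.≤-trans (ℚ.≤-reflexive (≡.trans (p i r) (≡.sym (ℚ.+-identityʳ (seq v i)))))
      (ℚ.+-monoʳ-≤ (seq v i) (ℚ.<⇒≤ 0<ε))
    eq : ∀ i → N ℕ.≤ i → seq x i ℚ.* seq (inv x 0<x) i ≡ 1ℚ
    eq i r = ≡.trans (≡.cong (ℚ._* seq (inv x 0<x) i) (≡.sym (ℚ.p≥q⇒p⊔q≡p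
        (ℚ.≤-trans (ℚ.≤-reflexive (≡.sym (ℚ.+-identityˡ δ))) (δ≤x i r)))))
      (inverseʳ (seq x i ℚ.⊔ δ) (max-pos (seq x i) 0<δ))

  inv-nonNeg : ∀ x (0<x : 0ℝ < x) → 0ℝ ≤ inv x 0<x
  inv-nonNeg x 0<x@(δ , 0<δ , _) = pointwise-≤ {0ℝ} {inv x 0<x}
    (λ i → ℚ.<⇒≤ (inverse-pos (seq x i ℚ.⊔ δ) (max-pos (seq x i) 0<δ)))

  upper-bound : ∀ x → ∃ λ B → 0ℚ ℚ.< B × x ≤ fromℚ B
  upper-bound x with bounded x
  ... | B , 0<B , N , b = B , 0<B , λ ε 0<ε → N , λ i r → ℚ.≤-trans (proj₂ (b i r))
          (ℚ.≤-trans (ℚ.≤-reflexive (≡.sym (ℚ.+-identityʳ B))) (ℚ.+-monoʳ-≤ B (ℚ.<⇒≤ 0<ε)))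

-- The Archimedean property and the tolerances of the reals

module Archimedean where

  open ℚ-Lemmas
  open ℝ-Lemmas
  open OrderedRingProperties ℚ-orderedRing using () renaming (fromℕ to multiple)
  open OrderedRingProperties ℝ-orderedRing using (fromℕ)
  module ℝ-ring = OrderedRingProperties ℝ-orderedRing

  toℚᵘ-multiple : ∀ n → toℚᵘ (multiple n) ℚᵘ.≃ mkℚᵘ (+ n) 0
  toℚᵘ-multiple zero    = ℚᵘ.≃-refl
  toℚᵘ-multiple (suc n) = ℚᵘ.≃-trans (ℚ.toℚᵘ-homo-+ 1ℚ (multiple n))
    (ℚᵘ.≃-trans (ℚᵘ.+-congʳ (toℚᵘ 1ℚ) (toℚᵘ-multiple n)) (ℚᵘ.*≡* (≡.cong (λ k → (+ 1 ℤ.+ k) ℤ.* + 1) (ℤ.*-identityʳ (+ n)))))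

  1≤↥ : ∀ p → 0ℚ ℚ.< p → + 1 ℤ.≤ ↥ p
  1≤↥ p 0<p = ℤ.i<j⇒suc[i]≤j (≡.subst (+ 0 ℤ.<_) (ℤ.*-identityʳ (↥ p)) (ℚ.drop-*<* 0<p))

  -- The denominator is the witness: for p = a / (d + 1) the product (d + 1) p is the numerator `a`,
  -- which is at least 1.
  archimedean : ∀ p → 0ℚ ℚ.< p → ∃ λ n → 1ℚ ℚ.≤ multiple (suc n) ℚ.* p
  archimedean p@(mkℚ a d _) 0<p = d , ℚ.toℚᵘ-cancel-≤ (ℚᵘ.≤-respʳ-≃ {toℚᵘ 1ℚ}
    (ℚᵘ.≃-sym (ℚᵘ.≃-trans (ℚ.toℚᵘ-homo-* (multiple (suc d)) p) (ℚᵘ.*-congʳ {toℚᵘ p} (toℚᵘ-multiple (suc d)))))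
    (ℚᵘ.*≤* bound))
    where
    bound : + 1 ℤ.* + (1 ℕ.* suc d) ℤ.≤ (+ suc d ℤ.* a) ℤ.* + 1
    bound = ℤ.≤-trans (ℤ.≤-reflexive lhs) (ℤ.≤-trans (ℤ.*-monoˡ-≤-nonNeg (+ suc d) (1≤↥ p 0<p)) (ℤ.≤-reflexive (≡.sym (ℤ.*-identityʳ (+ suc d ℤ.* a)))))
      where
      lhs : + 1 ℤ.* + (1 ℕ.* suc d) ≡ + suc d ℤ.* + 1
      lhs = ≡.trans (ℤ.*-comm (+ 1) (+ (1 ℕ.* suc d))) (≡.cong (λ k → + k ℤ.* + 1) (ℕ.*-identityˡ (suc d)))

  multiple-pos : ∀ n → 0ℚ ℚ.< multiple (suc n)
  multiple-pos zero    = ℚ.positive⁻¹ (1ℚ ℚ.+ 0ℚ)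
  multiple-pos (suc n) = ℚ.+-mono-< (ℚ.positive⁻¹ 1ℚ) (multiple-pos n)

  seq-fromℕ : ∀ n i → seq (fromℕ n) i ≡ multiple n
  seq-fromℕ zero    i = ≡.refl
  seq-fromℕ (suc n) i = ≡.cong (1ℚ ℚ.+_) (seq-fromℕ n i)

  small-reciprocal : ∀ ε → 0ℚ ℚ.< ε → ∃ λ n → ∃ λ τ → 0ℝ ≤ τ × fromℕ n * τ ≃ 1ℝ × τ ≤ fromℚ ε
  small-reciprocal ε 0<ε with archimedean ε 0<ε
  ... | n , 1≤nε = suc n , fromℚ τ , pointwise-≤ {0ℝ} {fromℚ τ} (λ _ → ℚ.<⇒≤ 0<τ) ,
      pointwise-≃ {fromℕ (suc n) * fromℚ τ} {1ℝ} (λ i → ≡.trans (≡.cong (ℚ._* τ) (seq-fromℕ (suc n) i)) nτ≡1) ,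
      pointwise-≤ {fromℚ τ} {fromℚ ε} (λ _ → ℚ.*-cancelˡ-≤-pos (multiple (suc n)) {{ℚ.positive (multiple-pos n)}}
        (ℚ.≤-trans (ℚ.≤-reflexive nτ≡1) 1≤nε))
    where
    τ : ℚ
    τ = inverse (multiple (suc n)) (multiple-pos n)
    0<τ : 0ℚ ℚ.< τ
    0<τ = inverse-pos (multiple (suc n)) (multiple-pos n)
    nτ≡1 : multiple (suc n) ℚ.* τ ≡ 1ℚ
    nτ≡1 = inverseʳ (multiple (suc n)) (multiple-pos n)

  small-multiple : ∀ x ε → 0ℚ ℚ.< ε → ∃ λ δ → 0ℚ ℚ.< δ × x * fromℚ δ ≤ fromℚ ε
  small-multiple x ε 0<ε with upper-bound x
  ... | B , 0<B , x≤B with quotient ε B 0<ε 0<B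
  ...   | δ , 0<δ , Bδ≡ε = δ , 0<δ , ≤-trans {x * fromℚ δ} {fromℚ δ * x} {fromℚ ε} (proj₁ (*-comm x (fromℚ δ)))
          (≤-trans {fromℚ δ * x} {fromℚ δ * fromℚ B} {fromℚ ε}
            (ℝ-ring.*-monoˡ-≤ {x} {fromℚ B} {fromℚ δ} (pointwise-≤ {0ℝ} {fromℚ δ} (λ _ → ℚ.<⇒≤ 0<δ)) x≤B)
            (pointwise-≤ {fromℚ δ * fromℚ B} {fromℚ ε} (λ _ → ℚ.≤-reflexive (≡.trans (ℚ.*-comm δ B) Bδ≡ε))))

  -- Half of `c` is kept as the margin of the strict inequality; the other half absorbs the slack in
  -- `_≤_`.
  positive : ∀ {c} → 0ℚ ℚ.< c → ∀ t → fromℚ c ≤ t → 0ℝ < t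
  positive {c} 0<c t c≤t with half c 0<c
  ... | c′ , 0<c′ , c′+c′≡c = c′ , 0<c′ , eventually
          (λ i a → ℚ.≤-trans (ℚ.≤-reflexive (ℚ.+-identityˡ c′)) (+-cancelʳ-≤ c′ (ℚ.≤-trans (ℚ.≤-reflexive c′+c′≡c) a)))
          (c≤t c′ 0<c′)

  tolerance : Tolerance ℝ-orderedRing
  tolerance = record
    { Tol         = ∃ λ ε → 0ℚ ℚ.< ε
    ; ⟦_⟧         = λ (ε , _) → fromℚ ε
    ; tol-nonNeg  = λ (ε , 0<ε) → pointwise-≤ {0ℝ} {fromℚ ε} (λ _ → ℚ.<⇒≤ 0<ε)
    ; tol-≤       = λ {x} {y} p → ε-≤ {x} {y} (λ ε 0<ε → p (ε , 0<ε))
    ; tol-*       = λ x (ε , 0<ε) → let δ , 0<δ , p = small-multiple x ε 0<ε in (δ , 0<δ) , p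
    ; tol-1/n     = λ (ε , 0<ε) → small-reciprocal ε 0<ε
    ; tol-inverse = λ (ε , 0<ε) → near-one ε 0<ε
    }
    where
    near-one : ∀ ε → 0ℚ ℚ.< ε → ∃ λ (δ : ∃ λ ε → 0ℚ ℚ.< ε) → ∃ λ ρ → fromℚ (proj₁ δ) ≤ fromℚ ε × 0ℝ ≤ ρ ×
      ρ + fromℚ (proj₁ δ) ≃ 1ℝ × (∀ t → ρ ≤ t → ∃ λ τ → 0ℝ ≤ τ × t * τ ≃ 1ℝ)
    near-one ε 0<ε = (δ , 0<δ) , fromℚ ρ , pointwise-≤ {fromℚ δ} {fromℚ ε} (λ _ → ℚ.p⊓q≤p ε ½) ,
      pointwise-≤ {0ℝ} {fromℚ ρ} (λ _ → ℚ.<⇒≤ 0<ρ) ,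
      pointwise-≃ {fromℚ ρ + fromℚ δ} {1ℝ} (λ _ → x-y+y≈x 1ℚ δ) ,
      λ t ρ≤t → let 0<t = positive 0<ρ t ρ≤t in inv t 0<t , inv-nonNeg t 0<t , inv-≃ t 0<t
      where
      δ ρ : ℚ
      -- The cap at ½ keeps `ρ` at least ½, so everything above `ρ` is strictly positive.
      δ = ε ℚ.⊓ ½
      ρ = 1ℚ ℚ.- δ
      0<δ : 0ℚ ℚ.< δ
      0<δ with ℚ.⊓-sel ε ½
      ... | inj₁ p = ≡.subst (0ℚ ℚ.<_) (≡.sym p) 0<ε
      ... | inj₂ p = ≡.subst (0ℚ ℚ.<_) (≡.sym p) (ℚ.positive⁻¹ ½)
      0<ρ : 0ℚ ℚ.< ρ
      0<ρ = ℚ.<-≤-trans (ℚ.positive⁻¹ ½) (+-cancelʳ-≤ δ (ℚ.≤-trans (ℚ.+-monoʳ-≤ ½ (ℚ.p⊓q≤q ε ½))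
        (ℚ.≤-reflexive (≡.sym (x-y+y≈x 1ℚ δ)))))

-- The given process over the reals

module _ {n m : ℕ} (I : Instance n m) (R : Rule I) where

  open Instance I
  open Rule R

  process : Process I ℝ-Lemmas.ℝ-orderedRing
  process = record
    { mass        = λ i → pmf (𝒟 i)
    ; mass-nonNeg = λ i → nonNeg (𝒟 i)
    ; rule        = choose
    ; rule-nonNeg = choose-nonNeg
    ; rule-true   = choose-false
    ; rule-total  = choose-total
    }

  -- The factors contributed by a single step agree definitionally; only the recursion along the
  -- history needs an induction.
  weight-process : ∀ h → Process.weight process h ≡ weight I R h
  weight-process (start x)    = ≡.refl
  weight-process (step h k x) = ≡.cong (λ w → w * choose h k * resample I k (current I h) x) (weight-process h)

  final-process : ∀ h → Process.final process h ≡ finalLaw I R h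
  final-process h = ≡.cong (λ w → if formula I (current I h) then w else 0ℝ) (weight-process h)

theorem1 : {n m : ℕ} (I : Instance n m) → Extremal I →
    (Z : ℝ) → Prob (productLaw I) (formula I) Z → (0<Z : 0ℝ < Z) →
    (R : Rule I) →
    TerminatesAlmostSurely I R ×
    OutputLaw I R (conditioned (productLaw I) (formula I) Z 0<Z)
theorem1 I extremal Z Z-prob 0<Z R = terminated , distributed
  where
  open Instance I
  open ℝ-Lemmas using (ℝ-orderedRing; inv-≃; inv-nonNeg)
  open OrderedRing ℝ-orderedRing using (reflexive)
  open Process (process I R) using (final)
  open Summation Archimedean.tolerance using (Sums-cong)
  open Convergence Archimedean.tolerance (process I R) extremal (λ i (ε , 0<ε) → total (𝒟 i) ε 0<ε)
    {Z} {inv Z 0<Z} (λ (ε , 0<ε) → Z-prob ε 0<ε) (inv-nonNeg Z 0<Z) (inv-≃ Z 0<Z) using (terminates; output-law)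

  terminated : TerminatesAlmostSurely I R
  terminated ε 0<ε = Sums-cong {f = final} {finalLaw I R} {1ℝ} {1ℝ}
    (λ h → reflexive {final h} {finalLaw I R h} (final-process I R h)) (reflexive {1ℝ} ≡.refl) terminates (ε , 0<ε)

  distributed : OutputLaw I R (conditioned (productLaw I) (formula I) Z 0<Z)
  distributed y ε 0<ε = Sums-cong {f = restrict final} {restrict (finalLaw I R)} {μ} {μ}
    (λ h → reflexive {restrict final h} {restrict (finalLaw I R) h}
      (≡.cong (λ w → if ⌊ assignment-≟ I (current I h) y ⌋ then w else 0ℝ) (final-process I R h)))
    (reflexive {μ} ≡.refl) (output-law y) (ε , 0<ε)
    where
    μ : ℝ
    μ = conditioned (productLaw I) (formula I) Z 0<Z y
    restrict : (History I → ℝ) → History I → ℝ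
    restrict w h = if ⌊ assignment-≟ I (current I h) y ⌋ then w h else 0ℝ
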